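{- Let $\sigma,\tau,\bar\sigma,\bar\tau$ satisfy the Standing Hypothesis. (i) If $a\ge b\ge2$ are integers, then $$\{\sigma,a,b,\tau\,|\,\bar\sigma,1,\bar\tau\}-\{\sigma,a+1,b-1,\tau\,|\,\bar\sigma,1,\bar\tau\}$$ is Schur positive. (ii) If $a\ge2$ and $n\ge2$ are integers, then $$\{\sigma,a^n,\tau\,|\,\bar\sigma,1^{n-1},\bar\tau\}-\{\sigma,a+1,a^{n-2},a-1,\tau\,|\,\bar\sigma,1^{n-1},\bar\tau\}$$ is Schur positive.
   Context: A symmetric function is Schur positive if it is a linear combination of Schur functions $s_\nu$ with non-negative coefficients. Overlap notation: for $\alpha=(\alpha_1,\dots,\alpha_L)$ with $\alpha_i\ge1$ and $\beta=(\beta_1,\dots,\beta_{L-1})$ with $0\le\beta_i\le\min\{\alpha_i,\alpha_{i+1}\}$, $(\alpha\,|\,\beta)$ is the skew diagram $\lambda/\mu$ (boxes $(i,j)$ with $\mu_i<j\le\lambda_i$, identified up to deleting empty rows/columns) with $L$ nonempty rows, $\lambda_i-\mu_i=\alpha_i$, $\lambda_{i+1}-\mu_i=\beta_i$ (row $i$ has $\alpha_i$ boxes, rows $i,i+1$ share $\beta_i$ columns); $\{\alpha\,|\,\beta\}=s_{\lambda/\mu}$ is its skew Schur function (generating function of semistandard Young tableaux of that shape). Commas denote concatenation of sequences; $a^j$ denotes $j$ copies of $a$ (empty if $j=0$). Standing Hypothesis: $\sigma=(\sigma_1,\dots,\sigma_s)$, $\tau=(\tau_1,\dots,\tau_t)$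 compositions, $s,t\ge0$; $\bar\sigma,\bar\tau$ sequences of non-negative integers of lengths $s,t$; $\bar\sigma_s=1$ if $s>0$; $\bar\tau_1=1$ if $t>0$; $\bar\sigma_i\le\min\{\sigma_i,\sigma_{i+1}\}$ ($1\le i<s$), $\bar\tau_i\le\min\{\tau_i,\tau_{i-1}\}$ ($1<i\le t$). -}

module Defs where

open import Data.Nat.Base as ℕ using (ℕ; zero; suc; _+_; _∸_; _⊓_; _≤_; _≥_)
import Data.Nat.Properties as ℕ
open import Data.Integer.Base as ℤ using (ℤ; +_)
open import Data.Fin.Base as Fin using (Fin; toℕ)
import Data.Fin.Properties as Fin
open import Data.Vec.Base as Vec using (Vec; []; _∷_; lookup)
open import Data.List.Base as List
  using (List; []; _∷_; [_]; map; foldr; length; filter; allFin; cartesianProductWith; _++_)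
open import Data.List.Relation.Unary.All using (All; []; _∷_)
open import Data.List.Relation.Unary.Linked using (Linked)
open import Data.Product.Base using (_×_; _,_; ∃-syntax)
open import Data.Unit.Base using (⊤; tt)
open import Relation.Binary.PropositionalEquality.Core using (_≡_)
open import Relation.Nullary.Decidable using (Dec; yes; _×-dec_; _→-dec_)

-- Row i of λ/μ is the pair (μᵢ , λᵢ); its boxes are the (i , j) with μᵢ < j ≤ λᵢ.
record Row : Set where
  constructor row
  field
    inner outer : ℕ

  size : ℕ
  size = outer ∸ inner

open Row public

-- Rows are listed from top to bottom (English notation).
SkewDiagram : Set
SkewDiagram = List Row

-- A filling by the m-letter alphabet Fin m, row by row; the k-th entry
-- (k = 0, 1, …) of the row (μᵢ , λᵢ) occupies the column μᵢ + k + 1.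
Filling : ℕ → SkewDiagram → Set
Filling m = All (λ r → Vec (Fin m) (size r))

WeaklyIncreasing : ∀ {m k} → Vec (Fin m) k → Set
WeaklyIncreasing u = ∀ i j → i Fin.≤ j → lookup u i Fin.≤ lookup u j

ColumnStrict : ∀ {m} (r r′ : Row) → Vec (Fin m) (size r) → Vec (Fin m) (size r′) → Set
ColumnStrict r r′ u v =
  ∀ i j → inner r + toℕ i ≡ inner r′ + toℕ j → lookup u i Fin.< lookup v j

-- The columns of a skew diagram are contiguous, so comparing consecutive rows
-- is enough.
Semistandard : ∀ {m} D → Filling m D → Set
Semistandard []           []          = ⊤
Semistandard (_ ∷ [])     (u ∷ [])    = WeaklyIncreasing u
Semistandard (r ∷ r′ ∷ D) (u ∷ v ∷ T) =
  WeaklyIncreasing u × ColumnStrict r r′ u v × Semistandard (r′ ∷ D) (v ∷ T)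

entries : ∀ {m} D → Filling m D → List (Fin m)
entries []      []      = []
entries (_ ∷ D) (u ∷ T) = Vec.toList u ++ entries D T

-- The exponent list w = (w₁, …, wₘ) stands for the monomial x₁^w₁ ⋯ xₘ^wₘ.
HasContent : ∀ (w : List ℕ) D → Filling (length w) D → Set
HasContent w D T = ∀ i → length (filter (i Fin.≟_) (entries D T)) ≡ List.lookup w i

weaklyIncreasing? : ∀ {m k} (u : Vec (Fin m) k) → Dec (WeaklyIncreasing u)
weaklyIncreasing? u = Fin.all? λ i → Fin.all? λ j →
  (i Fin.≤? j) →-dec (lookup u i Fin.≤? lookup u j)

columnStrict? : ∀ {m} r r′ (u : Vec (Fin m) (size r)) (v : Vec (Fin m) (size r′)) →
                Dec (ColumnStrict r r′ u v)
columnStrict? r r′ u v = Fin.all? λ i → Fin.all? λ j →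
  (inner r + toℕ i ℕ.≟ inner r′ + toℕ j) →-dec (lookup u i Fin.<? lookup v j)

semistandard? : ∀ {m} D (T : Filling m D) → Dec (Semistandard D T)
semistandard? []           []          = yes tt
semistandard? (_ ∷ [])     (u ∷ [])    = weaklyIncreasing? u
semistandard? (r ∷ r′ ∷ D) (u ∷ v ∷ T) =
  weaklyIncreasing? u ×-dec columnStrict? r r′ u v ×-dec semistandard? (r′ ∷ D) (v ∷ T)

hasContent? : ∀ w D (T : Filling (length w) D) → Dec (HasContent w D T)
hasContent? w D T = Fin.all? λ i →
  length (filter (i Fin.≟_) (entries D T)) ℕ.≟ List.lookup w i

words : ∀ m k → List (Vec (Fin m) k)
words m zero    = [ [] ]
words m (suc k) = cartesianProductWith _∷_ (allFin m) (words m k)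

fillings : ∀ m D → List (Filling m D)
fillings m []      = [ [] ]
fillings m (r ∷ D) = cartesianProductWith _∷_ (words m (size r)) (fillings m D)

-- A formal power series in x₁, x₂, … is given by its coefficients. Exponent
-- lists differing by trailing zeros name the same monomial; the series built
-- below take equal values on them.
Series : Set
Series = List ℕ → ℤ

infixl 6 _⊖_
_⊖_ : Series → Series → Series
(f ⊖ g) w = f w ℤ.- g w

-- A tableau contributing to the coefficient of x₁^w₁ ⋯ xₘ^wₘ has all its
-- entries among the first m letters.
skewSchur : SkewDiagram → Series
skewSchur D w =
  + length (filter (λ T → semistandard? D T ×-dec hasContent? w D T) (fillings (length w) D))

record Partition : Set where
  field
    parts      : List ℕ
    positive   : All (1 ≤_) parts
    decreasing : Linked _≥_ parts

open Partition public

schur : Partition → Series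
schur ν = skewSchur (map (row 0) (parts ν))

linearCombination : List (ℕ × Partition) → Series
linearCombination cs w = foldr (λ (c , ν) z → + c ℤ.* schur ν w ℤ.+ z) ℤ.0ℤ cs

-- Natural-number coefficients lose nothing: Schur functions form a ℤ-basis of
-- the symmetric functions with integer coefficients. Symmetry of f is implied.
SchurPositive : Series → Set
SchurPositive f = ∃[ cs ] ∀ w → f w ≡ linearCombination cs w

topOuter : SkewDiagram → ℕ
topOuter []      = 0
topOuter (r ∷ _) = outer r

-- (α | β), built from the bottom row, which starts in column 1, by solving
-- λᵢ₊₁ − μᵢ = βᵢ and λᵢ − μᵢ = αᵢ for μᵢ and λᵢ. The subtraction is exact because
-- βᵢ ≤ αᵢ₊₁ ≤ λᵢ₊₁. Only arguments with length α = length β + 1 are meaningful.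
overlapDiagram : List ℕ → List ℕ → SkewDiagram
overlapDiagram []      _       = []
overlapDiagram (a ∷ _) []      = [ row 0 a ]
overlapDiagram (a ∷ α) (b ∷ β) = row μ (μ + a) ∷ D
  where
  D = overlapDiagram α β
  μ = topOuter D ∸ b

⟦_∣_⟧ : List ℕ → List ℕ → Series
⟦ α ∣ β ⟧ = skewSchur (overlapDiagram α β)

-- Indices are shifted to 0, …, s − 1 and 0, …, t − 1; consecutive indices are
-- expressed through toℕ.
record StandingHypothesis {s t : ℕ} (σ σ̄ : Vec ℕ s) (τ τ̄ : Vec ℕ t) : Set where
  field
    σ-positive : ∀ i → 1 ≤ lookup σ i
    τ-positive : ∀ i → 1 ≤ lookup τ i
    σ̄-last     : ∀ i → suc (toℕ i) ≡ s → lookup σ̄ i ≡ 1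
    τ̄-first    : ∀ i → toℕ i ≡ 0 → lookup τ̄ i ≡ 1
    σ̄-bound    : ∀ i j → toℕ j ≡ suc (toℕ i) → lookup σ̄ i ≤ lookup σ i ⊓ lookup σ j
    τ̄-bound    : ∀ i j → toℕ i ≡ suc (toℕ j) → lookup τ̄ i ≤ lookup τ i ⊓ lookup τ j

{-# OPTIONS --safe #-}
module Submission where

-- By the Littlewood–Richardson rule, s_{λ/μ} is the sum of s_ν over the
-- Littlewood–Richardson fillings of λ/μ, ν being the content. The rule is proved
-- by RSK growth diagrams: a tableau, read one letter at a time, corresponds to a
-- Littlewood–Richardson filling together with a chain of horizontal strips
-- leading from ∅ to ν, and a straight shape ν has a single such filling.
--
-- It then suffices to inject the Littlewood–Richardson fillings of the second
-- diagram into those of the first, preserving the content. Overlap 1 of two rows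
-- A, B means that some letter of A is smaller than some letter of B. The crystal
-- operator on two consecutive rows brackets the letters of B with smaller letters
-- of A and moves the smallest unbracketed letter of A down to B. It is injective,
-- keeps the filling Yamanouchi and the number of brackets, and the largest letter
-- of A survives as soon as two letters of A are unbracketed. This is (i).
--
-- For (ii) every row but the last must pass on one letter. The operators on rows
-- k, k+1 and k+1, k+2 are applied lower one first precisely if there are letters
-- a < b < c in rows k, k+1, k+2. The operators leave this property unchanged, so
-- that the order in which they were applied can be read off the result.

open import Data.Nat.Base using (ℕ; zero; suc; _+_; _∸_; _⊓_; _≤_; _<_; _≥_; s≤s; z≤n; s≤s⁻¹)
import Data.Nat.Properties as ℕ
open import Data.Nat.ListAction using (sum)
import Data.Nat.ListAction.Properties as ListAction
open import Data.Nat.Tactic.RingSolver using (solve-∀)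
open import Data.Integer.Base as ℤ using () renaming (+_ to pos)
import Data.Integer.Properties as ℤ
open import Data.Fin.Base as Fin using (Fin; zero; suc; toℕ; fromℕ<; inject₁)
import Data.Fin.Properties as Fin
open import Data.List.Base as List
  using (List; []; _∷_; _++_; map; length; replicate; filter; upTo; concatMap; cartesianProductWith)
import Data.List.Properties as List
open import Data.List.Membership.Propositional using (_∈_)
open import Data.List.Membership.Propositional.Properties
open import Data.List.Relation.Unary.Any using (here; there)
open import Data.List.Relation.Unary.All as All using (All; []; _∷_)
import Data.List.Relation.Unary.All.Properties as All
open import Data.List.Relation.Unary.AllPairs using ([]; _∷_)
open import Data.List.Relation.Unary.Linked using (Linked; []; [-]; _∷_)
open import Data.List.Relation.Unary.Unique.Propositional using (Unique)
import Data.List.Relation.Unary.Unique.Propositional.Properties as Unique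
open import Data.List.Relation.Binary.Permutation.Propositional using (_↭_; ↭-refl; ↭-trans; prep)
import Data.List.Relation.Binary.Permutation.Propositional.Properties as Perm
open import Data.Vec.Base as Vec using (Vec; []; _∷_; zipWith; lookup; updateAt; head; tail; toList)
import Data.Vec.Properties as Vec
open import Data.Vec.Relation.Unary.All as VecAll using ([]; _∷_)
open import Data.Product.Base using (∃; ∃-syntax; ∃₂; _×_; _,_; proj₁; proj₂)
open import Data.Sum.Base using (_⊎_; inj₁; inj₂)
open import Data.Unit.Base using (⊤; tt)
open import Data.Empty using (⊥)
open import Function.Base using (_∘_)
open import Relation.Nullary using (¬_; Dec; yes; no; contradiction; _×-dec_; _⊎-dec_)
open import Relation.Unary using (Decidable)
open import Relation.Binary.PropositionalEquality
open import Defs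

-- What has to be protected in (ii) is the overlap with the row above: a move out of a row may take
-- its largest letter unless two of its letters are unbracketed. Let A, B, C be consecutive rows,
-- and let A and B have the common length. If there are no letters a < b < c in them, the overlap of
-- B and C forces some letter of B to be at most every letter of A. It stays unbracketed, so A has a
-- letter to move. Afterwards B has one letter too many, and so keeps its largest letter when it
-- passes one on. If there are letters a < b < c, all of B may be bracketed with A and nothing can
-- move down from A. Passing a letter from B to C beforehand makes B one letter short and leaves a
-- letter of A unbracketed. Now B may lose its largest letter, but a triple a < b < c survives the
-- move and keeps A and B overlapping.

-- Finite enumerations, injections and bijections

record Enumerates {A : Set} (P : A → Set) (xs : List A) : Set where
  field
    unique   : Unique xs
    sound    : ∀ {x} → x ∈ xs → P x
    complete : ∀ {x} → P x → x ∈ xs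

open Enumerates

-- Each image is removed from `ys` before the rest is embedded; injectivity keeps the later images
-- in what remains. The surplus `zs` matters most: for fillings it lists the ν of the Schur
-- expansion. A relation serves better than a function because the images of fillings come from
-- existence proofs.
embedding : ∀ {A B C : Set} (_~_ : A → B → Set) (c : A → C) (d : B → C) →
            (∀ {x x′ y} → x ~ y → x′ ~ y → x ≡ x′) →
            ∀ {xs ys} → Unique xs → (∀ {x} → x ∈ xs → ∃[ y ] y ∈ ys × x ~ y × c x ≡ d y) →
            ∃[ zs ] map d ys ↭ map c xs ++ zs
embedding _~_ c d inj {[]}     {ys} _            _     = map d ys , ↭-refl
embedding _~_ c d inj {x ∷ xs} {ys} (x∉xs ∷ uniq) into with into (here refl)
... | y , y∈ys , x~y , eq with ∈-∃++ y∈ys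
... | as , bs , refl with embedding _~_ c d inj {xs} {as ++ bs} uniq into′
  where
  into′ : ∀ {x′} → x′ ∈ xs → ∃[ y′ ] y′ ∈ as ++ bs × x′ ~ y′ × c x′ ≡ d y′
  into′ x′∈ with into (there x′∈)
  ... | y′ , y′∈ , x′~y′ , eq′ with ∈-++⁻ as y′∈
  ... | inj₁ p            = y′ , ∈-++⁺ˡ p , x′~y′ , eq′
  ... | inj₂ (there p)    = y′ , ∈-++⁺ʳ as p , x′~y′ , eq′
  ... | inj₂ (here refl)  = contradiction (inj x~y x′~y′) (All.lookup x∉xs x′∈)
... | zs , p = zs , ↭-trans (Perm.map⁺ d (Perm.shift y as bs))
  (subst (λ z → z ∷ map d (as ++ bs) ↭ c x ∷ map c xs ++ zs) eq (prep (c x) p))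

length-≤ : ∀ {A B : Set} (f : A → B) {xs : List A} {ys : List B} → Unique xs →
           (∀ {x} → x ∈ xs → f x ∈ ys) →
           (∀ {x y} → x ∈ xs → y ∈ xs → f x ≡ f y → x ≡ y) →
           length xs ≤ length ys
length-≤ f {xs} {ys} uniq into inj
  with embedding (λ x y → x ∈ xs × f x ≡ y) (λ _ → tt) (λ _ → tt)
         (λ { (p , refl) (q , eq) → inj p q (sym eq) }) {xs} {ys} uniq
         (λ {x} p → f x , into p , (p , refl) , refl)
... | zs , p = begin
  length xs                                    ≡⟨ List.length-map (λ _ → tt) xs ⟨
  length (map (λ _ → tt) xs)                   ≤⟨ ℕ.m≤m+n _ (length zs) ⟩
  length (map (λ _ → tt) xs) + length zs       ≡⟨ List.length-++ (map (λ _ → tt) xs) ⟨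
  length (map (λ _ → tt) xs ++ zs)             ≡⟨ Perm.↭-length p ⟨
  length (map (λ _ → tt) ys)                   ≡⟨ List.length-map (λ _ → tt) ys ⟩
  length ys                                    ∎
  where open ℕ.≤-Reasoning

module _ {A B : Set} {P : A → Set} {Q : B → Set} (f : A → B) (g : B → A)
         (to : ∀ {x} → P x → Q (f x)) (from : ∀ {y} → Q y → P (g y))
         (gf : ∀ {x} → P x → g (f x) ≡ x) (fg : ∀ {y} → Q y → f (g y) ≡ y) where

  bijection-length : ∀ {xs ys} → Enumerates P xs → Enumerates Q ys → length xs ≡ length ys
  bijection-length E F = ℕ.≤-antisym
    (length-≤ f (unique E) (λ p → complete F (to (sound E p)))
      λ p q eq → trans (sym (gf (sound E p))) (trans (cong g eq) (gf (sound E q))))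
    (length-≤ g (unique F) (λ p → complete E (from (sound F p)))
      λ p q eq → trans (sym (fg (sound F p))) (trans (cong f eq) (fg (sound F q))))

image-enumerates : ∀ {A B : Set} {P : A → Set} {Q : B → Set} (f : A → B) →
  (∀ {x} → P x → Q (f x)) →
  (∀ {x y} → P x → P y → f x ≡ f y → x ≡ y) →
  (∀ {y} → Q y → ∃[ x ] P x × f x ≡ y) →
  ∀ {xs} → Enumerates P xs → Enumerates Q (map f xs)
image-enumerates {P = P} {Q} f to injective surjective {xs} E = record
  { unique   = uniq (unique E) (sound E)
  ; sound    = λ p → at-image (∈-map⁻ f p)
  ; complete = λ q → let x , p , eq = surjective q in subst (_∈ map f xs) eq (∈-map⁺ f (complete E p))
  }
  where
  at-image : ∀ {y} → (∃ λ x → x ∈ xs × y ≡ f x) → Q y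
  at-image (x , p , refl) = to (sound E p)

  uniq : ∀ {xs} → Unique xs → (∀ {x} → x ∈ xs → P x) → Unique (map f xs)
  uniq []       _ = []
  uniq {x ∷ xs} (x∉ ∷ u) s = All.tabulate (λ y∈ eq → distinct y∈ eq) ∷ uniq u (λ p → s (there p))
    where
    distinct : ∀ {y} → y ∈ map f xs → f x ≡ y → ⊥
    distinct y∈ refl with ∈-map⁻ f y∈
    ... | z , z∈ , eq = All.lookup x∉ z∈ (injective (s (here refl)) (s (there z∈)) eq)

module _ {A B : Set} {P : A → Set} {Q : A → B → Set} {xs : List A} {ys : A → List B}
         (E : Enumerates P xs) (F : ∀ {x} → P x → Enumerates (Q x) (ys x)) where

  pairs : List A → List (A × B)
  pairs = concatMap λ x → map (x ,_) (ys x)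

  private
    ∈-pairs⁻ : ∀ zs {x y} → (x , y) ∈ pairs zs → x ∈ zs × y ∈ ys x
    ∈-pairs⁻ (z ∷ zs) p with ∈-++⁻ (map (z ,_) (ys z)) p
    ... | inj₂ q = there (proj₁ (∈-pairs⁻ zs q)) , proj₂ (∈-pairs⁻ zs q)
    ... | inj₁ q with ∈-map⁻ (z ,_) q
    ... | _ , r , refl = here refl , r

    ∈-pairs⁺ : ∀ {zs x y} → x ∈ zs → y ∈ ys x → (x , y) ∈ pairs zs
    ∈-pairs⁺ (here refl) q = ∈-++⁺ˡ (∈-map⁺ _ q)
    ∈-pairs⁺ {z ∷ zs} (there p) q = ∈-++⁺ʳ (map (z ,_) (ys z)) (∈-pairs⁺ p q)

    pairs-unique : ∀ zs → Unique zs → (∀ {x} → x ∈ zs → P x) → Unique (pairs zs)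
    pairs-unique []       _        _ = []
    pairs-unique (z ∷ zs) (z∉ ∷ u) s = Unique.++⁺
      (Unique.map⁺ (λ { refl → refl }) (unique (F (s (here refl)))))
      (pairs-unique zs u (λ p → s (there p)))
      λ { (p , q) → disjoint p q }
      where
      disjoint : ∀ {v} → v ∈ map (z ,_) (ys z) → v ∈ pairs zs → ⊥
      disjoint p q with ∈-map⁻ (z ,_) p
      ... | _ , _ , refl = All.lookup z∉ (proj₁ (∈-pairs⁻ zs q)) refl

  pairs-enumerate : Enumerates (λ (x , y) → P x × Q x y) (pairs xs)
  pairs-enumerate = record
    { unique   = pairs-unique xs (unique E) (sound E)
    ; sound    = λ p → let p₁ , p₂ = ∈-pairs⁻ xs p in sound E p₁ , sound (F (sound E p₁)) p₂
    ; complete = λ (p , q) → ∈-pairs⁺ (complete E p) (complete (F p) q)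
    }

  length-pairs : ∀ zs → length (pairs zs) ≡ sum (map (length ∘ ys) zs)
  length-pairs []       = refl
  length-pairs (z ∷ zs) = trans (List.length-++ (map (z ,_) (ys z)))
    (cong₂ _+_ (List.length-map (z ,_) (ys z)) (length-pairs zs))

filter-enumerates : ∀ {A : Set} {P Q : A → Set} (Q? : Decidable Q) {xs} →
                    Enumerates P xs → Enumerates (λ x → P x × Q x) (filter Q? xs)
filter-enumerates Q? E = record
  { unique   = Unique.filter⁺ Q? (unique E)
  ; sound    = λ p → let q , r = ∈-filter⁻ Q? p in sound E q , r
  ; complete = λ (p , q) → ∈-filter⁺ Q? (complete E p) q
  }

enumerates-⇔ : ∀ {A : Set} {P Q : A → Set} → (∀ {x} → P x → Q x) → (∀ {x} → Q x → P x) →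
               ∀ {xs} → Enumerates P xs → Enumerates Q xs
enumerates-⇔ to from E = record
  { unique = unique E ; sound = λ p → to (sound E p) ; complete = λ q → complete E (from q) }

-- The local rule of growth diagrams

infixl 6 _⊕_
_⊕_ : ∀ {n} → Vec ℕ n → Vec ℕ n → Vec ℕ n
_⊕_ = zipWith _+_

𝟎 : ∀ {n} → Vec ℕ n
𝟎 = Vec.replicate _ 0

-- p is the part preceding ν.
Strip : ∀ {n} → ℕ → Vec ℕ n → Vec ℕ n → Set
Strip p []      []       = ⊤
Strip p (c ∷ ν) (x ∷ xs) = c + x ≤ p × Strip c ν xs

HorizontalStrip : ∀ {n} → Vec ℕ n → Vec ℕ n → Set
HorizontalStrip []      []       = ⊤
HorizontalStrip (c ∷ ν) (_ ∷ xs) = Strip c ν xs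

-- A row is given by the multiplicities of its letters. This is the number of letters
-- of the lower row left over when letters of the lower row are bracketed with
-- smaller letters of the upper row.
unmatched : ∀ {n} → Vec ℕ n → Vec ℕ n → ℕ
unmatched []       []       = 0
unmatched (x ∷ xs) (y ∷ ys) = (unmatched xs ys ∸ x) + y

-- The local rule of RSK growth diagrams for the square a, a ⊕ x, a ⊕ y with label k:
-- the fourth corner is (a ⊕ y) ⊕ rowAfter k x y = (a ⊕ x) ⊕ stripAfter k x y. The usual
-- formula (a + x) ⊔ (a + y) + carry for its parts depends on a only through these differences.
rowAfter : ∀ {n} → ℕ → Vec ℕ n → Vec ℕ n → Vec ℕ n
rowAfter k []       []       = []
rowAfter k (x ∷ xs) (y ∷ ys) = (x ∸ y) + k ∷ rowAfter (x ⊓ y) xs ys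

stripAfter : ∀ {n} → ℕ → Vec ℕ n → Vec ℕ n → Vec ℕ n
stripAfter k []       []       = []
stripAfter k (x ∷ xs) (y ∷ ys) = (y ∸ x) + k ∷ stripAfter (x ⊓ y) xs ys

-- The amount that the last part would hand on to a further part. It has to vanish for the square to
-- be invertible and for the row to gain exactly `k` letters.
overflow : ∀ {n} → ℕ → Vec ℕ n → Vec ℕ n → ℕ
overflow k []       []       = k
overflow k (x ∷ xs) (y ∷ ys) = overflow (x ⊓ y) xs ys

-- This recovers the label of a square: one of `x ∸ y` and `y ∸ x` vanishes, so the smaller of
-- `(x ∸ y) + k` and `(y ∸ x) + k` is `k`.
carry : ∀ {n} → Vec ℕ n → Vec ℕ n → ℕ
carry []      []      = 0
carry (x ∷ _) (y ∷ _) = x ⊓ y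

rowBefore : ∀ {n} → Vec ℕ n → Vec ℕ n → Vec ℕ n
rowBefore []       []       = []
rowBefore (x ∷ xs) (y ∷ ys) = (x ∸ y) + carry xs ys ∷ rowBefore xs ys

stripBefore : ∀ {n} → Vec ℕ n → Vec ℕ n → Vec ℕ n
stripBefore []       []       = []
stripBefore (x ∷ xs) (y ∷ ys) = (y ∸ x) + carry xs ys ∷ stripBefore xs ys

stripAfter-swap : ∀ {n} k (x y : Vec ℕ n) → stripAfter k x y ≡ rowAfter k y x
stripAfter-swap k []       []       = refl
stripAfter-swap k (x ∷ xs) (y ∷ ys) =
  cong (_ ∷_) (trans (stripAfter-swap (x ⊓ y) xs ys) (cong (λ c → rowAfter c ys xs) (ℕ.⊓-comm x y)))

∸-⊓-+ : ∀ x y k → ((x ∸ y) + k) ⊓ ((y ∸ x) + k) ≡ k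
∸-⊓-+ zero    zero    k = ℕ.⊓-idem k
∸-⊓-+ zero    (suc y) k = ℕ.m≤n⇒m⊓n≡m (ℕ.m≤n+m k (suc y))
∸-⊓-+ (suc x) zero    k = ℕ.m≥n⇒m⊓n≡n (ℕ.m≤n+m k (suc x))
∸-⊓-+ (suc x) (suc y) k = ∸-⊓-+ x y k

∸-∸-+ : ∀ x y k → ((x ∸ y) + k) ∸ ((y ∸ x) + k) ≡ x ∸ y
∸-∸-+ zero    zero    k = ℕ.n∸n≡0 k
∸-∸-+ zero    (suc y) k = ℕ.m≤n⇒m∸n≡0 (ℕ.m≤n+m k (suc y))
∸-∸-+ (suc x) zero    k = ℕ.m+n∸n≡m (suc x) k
∸-∸-+ (suc x) (suc y) k = ∸-∸-+ x y k

∸-+-⊓ : ∀ x y → (x ∸ y) + (x ⊓ y) ≡ x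
∸-+-⊓ zero    y       = cong (_+ 0) (ℕ.0∸n≡0 y)
∸-+-⊓ (suc x) zero    = ℕ.+-identityʳ (suc x)
∸-+-⊓ (suc x) (suc y) = trans (ℕ.+-suc (x ∸ y) (x ⊓ y)) (cong suc (∸-+-⊓ x y))

∸-+-⊓′ : ∀ x y → (y ∸ x) + (x ⊓ y) ≡ y
∸-+-⊓′ x y = trans (cong ((y ∸ x) +_) (ℕ.⊓-comm x y)) (∸-+-⊓ y x)

+-∸-swap : ∀ x y → y + (x ∸ y) ≡ x + (y ∸ x)
+-∸-swap zero    zero    = refl
+-∸-swap zero    (suc y) = ℕ.+-identityʳ (suc y)
+-∸-swap (suc x) zero    = sym (ℕ.+-identityʳ (suc x))
+-∸-swap (suc x) (suc y) = cong suc (+-∸-swap x y)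

carry-after : ∀ {n} k (x y : Vec ℕ n) → overflow k x y ≡ 0 →
              carry (rowAfter k x y) (stripAfter k x y) ≡ k
carry-after k []      []      p = sym p
carry-after k (x ∷ _) (y ∷ _) _ = ∸-⊓-+ x y k

rowBefore-after : ∀ {n} k (x y : Vec ℕ n) → overflow k x y ≡ 0 →
                  rowBefore (rowAfter k x y) (stripAfter k x y) ≡ x
rowBefore-after k []       []       _ = refl
rowBefore-after k (x ∷ xs) (y ∷ ys) p = cong₂ _∷_
  (trans (cong₂ _+_ (∸-∸-+ x y k) (carry-after (x ⊓ y) xs ys p)) (∸-+-⊓ x y))
  (rowBefore-after (x ⊓ y) xs ys p)

stripBefore-after : ∀ {n} k (x y : Vec ℕ n) → overflow k x y ≡ 0 →
                    stripBefore (rowAfter k x y) (stripAfter k x y) ≡ y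
stripBefore-after k []       []       _ = refl
stripBefore-after k (x ∷ xs) (y ∷ ys) p = cong₂ _∷_
  (trans (cong₂ _+_ (∸-∸-+ y x k) (carry-after (x ⊓ y) xs ys p)) (∸-+-⊓′ x y))
  (stripBefore-after (x ⊓ y) xs ys p)

rowAfter-before : ∀ {n} (x y : Vec ℕ n) →
                  rowAfter (carry x y) (rowBefore x y) (stripBefore x y) ≡ x
rowAfter-before []       []       = refl
rowAfter-before (x ∷ xs) (y ∷ ys) = cong₂ _∷_
  (trans (cong (_+ (x ⊓ y)) (∸-∸-+ x y (carry xs ys))) (∸-+-⊓ x y))
  (trans (cong (λ c → rowAfter c _ _) (∸-⊓-+ x y (carry xs ys))) (rowAfter-before xs ys))

stripAfter-before : ∀ {n} (x y : Vec ℕ n) →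
                    stripAfter (carry x y) (rowBefore x y) (stripBefore x y) ≡ y
stripAfter-before []       []       = refl
stripAfter-before (x ∷ xs) (y ∷ ys) = cong₂ _∷_
  (trans (cong (_+ (x ⊓ y)) (∸-∸-+ y x (carry xs ys))) (∸-+-⊓′ x y))
  (trans (cong (λ c → stripAfter c _ _) (∸-⊓-+ x y (carry xs ys))) (stripAfter-before xs ys))

overflow-before : ∀ {n} (x y : Vec ℕ n) → overflow (carry x y) (rowBefore x y) (stripBefore x y) ≡ 0
overflow-before []       []       = refl
overflow-before (x ∷ xs) (y ∷ ys) =
  trans (cong (λ c → overflow c (rowBefore xs ys) (stripBefore xs ys)) (∸-⊓-+ x y (carry xs ys)))
        (overflow-before xs ys)

sum-rowAfter : ∀ {n} k (x y : Vec ℕ n) → Vec.sum (rowAfter k x y) + overflow k x y ≡ Vec.sum x + k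
sum-rowAfter k []       []       = refl
sum-rowAfter k (x ∷ xs) (y ∷ ys) = begin
  (x ∸ y) + k + S + o               ≡⟨ ℕ.+-assoc ((x ∸ y) + k) S o ⟩
  (x ∸ y) + k + (S + o)             ≡⟨ cong ((x ∸ y) + k +_) (sum-rowAfter (x ⊓ y) xs ys) ⟩
  (x ∸ y) + k + (T + (x ⊓ y))       ≡⟨ rearrange (x ∸ y) k T (x ⊓ y) ⟩
  (x ∸ y) + (x ⊓ y) + T + k         ≡⟨ cong (λ z → z + T + k) (∸-+-⊓ x y) ⟩
  x + T + k                         ∎
  where
  open ≡-Reasoning
  S = Vec.sum (rowAfter (x ⊓ y) xs ys)
  T = Vec.sum xs
  o = overflow (x ⊓ y) xs ys
  rearrange : ∀ a b c d → a + b + (c + d) ≡ a + d + c + b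
  rearrange = solve-∀

⊕-after : ∀ {n} k (a x y : Vec ℕ n) → (a ⊕ y) ⊕ rowAfter k x y ≡ (a ⊕ x) ⊕ stripAfter k x y
⊕-after k []       []       []       = refl
⊕-after k (a ∷ as) (x ∷ xs) (y ∷ ys) = cong₂ _∷_ eq (⊕-after (x ⊓ y) as xs ys)
  where
  open ≡-Reasoning
  assoc : ∀ a b c k → a + b + (c + k) ≡ a + (b + c) + k
  assoc = solve-∀
  eq : a + y + ((x ∸ y) + k) ≡ a + x + ((y ∸ x) + k)
  eq = begin
    a + y + ((x ∸ y) + k)   ≡⟨ assoc a y (x ∸ y) k ⟩
    a + (y + (x ∸ y)) + k   ≡⟨ cong (λ z → a + z + k) (+-∸-swap x y) ⟩
    a + (x + (y ∸ x)) + k   ≡⟨ assoc a x (y ∸ x) k ⟨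
    a + x + ((y ∸ x) + k)   ∎

unmatched-step-≤ : ∀ d m x′ c → ((x′ ⊓ (d + c)) + m ∸ c) + (x′ ∸ (d + c)) ≡ (m + x′) ∸ c
unmatched-step-≤ d m x′ c with ℕ.≤-total x′ (d + c)
... | inj₁ le rewrite ℕ.m≤n⇒m⊓n≡m le | ℕ.m≤n⇒m∸n≡0 le | ℕ.+-identityʳ (x′ + m ∸ c) =
  cong (_∸ c) (ℕ.+-comm x′ m)
... | inj₂ ge with ℕ.m≤n⇒∃[o]m+o≡n ge
... | e , refl rewrite ℕ.m≥n⇒m⊓n≡n ge | ℕ.m+n∸m≡n (d + c) e = begin
  (d + c + m ∸ c) + e        ≡⟨ cong (λ z → z ∸ c + e) (r₁ d c m) ⟩
  (d + m + c ∸ c) + e        ≡⟨ cong (_+ e) (ℕ.m+n∸n≡m (d + m) c) ⟩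
  d + m + e                  ≡⟨ ℕ.m+n∸n≡m (d + m + e) c ⟨
  d + m + e + c ∸ c          ≡⟨ cong (_∸ c) (r₂ d m e c) ⟩
  m + (d + c + e) ∸ c        ∎
  where
  open ≡-Reasoning
  r₁ : ∀ d c m → d + c + m ≡ d + m + c
  r₁ = solve-∀
  r₂ : ∀ d m e c → d + m + e + c ≡ m + (d + c + e)
  r₂ = solve-∀

unmatched-step-≥ : ∀ d m x′ c → ((x′ ⊓ c) + m ∸ (d + c)) + (x′ ∸ c) ≡ ((m ∸ d) + x′) ∸ c
unmatched-step-≥ d m x′ c with ℕ.≤-total x′ c
... | inj₂ ge with ℕ.m≤n⇒∃[o]m+o≡n ge
... | e , refl rewrite ℕ.m≥n⇒m⊓n≡n ge | ℕ.m+n∸m≡n c e | ℕ.+-comm d c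
                     | ℕ.[m+n]∸[m+o]≡n∸o c m d = begin
  (m ∸ d) + e                ≡⟨ ℕ.m+n∸n≡m _ c ⟨
  (m ∸ d) + e + c ∸ c        ≡⟨ cong (_∸ c) (trans (ℕ.+-assoc (m ∸ d) e c) (cong ((m ∸ d) +_) (ℕ.+-comm e c))) ⟩
  (m ∸ d) + (c + e) ∸ c      ∎
  where open ≡-Reasoning
unmatched-step-≥ d m x′ c | inj₁ le
  rewrite ℕ.m≤n⇒m⊓n≡m le | ℕ.m≤n⇒m∸n≡0 le | ℕ.+-identityʳ (x′ + m ∸ (d + c)) with ℕ.≤-total d m
... | inj₂ ge rewrite ℕ.m≤n⇒m∸n≡0 ge | ℕ.m≤n⇒m∸n≡0 le =
  ℕ.m≤n⇒m∸n≡0 (ℕ.≤-trans (ℕ.+-mono-≤ le ge) (ℕ.≤-reflexive (ℕ.+-comm c d)))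
... | inj₁ d≤m with ℕ.m≤n⇒∃[o]m+o≡n d≤m
... | f , refl rewrite ℕ.m+n∸m≡n d f = begin
  x′ + (d + f) ∸ (d + c)     ≡⟨ cong (_∸ (d + c)) (r x′ d f) ⟩
  d + (f + x′) ∸ (d + c)     ≡⟨ ℕ.[m+n]∸[m+o]≡n∸o d (f + x′) c ⟩
  f + x′ ∸ c                 ∎
  where
  open ≡-Reasoning
  r : ∀ x d f → x + (d + f) ≡ d + (f + x)
  r = solve-∀

-- The contribution of a single letter to `unmatched-after`. Lowering `x`, `y` and `n` together
-- changes neither side, and for `n` zero lowering `x` and `y` does not either; this leaves the
-- cases in which `x` or `y` is zero.
unmatched-step : ∀ x x′ y n c →
  ((x′ ⊓ ((y ∸ x) + c)) + (n ∸ (x ⊓ y)) ∸ ((x ∸ y) + c)) + (x′ ∸ ((y ∸ x) + c)) ≡ ((n ∸ x) + x′) ∸ c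
unmatched-step zero x′ zero n c = unmatched-step-≤ 0 n x′ c
unmatched-step zero x′ (suc y) n c = unmatched-step-≤ (suc y) n x′ c
unmatched-step (suc x) x′ zero n c = unmatched-step-≥ (suc x) n x′ c
unmatched-step (suc x) x′ (suc y) zero c = begin
  ((x′ ⊓ Y) + 0 ∸ X) + (x′ ∸ Y)            ≡⟨ cong (λ z → ((x′ ⊓ Y) + z ∸ X) + (x′ ∸ Y)) (ℕ.0∸n≡0 (x ⊓ y)) ⟨
  ((x′ ⊓ Y) + (0 ∸ (x ⊓ y)) ∸ X) + (x′ ∸ Y) ≡⟨ unmatched-step x x′ y 0 c ⟩
  ((0 ∸ x) + x′) ∸ c                       ≡⟨ cong (λ z → (z + x′) ∸ c) (ℕ.0∸n≡0 x) ⟩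
  x′ ∸ c                                   ∎
  where
  open ≡-Reasoning
  X = (x ∸ y) + c
  Y = (y ∸ x) + c
unmatched-step (suc x) x′ (suc y) (suc n) c = unmatched-step x x′ y n c

-- With unmatched x x′ + m′ ≤ m expressing column strictness of two rows starting in
-- columns m and m′, this says that k and k′ boxes may be put in front of them.
unmatched-after : ∀ {n} k k′ (x x′ y : Vec ℕ n) → overflow k′ x′ (stripAfter k x y) ≡ 0 →
  unmatched (rowAfter k x y) (rowAfter k′ x′ (stripAfter k x y)) ≡ k′ + (unmatched x x′ ∸ k)
unmatched-after k k′ []       []         []       p = trans (sym (ℕ.0∸n≡0 k)) (cong₂ _+_ (sym p) refl)
unmatched-after k k′ (x ∷ xs) (x′ ∷ xs′) (y ∷ ys) p
  rewrite unmatched-after (x ⊓ y) (x′ ⊓ ((y ∸ x) + k)) xs xs′ ys p = begin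
  (u ∸ X) + ((x′ ∸ Y) + k′)     ≡⟨ ℕ.+-assoc (u ∸ X) (x′ ∸ Y) k′ ⟨
  (u ∸ X) + (x′ ∸ Y) + k′       ≡⟨ cong (_+ k′) (unmatched-step x x′ y (unmatched xs xs′) k) ⟩
  (v ∸ k) + k′                  ≡⟨ ℕ.+-comm (v ∸ k) k′ ⟩
  k′ + (v ∸ k)                  ∎
  where
  open ≡-Reasoning
  X = (x ∸ y) + k
  Y = (y ∸ x) + k
  u = (x′ ⊓ Y) + (unmatched xs xs′ ∸ (x ⊓ y))
  v = (unmatched xs xs′ ∸ x) + x′

strip-after : ∀ {n} p q c (a x y : Vec ℕ n) → Strip p a x → Strip p a y → c ≤ q →
              Strip (p + q) (a ⊕ y) (rowAfter c x y)
strip-after p q c []       []       []       _        _        _   = tt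
strip-after p q c (a ∷ as) (x ∷ xs) (y ∷ ys) (h , hs) (g , gs) c≤q =
  front , strip-after a y (x ⊓ y) as xs ys hs gs (ℕ.m⊓n≤n x y)
  where
  open ℕ.≤-Reasoning
  a+⊔ : a + (y + (x ∸ y)) ≤ p
  a+⊔ with ℕ.≤-total x y
  ... | inj₁ le rewrite ℕ.m≤n⇒m∸n≡0 le | ℕ.+-identityʳ y = g
  ... | inj₂ ge rewrite ℕ.m+[n∸m]≡n ge = h
  assoc : ∀ a b c k → a + b + (c + k) ≡ a + (b + c) + k
  assoc = solve-∀
  front : a + y + ((x ∸ y) + c) ≤ p + q
  front = begin
    a + y + ((x ∸ y) + c)   ≡⟨ assoc a y (x ∸ y) c ⟩
    a + (y + (x ∸ y)) + c   ≤⟨ ℕ.+-mono-≤ a+⊔ c≤q ⟩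
    p + q                   ∎

horizontal-after : ∀ {n} k (a x y : Vec ℕ n) → HorizontalStrip a x → HorizontalStrip a y →
                   HorizontalStrip (a ⊕ y) (rowAfter k x y)
horizontal-after k []       []       []       _ _ = tt
horizontal-after k (a ∷ as) (x ∷ xs) (y ∷ ys) h g = strip-after a y (x ⊓ y) as xs ys h g (ℕ.m⊓n≤n x y)

-- Inserting and deleting one letter in all rows

-- Each row of the filling lets the strip reach one more part: the strip entering row `i`, counted
-- from 0, lives on the first `i` letters. Hence an alphabet with as many letters as there are rows
-- excludes `overflow`.
Supported : ∀ {n} → ℕ → Vec ℕ n → Set
Supported _       []       = ⊤
Supported zero    (y ∷ ys) = y ≡ 0 × Supported zero ys
Supported (suc i) (_ ∷ ys) = Supported i ys

supported-𝟎 : ∀ {n} → Supported {n} 0 𝟎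
supported-𝟎 {zero}  = tt
supported-𝟎 {suc n} = refl , supported-𝟎 {n}

overflow-supported : ∀ {n} i k (x y : Vec ℕ n) → Supported i y → i < n → overflow k x y ≡ 0
overflow-supported zero    k (x ∷ [])      (_ ∷ [])      (refl , _)  _ = ℕ.⊓-zeroʳ x
overflow-supported zero    k (x ∷ x′ ∷ xs) (y ∷ y′ ∷ ys) (_ , s)     _ =
  overflow-supported zero (x ⊓ y) (x′ ∷ xs) (y′ ∷ ys) s (s≤s z≤n)
overflow-supported (suc i) k (x ∷ xs)      (y ∷ ys)      s (s≤s i<n) =
  overflow-supported i (x ⊓ y) xs ys s i<n

stripAfter-supported : ∀ {n} i k (x y : Vec ℕ n) → Supported i y → Supported (suc i) (stripAfter k x y)
stripAfter-supported i       k []       []       _          = tt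
stripAfter-supported (suc i) k (x ∷ xs) (y ∷ ys) s          = stripAfter-supported i (x ⊓ y) xs ys s
stripAfter-supported zero    k (x ∷ xs) (_ ∷ ys) (refl , s)
  rewrite ℕ.⊓-zeroʳ x = zeros xs ys s
  where
  zeros : ∀ {n} (x y : Vec ℕ n) → Supported 0 y → Supported 0 (stripAfter 0 x y)
  zeros []       []       _          = tt
  zeros (x ∷ xs) (_ ∷ ys) (refl , s) rewrite ℕ.⊓-zeroʳ x | ℕ.0∸n≡0 x = refl , zeros xs ys s

strip⇒horizontal : ∀ {n p} (ν x : Vec ℕ n) → Strip p ν x → HorizontalStrip ν x
strip⇒horizontal []      []      _       = tt
strip⇒horizontal (_ ∷ _) (_ ∷ _) (_ , s) = s

-- ks holds the multiplicities, row by row, of a new letter smaller than all the others.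
insertRows : ∀ {L N} → Vec ℕ N → Vec (Vec ℕ N) L → Vec ℕ L → Vec (Vec ℕ N) L
insertRows y []       []       = []
insertRows y (x ∷ xs) (k ∷ ks) = rowAfter k x y ∷ insertRows (stripAfter k x y) xs ks

insertStrip : ∀ {L N} → Vec ℕ N → Vec (Vec ℕ N) L → Vec ℕ L → Vec ℕ N
insertStrip y []       []       = y
insertStrip y (x ∷ xs) (k ∷ ks) = insertStrip (stripAfter k x y) xs ks

deleteStrip : ∀ {L N} → Vec (Vec ℕ N) L → Vec ℕ N → Vec ℕ N
deleteStrip []       Y = Y
deleteStrip (X ∷ Xs) Y = stripBefore X (deleteStrip Xs Y)

deleteRows : ∀ {L N} → Vec (Vec ℕ N) L → Vec ℕ N → Vec (Vec ℕ N) L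
deleteRows []       Y = []
deleteRows (X ∷ Xs) Y = rowBefore X (deleteStrip Xs Y) ∷ deleteRows Xs Y

deleteColumn : ∀ {L N} → Vec (Vec ℕ N) L → Vec ℕ N → Vec ℕ L
deleteColumn []       Y = []
deleteColumn (X ∷ Xs) Y = carry X (deleteStrip Xs Y) ∷ deleteColumn Xs Y

module _ {N : ℕ} where

  delete-insert : ∀ {L} i y (xs : Vec (Vec ℕ N) L) ks → Supported i y → i + L ≤ N →
    let Xs = insertRows y xs ks; Y = insertStrip y xs ks in
    deleteStrip Xs Y ≡ y × deleteRows Xs Y ≡ xs × deleteColumn Xs Y ≡ ks
  delete-insert i y []       []       _ _  = refl , refl , refl
  delete-insert {suc L} i y (x ∷ xs) (k ∷ ks) s le
    with delete-insert (suc i) (stripAfter k x y) xs ks (stripAfter-supported i k x y s)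
           (subst (_≤ N) (ℕ.+-suc i L) le)
  ... | eq₁ , eq₂ , eq₃ rewrite eq₁ | eq₂ | eq₃ =
    stripBefore-after k x y none , cong (_∷ xs) (rowBefore-after k x y none) , cong (_∷ ks) (carry-after k x y none)
    where
    none : overflow k x y ≡ 0
    none = overflow-supported i k x y s (ℕ.≤-trans (ℕ.m<m+n i (s≤s z≤n)) le)

  insertStrip-delete : ∀ {L} (Xs : Vec (Vec ℕ N) L) Y →
    insertStrip (deleteStrip Xs Y) (deleteRows Xs Y) (deleteColumn Xs Y) ≡ Y
  insertStrip-delete []       Y = refl
  insertStrip-delete (X ∷ Xs) Y =
    trans (cong (λ z → insertStrip z (deleteRows Xs Y) (deleteColumn Xs Y))
            (stripAfter-before X (deleteStrip Xs Y)))
          (insertStrip-delete Xs Y)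

  insertRows-delete : ∀ {L} (Xs : Vec (Vec ℕ N) L) Y →
    insertRows (deleteStrip Xs Y) (deleteRows Xs Y) (deleteColumn Xs Y) ≡ Xs
  insertRows-delete []       Y = refl
  insertRows-delete (X ∷ Xs) Y = cong₂ _∷_ (rowAfter-before X (deleteStrip Xs Y))
    (trans (cong (λ z → insertRows z (deleteRows Xs Y) (deleteColumn Xs Y))
             (stripAfter-before X (deleteStrip Xs Y)))
           (insertRows-delete Xs Y))

Below : ∀ {L N} → ℕ → Vec ℕ L → Vec ℕ N → Vec (Vec ℕ N) L → Set
Below m []       x []       = ⊤
Below m (m′ ∷ _) x (x′ ∷ _) = unmatched x x′ + m′ ≤ m

-- Littlewood–Richardson fillings of λ/μ: the rows x are Yamanouchi when read after
-- the content ν, and Below expresses column strictness.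
LR : ∀ {L N} → Vec ℕ N → Vec ℕ L → Vec ℕ L → Vec (Vec ℕ N) L → Set
LR ν []      []       []       = ⊤
LR ν (m ∷ μ) (l ∷ ls) (x ∷ xs) =
  HorizontalStrip ν x × m + Vec.sum x ≡ l × Below m μ x xs × LR (ν ⊕ x) μ ls xs

shape : ∀ {L N} → Vec ℕ N → Vec (Vec ℕ N) L → Vec ℕ N
shape ν []       = ν
shape ν (x ∷ xs) = shape (ν ⊕ x) xs

module _ {N : ℕ} where

  -- Along the rows, `y` is the strip between the old content `a` and the new content `a ⊕ y`, and
  -- `i` counts the rows already read. The strip left over at the end separates the two final
  -- contents.
  insert-LR : ∀ {L} i a y μ k λs (xs : Vec (Vec ℕ N) L) → i + L ≤ N → Supported i y →
    HorizontalStrip a y → HorizontalStrip μ k → LR a (μ ⊕ k) λs xs →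
    LR (a ⊕ y) μ λs (insertRows y xs k) ×
    HorizontalStrip (shape a xs) (insertStrip y xs k) ×
    shape (a ⊕ y) (insertRows y xs k) ≡ shape a xs ⊕ insertStrip y xs k
  insert-LR i a y [] [] [] [] _ _ h _ _ = tt , h , refl
  insert-LR {suc L} i a y (m ∷ μ) (k ∷ ks) (l ∷ ls) (x ∷ xs) le s h g (hx , size , below , rest)
    with insert-LR (suc i) (a ⊕ x) (stripAfter k x y) μ ks ls xs
           (subst (_≤ N) (ℕ.+-suc i L) le) (stripAfter-supported i k x y s)
           (subst (HorizontalStrip (a ⊕ x)) (sym (stripAfter-swap k x y)) (horizontal-after k a y x h hx))
           (strip⇒horizontal μ ks g) rest
  ... | lr , h′ , eq =
    ( horizontal-after k a x y hx h
    , size′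
    , below′ μ ks xs le g below
    , subst (λ z → LR z μ ls _) (sym (⊕-after k a x y)) lr
    ) , h′ , trans (cong (λ z → shape z (insertRows (stripAfter k x y) xs ks)) (⊕-after k a x y)) eq
    where
    none : overflow k x y ≡ 0
    none = overflow-supported i k x y s (ℕ.≤-trans (ℕ.m<m+n i (s≤s z≤n)) le)

    size′ : m + Vec.sum (rowAfter k x y) ≡ l
    size′ = begin
      m + Vec.sum (rowAfter k x y)                     ≡⟨ cong (m +_) (ℕ.+-identityʳ _) ⟨
      m + (Vec.sum (rowAfter k x y) + 0)               ≡⟨ cong (λ z → m + (Vec.sum (rowAfter k x y) + z)) none ⟨
      m + (Vec.sum (rowAfter k x y) + overflow k x y)  ≡⟨ cong (m +_) (sum-rowAfter k x y) ⟩
      m + (Vec.sum x + k)                              ≡⟨ cong (m +_) (ℕ.+-comm (Vec.sum x) k) ⟩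
      m + (k + Vec.sum x)                              ≡⟨ ℕ.+-assoc m k _ ⟨
      m + k + Vec.sum x                                ≡⟨ size ⟩
      l                                                ∎
      where open ≡-Reasoning

    below′ : ∀ {L} μ ks (xs : Vec (Vec ℕ N) L) → i + suc L ≤ N → Strip m μ ks → Below (m + k) (μ ⊕ ks) x xs →
             Below m μ (rowAfter k x y) (insertRows (stripAfter k x y) xs ks)
    below′ []       []        []        _  _       _ = tt
    below′ (m′ ∷ μ) (k′ ∷ ks) (x′ ∷ xs) le (b , _) d
      rewrite unmatched-after k k′ x x′ y
                (overflow-supported (suc i) k′ x′ (stripAfter k x y) (stripAfter-supported i k x y s)
                  (ℕ.≤-trans (ℕ.≤-reflexive (ℕ.+-comm 2 i)) (ℕ.≤-trans (ℕ.+-monoʳ-≤ i (s≤s (s≤s z≤n))) le)))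
      with ℕ.≤-total (unmatched x x′) k
    -- If `k` absorbs the unmatched letters, only the `k′` new boxes count, and the strip condition
    -- `b` bounds them; otherwise `k` cancels from `d`.
    ... | inj₁ n≤k rewrite ℕ.m≤n⇒m∸n≡0 n≤k | ℕ.+-identityʳ k′ | ℕ.+-comm k′ m′ = b
    ... | inj₂ k≤n with ℕ.m≤n⇒∃[o]m+o≡n k≤n
    ... | e , eq′ rewrite sym eq′ | ℕ.m+n∸m≡n k e = ℕ.+-cancelʳ-≤ k _ _ (begin
      k′ + e + m′ + k      ≡⟨ r k′ e m′ k ⟩
      k + e + (m′ + k′)    ≤⟨ d ⟩
      m + k                ∎)
      where
      open ℕ.≤-Reasoning
      r : ∀ k′ e m′ k → k′ + e + m′ + k ≡ k + e + (m′ + k′)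
      r = solve-∀

  -- The local rule backwards on shapes: each part of the missing corner is the smaller of the parts
  -- of `A` and `b`, less the carry. All inequalities come from `bound`, which says that the next
  -- part of the opposite corner, `A′ + X′`, is at most that smaller part.
  horizontal-before : ∀ {n} (A b X Y : Vec ℕ n) → HorizontalStrip A X → HorizontalStrip b Y → b ⊕ Y ≡ A ⊕ X →
    ∃[ a ] a ⊕ stripBefore X Y ≡ A × a ⊕ rowBefore X Y ≡ b ×
           HorizontalStrip a (rowBefore X Y) × HorizontalStrip a (stripBefore X Y)
  horizontal-before []       []       []       []       _ _ _ = [] , refl , refl , tt , tt
  horizontal-before (A ∷ []) (b ∷ []) (X ∷ []) (Y ∷ []) _ _ eq =
    a ∷ [] , cong (_∷ []) eqA , cong (_∷ []) eqb , tt , tt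
    where
    b+Y≡A+X = proj₁ (Vec.∷-injective eq)
    a = A ∸ (Y ∸ X)
    le : Y ∸ X ≤ A
    le = ℕ.m≤n+o⇒m∸n≤o Y X (ℕ.≤-trans (ℕ.m≤n+m Y b) (ℕ.≤-reflexive (trans b+Y≡A+X (ℕ.+-comm A X))))
    eqA : a + ((Y ∸ X) + 0) ≡ A
    eqA rewrite ℕ.+-identityʳ (Y ∸ X) = ℕ.m∸n+n≡m le
    eqb : a + ((X ∸ Y) + 0) ≡ b
    eqb rewrite ℕ.+-identityʳ (X ∸ Y) = ℕ.+-cancelʳ-≡ Y _ _ (begin
      a + (X ∸ Y) + Y   ≡⟨ ℕ.+-assoc a (X ∸ Y) Y ⟩
      a + ((X ∸ Y) + Y) ≡⟨ cong (a +_) (trans (ℕ.+-comm (X ∸ Y) Y) (+-∸-swap X Y)) ⟩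
      a + (X + (Y ∸ X)) ≡⟨ cong (a +_) (ℕ.+-comm X (Y ∸ X)) ⟩
      a + ((Y ∸ X) + X) ≡⟨ ℕ.+-assoc a (Y ∸ X) X ⟨
      a + (Y ∸ X) + X   ≡⟨ cong (_+ X) (ℕ.m∸n+n≡m le) ⟩
      A + X             ≡⟨ b+Y≡A+X ⟨
      b + Y             ∎)
      where open ≡-Reasoning
  horizontal-before (A ∷ A′ ∷ As) (b ∷ b′ ∷ bs) (X ∷ X′ ∷ Xs) (Y ∷ Y′ ∷ Ys) (hA , sA) (hb , sb) eq
    with horizontal-before (A′ ∷ As) (b′ ∷ bs) (X′ ∷ Xs) (Y′ ∷ Ys) sA sb (proj₂ (Vec.∷-injective eq))
  ... | a′ ∷ as , eqA′ , eqb′ , sx , sy =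
    a ∷ a′ ∷ as , cong₂ _∷_ eqA eqA′ , cong₂ _∷_ eqb eqb′ ,
    (subst (_≤ a) (sym headb) b′≤a , sx) , (subst (_≤ a) (sym headA) A′≤a , sy)
    where
    b+Y≡A+X = proj₁ (Vec.∷-injective eq)
    b′+Y′≡A′+X′ = proj₁ (Vec.∷-injective (proj₂ (Vec.∷-injective eq)))
    c = X′ ⊓ Y′
    a = A ∸ ((Y ∸ X) + c)
    headA = proj₁ (Vec.∷-injective eqA′)
    headb = proj₁ (Vec.∷-injective eqb′)
    open ℕ.≤-Reasoning
    r₁ : ∀ p q r s → p + q + r + s ≡ (p + q) + (r + s)
    r₁ = solve-∀
    bound : A′ + X′ + (Y ∸ X) ≤ A
    bound with ℕ.≤-total Y X
    ... | inj₁ Y≤X rewrite ℕ.m≤n⇒m∸n≡0 Y≤X | ℕ.+-identityʳ (A′ + X′) = hA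
    ... | inj₂ X≤Y = ℕ.+-cancelʳ-≤ X _ _ (begin
      A′ + X′ + (Y ∸ X) + X     ≡⟨ ℕ.+-assoc (A′ + X′) (Y ∸ X) X ⟩
      A′ + X′ + ((Y ∸ X) + X)   ≡⟨ cong₂ _+_ b′+Y′≡A′+X′ (sym (ℕ.m∸n+n≡m X≤Y)) ⟨
      b′ + Y′ + Y               ≤⟨ ℕ.+-monoˡ-≤ Y hb ⟩
      b + Y                     ≡⟨ b+Y≡A+X ⟩
      A + X                     ∎)
    le : (Y ∸ X) + c ≤ A
    le = begin
      (Y ∸ X) + c         ≤⟨ ℕ.+-monoʳ-≤ (Y ∸ X) (ℕ.m⊓n≤m X′ Y′) ⟩
      (Y ∸ X) + X′        ≤⟨ ℕ.m≤n+m _ A′ ⟩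
      A′ + ((Y ∸ X) + X′) ≡⟨ cong (A′ +_) (ℕ.+-comm (Y ∸ X) X′) ⟩
      A′ + (X′ + (Y ∸ X)) ≡⟨ ℕ.+-assoc A′ X′ (Y ∸ X) ⟨
      A′ + X′ + (Y ∸ X)   ≤⟨ bound ⟩
      A                   ∎
    eqA : a + ((Y ∸ X) + c) ≡ A
    eqA = ℕ.m∸n+n≡m le
    eqb : a + ((X ∸ Y) + c) ≡ b
    eqb = ℕ.+-cancelʳ-≡ Y _ _ (begin-equality
      a + ((X ∸ Y) + c) + Y    ≡⟨ s₁ a (X ∸ Y) c Y ⟩
      a + c + (Y + (X ∸ Y))    ≡⟨ cong (a + c +_) (+-∸-swap X Y) ⟩
      a + c + (X + (Y ∸ X))    ≡⟨ s₂ a c X (Y ∸ X) ⟩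
      a + ((Y ∸ X) + c) + X    ≡⟨ cong (_+ X) eqA ⟩
      A + X                    ≡⟨ b+Y≡A+X ⟨
      b + Y                    ∎)
      where
      s₁ : ∀ a d c Y → a + (d + c) + Y ≡ a + c + (Y + d)
      s₁ = solve-∀
      s₂ : ∀ a c X d → a + c + (X + d) ≡ a + (d + c) + X
      s₂ = solve-∀
    A′≤a : A′ ≤ a
    A′≤a = ℕ.+-cancelʳ-≤ ((Y ∸ X) + c) _ _ (begin
      A′ + ((Y ∸ X) + c)   ≤⟨ ℕ.+-monoʳ-≤ A′ (ℕ.+-monoʳ-≤ (Y ∸ X) (ℕ.m⊓n≤m X′ Y′)) ⟩
      A′ + ((Y ∸ X) + X′)  ≡⟨ cong (A′ +_) (ℕ.+-comm (Y ∸ X) X′) ⟩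
      A′ + (X′ + (Y ∸ X))  ≡⟨ ℕ.+-assoc A′ X′ (Y ∸ X) ⟨
      A′ + X′ + (Y ∸ X)    ≤⟨ bound ⟩
      A                    ≡⟨ eqA ⟨
      a + ((Y ∸ X) + c)    ∎)
    b′≤a : b′ ≤ a
    b′≤a = ℕ.+-cancelʳ-≤ ((Y ∸ X) + c) _ _ (begin
      b′ + ((Y ∸ X) + c)   ≤⟨ ℕ.+-monoʳ-≤ b′ (ℕ.+-monoʳ-≤ (Y ∸ X) (ℕ.m⊓n≤n X′ Y′)) ⟩
      b′ + ((Y ∸ X) + Y′)  ≡⟨ cong (b′ +_) (ℕ.+-comm (Y ∸ X) Y′) ⟩
      b′ + (Y′ + (Y ∸ X))  ≡⟨ ℕ.+-assoc b′ Y′ (Y ∸ X) ⟨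
      b′ + Y′ + (Y ∸ X)    ≡⟨ cong (_+ (Y ∸ X)) b′+Y′≡A′+X′ ⟩
      A′ + X′ + (Y ∸ X)    ≤⟨ bound ⟩
      A                    ≡⟨ eqA ⟨
      a + ((Y ∸ X) + c)    ∎)

  delete-LR : ∀ {L} A μ λs (Xs : Vec (Vec ℕ N) L) Y ν → LR A μ λs Xs → HorizontalStrip ν Y →
    shape A Xs ≡ ν ⊕ Y →
    ∃[ a ] a ⊕ deleteStrip Xs Y ≡ A × HorizontalStrip a (deleteStrip Xs Y) ×
           HorizontalStrip μ (deleteColumn Xs Y) ×
           LR a (μ ⊕ deleteColumn Xs Y) λs (deleteRows Xs Y) × shape a (deleteRows Xs Y) ≡ ν
  delete-LR A []      []       []       Y ν _ h eq = ν , sym eq , h , tt , tt , refl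
  delete-LR A (m ∷ μ) (l ∷ ls) (X ∷ Xs) Y ν (hX , size , below , rest) h eq
    with delete-LR (A ⊕ X) μ ls Xs Y ν rest h eq
  ... | b , eqb , hb , g , lr , eqν
    with horizontal-before A b X (deleteStrip Xs Y) hX hb eqb
  ... | a , eqA , eqb′ , hx , hy =
    a , eqA , hy , strip , (hx , size′ , proj₂ both , subst (λ z → LR z _ ls _) (sym eqb′) lr) ,
    trans (cong (λ z → shape z (deleteRows Xs Y)) eqb′) eqν
    where
    y x : Vec ℕ N
    y = stripBefore X (deleteStrip Xs Y)
    x = rowBefore X (deleteStrip Xs Y)
    k : ℕ
    k = carry X (deleteStrip Xs Y)

    size′ : m + k + Vec.sum x ≡ l
    size′ = begin
      m + k + Vec.sum x                                ≡⟨ ℕ.+-assoc m k _ ⟩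
      m + (k + Vec.sum x)                              ≡⟨ cong (m +_) (ℕ.+-comm k (Vec.sum x)) ⟩
      m + (Vec.sum x + k)                              ≡⟨ cong (m +_) (sum-rowAfter k x y) ⟨
      m + (Vec.sum (rowAfter k x y) + overflow k x y)  ≡⟨ cong₂ (λ u v → m + (Vec.sum u + v))
                                                            (rowAfter-before X (deleteStrip Xs Y))
                                                            (overflow-before X (deleteStrip Xs Y)) ⟩
      m + (Vec.sum X + 0)                              ≡⟨ cong (m +_) (ℕ.+-identityʳ _) ⟩
      m + Vec.sum X                                    ≡⟨ size ⟩
      l                                                ∎
      where open ≡-Reasoning

    split : ∀ {L} (μ : Vec ℕ L) Xs (Y : Vec ℕ N) → Below m μ X Xs → HorizontalStrip μ (deleteColumn Xs Y) →
      let k = carry X (deleteStrip Xs Y) in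
      Strip m μ (deleteColumn Xs Y) ×
      Below (m + k) (μ ⊕ deleteColumn Xs Y) (rowBefore X (deleteStrip Xs Y)) (deleteRows Xs Y)
    split []       []        Y _ _ = tt , tt
    split (m′ ∷ μ) (X′ ∷ Xs) Y d g = (b₁ , g) , b₂
      where
      Y₂ = deleteStrip Xs Y
      Y₁ = stripBefore X′ Y₂
      k₁ = carry X Y₁
      k′ = carry X′ Y₂
      x₁ = rowBefore X Y₁
      x′ = rowBefore X′ Y₂
      y₁ = stripBefore X Y₁
      n = unmatched x₁ x′
      eqY : stripAfter k₁ x₁ y₁ ≡ Y₁
      eqY = stripAfter-before X Y₁
      -- One inequality now yields two: the summand `k′` gives the horizontal strip, and `n ∸ k₁`
      -- gives column strictness of the rows after deletion.
      key : unmatched X X′ ≡ k′ + (n ∸ k₁)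
      key = trans
        (cong₂ unmatched (sym (rowAfter-before X Y₁))
          (trans (sym (rowAfter-before X′ Y₂)) (cong (rowAfter k′ x′) (sym eqY))))
        (unmatched-after k₁ k′ x₁ x′ y₁ (trans (cong (overflow k′ x′) eqY) (overflow-before X′ Y₂)))
      d′ : k′ + (n ∸ k₁) + m′ ≤ m
      d′ = subst (λ z → z + m′ ≤ m) key d
      open ℕ.≤-Reasoning
      b₁ : m′ + k′ ≤ m
      b₁ = begin
        m′ + k′                ≡⟨ ℕ.+-comm m′ k′ ⟩
        k′ + m′                ≤⟨ ℕ.+-monoˡ-≤ m′ (ℕ.m≤m+n k′ _) ⟩
        k′ + (n ∸ k₁) + m′     ≤⟨ d′ ⟩
        m                      ∎
      r : ∀ k e m′ k′ → k + e + (m′ + k′) ≡ k′ + e + m′ + k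
      r = solve-∀
      b₂ : n + (m′ + k′) ≤ m + k₁
      b₂ = begin
        n + (m′ + k′)                 ≤⟨ ℕ.+-monoˡ-≤ (m′ + k′) (ℕ.m≤n+m∸n n k₁) ⟩
        k₁ + (n ∸ k₁) + (m′ + k′)     ≡⟨ r k₁ (n ∸ k₁) m′ k′ ⟩
        k′ + (n ∸ k₁) + m′ + k₁       ≤⟨ ℕ.+-monoˡ-≤ k₁ d′ ⟩
        m + k₁                        ∎

    both = split μ Xs Y below g
    strip = proj₁ both

-- Tableaux as chains of horizontal strips and the growth bijection

-- A semistandard tableau as the chain from μ to λ whose steps are the boxes of one letter each. `M`
-- has a row for each row of the diagram and a column for each letter; the letters are peeled off
-- from the smallest on.
Sst : ∀ {L} (w : List ℕ) → Vec ℕ L → Vec ℕ L → Vec (Vec ℕ (length w)) L → Set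
Sst []      μ λs M = μ ≡ λs
Sst (k ∷ w) μ λs M =
  Vec.sum (Vec.map head M) ≡ k × HorizontalStrip μ (Vec.map head M) ×
  Sst w (μ ⊕ Vec.map head M) λs (Vec.map tail M)

-- The letters are inserted from the largest to the smallest, so the strip of the
-- first letter is the outermost one.
Path : ∀ {N} (w : List ℕ) → Vec ℕ N → Vec (Vec ℕ N) (length w) → Set
Path []      ν []      = ν ≡ 𝟎
Path (k ∷ w) ν (Y ∷ p) = Vec.sum Y ≡ k × ∃[ ν′ ] ν′ ⊕ Y ≡ ν × HorizontalStrip ν′ Y × Path w ν′ p

𝟎⊕ : ∀ {n} (x : Vec ℕ n) → 𝟎 ⊕ x ≡ x
𝟎⊕ []      = refl
𝟎⊕ (x ∷ v) = cong (x ∷_) (𝟎⊕ v)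

⊕≡𝟎 : ∀ {n} (x y : Vec ℕ n) → x ⊕ y ≡ 𝟎 → x ≡ 𝟎 × y ≡ 𝟎
⊕≡𝟎 []      []      _  = refl , refl
⊕≡𝟎 (x ∷ v) (y ∷ u) eq with Vec.∷-injective eq
... | e , es with ⊕≡𝟎 v u es
... | p , q rewrite ℕ.m+n≡0⇒m≡0 x e | ℕ.m+n≡0⇒n≡0 x e = cong (0 ∷_) p , cong (0 ∷_) q

sum-𝟎 : ∀ n → Vec.sum (𝟎 {n}) ≡ 0
sum-𝟎 zero    = refl
sum-𝟎 (suc n) = sum-𝟎 n

unmatched-𝟎 : ∀ {n} (x : Vec ℕ n) → unmatched 𝟎 x ≡ Vec.sum x
unmatched-𝟎 []      = refl
unmatched-𝟎 (x ∷ v) = trans (ℕ.+-comm _ x) (cong (x +_) (unmatched-𝟎 v))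

strip-𝟎 : ∀ {n} p → Strip {n} p 𝟎 𝟎
strip-𝟎 {zero}  p = tt
strip-𝟎 {suc n} p = z≤n , strip-𝟎 0

horizontal-𝟎 : ∀ {n} → HorizontalStrip {n} 𝟎 𝟎
horizontal-𝟎 {zero}  = tt
horizontal-𝟎 {suc n} = strip-𝟎 0

shape≡𝟎 : ∀ {L N} ν (Xs : Vec (Vec ℕ N) L) → shape ν Xs ≡ 𝟎 → ν ≡ 𝟎 × Xs ≡ Vec.replicate L 𝟎
shape≡𝟎 ν []       eq = eq , refl
shape≡𝟎 ν (x ∷ Xs) eq with shape≡𝟎 (ν ⊕ x) Xs eq
... | p , q with ⊕≡𝟎 ν x p
... | r , s = r , cong₂ _∷_ s q

shape-𝟎 : ∀ {N} L → shape {L} {N} 𝟎 (Vec.replicate L 𝟎) ≡ 𝟎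
shape-𝟎         zero    = refl
shape-𝟎 {N = N} (suc L) rewrite 𝟎⊕ {N} 𝟎 = shape-𝟎 L

LR-empty : ∀ {L N} (μ : Vec ℕ L) → HorizontalStrip μ 𝟎 → LR {L} {N} 𝟎 μ μ (Vec.replicate L 𝟎)
LR-empty         []           _ = tt
LR-empty {N = N} (m ∷ [])     _ =
  horizontal-𝟎 {N} , trans (cong (m +_) (sum-𝟎 N)) (ℕ.+-identityʳ m) , tt , tt
LR-empty {N = N} (m ∷ m′ ∷ μ) (h , g) =
  horizontal-𝟎 {N} , trans (cong (m +_) (sum-𝟎 N)) (ℕ.+-identityʳ m) ,
  subst (λ z → z + m′ ≤ m) (sym (trans (unmatched-𝟎 {N} 𝟎) (sum-𝟎 N))) (subst (_≤ m) (ℕ.+-identityʳ m′) h) ,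
  subst (λ z → LR z (m′ ∷ μ) (m′ ∷ μ) (Vec.replicate _ 𝟎)) (sym (𝟎⊕ {N} 𝟎)) (LR-empty (m′ ∷ μ) g)

LR-𝟎 : ∀ {L N} (μ λs : Vec ℕ L) ν → LR {L} {N} ν μ λs (Vec.replicate L 𝟎) → μ ≡ λs
LR-𝟎 []      []       ν _ = refl
LR-𝟎 {N = N} (m ∷ μ) (l ∷ ls) ν (_ , size , _ , rest) = cong₂ _∷_
  (trans (sym (ℕ.+-identityʳ m)) (trans (cong (m +_) (sym (sum-𝟎 N))) size)) (LR-𝟎 μ ls _ rest)

overflow-comm : ∀ {n} k (x y : Vec ℕ n) → overflow k x y ≡ overflow k y x
overflow-comm k []       []       = refl
overflow-comm k (x ∷ xs) (y ∷ ys) =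
  trans (overflow-comm (x ⊓ y) xs ys) (cong (λ c → overflow c ys xs) (ℕ.⊓-comm x y))

sum-insertStrip : ∀ {L N} i y (xs : Vec (Vec ℕ N) L) ks → Supported i y → i + L ≤ N →
                  Vec.sum (insertStrip y xs ks) ≡ Vec.sum y + Vec.sum ks
sum-insertStrip i y []       []       _ _  = sym (ℕ.+-identityʳ _)
sum-insertStrip {suc L} {N} i y (x ∷ xs) (k ∷ ks) s le = begin
  Vec.sum (insertStrip Y xs ks)                        ≡⟨ sum-insertStrip (suc i) Y xs ks (stripAfter-supported i k x y s)
                                                            (subst (_≤ N) (ℕ.+-suc i L) le) ⟩
  Vec.sum Y + Vec.sum ks                               ≡⟨ cong (λ z → Vec.sum z + Vec.sum ks) (stripAfter-swap k x y) ⟩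
  Vec.sum (rowAfter k y x) + Vec.sum ks                ≡⟨ cong (_+ Vec.sum ks) (ℕ.+-identityʳ _) ⟨
  Vec.sum (rowAfter k y x) + 0 + Vec.sum ks            ≡⟨ cong (λ z → Vec.sum (rowAfter k y x) + z + Vec.sum ks) none ⟨
  Vec.sum (rowAfter k y x) + overflow k y x + Vec.sum ks ≡⟨ cong (_+ Vec.sum ks) (sum-rowAfter k y x) ⟩
  Vec.sum y + k + Vec.sum ks                           ≡⟨ ℕ.+-assoc (Vec.sum y) k _ ⟩
  Vec.sum y + (k + Vec.sum ks)                         ∎
  where
  open ≡-Reasoning
  Y = stripAfter k x y
  none : overflow k y x ≡ 0
  none = trans (overflow-comm k y x) (overflow-supported i k x y s (ℕ.≤-trans (ℕ.m<m+n i (s≤s z≤n)) le))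

head∷tail : ∀ {L m} (M : Vec (Vec ℕ (suc m)) L) → zipWith _∷_ (Vec.map head M) (Vec.map tail M) ≡ M
head∷tail []            = refl
head∷tail ((_ ∷ _) ∷ M) = cong (_ ∷_) (head∷tail M)

map-head : ∀ {L m} (k : Vec ℕ L) (M : Vec (Vec ℕ m) L) → Vec.map head (zipWith _∷_ k M) ≡ k
map-head []      []      = refl
map-head (x ∷ k) (_ ∷ M) = cong (x ∷_) (map-head k M)

map-tail : ∀ {L m} (k : Vec ℕ L) (M : Vec (Vec ℕ m) L) → Vec.map tail (zipWith _∷_ k M) ≡ M
map-tail []      []      = refl
map-tail (_ ∷ k) (x ∷ M) = cong (x ∷_) (map-tail k M)

empties : ∀ {L} (M : Vec (Vec ℕ 0) L) → Vec.replicate L [] ≡ M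
empties []       = refl
empties ([] ∷ M) = cong ([] ∷_) (empties M)

shrink : ∀ {L N m} → Vec (Vec ℕ N) L → Vec (Vec ℕ N) m → Vec (Vec ℕ m) L
shrink {L} Xs []      = Vec.replicate L []
shrink     Xs (Y ∷ p) = zipWith _∷_ (deleteColumn Xs Y) (shrink (deleteRows Xs Y) p)

module Growth (N : ℕ) where

  growRows : ∀ {L m} → Vec (Vec ℕ m) L → Vec (Vec ℕ N) L
  growRows {L} {zero}  M = Vec.replicate L 𝟎
  growRows {L} {suc m} M = insertRows 𝟎 (growRows (Vec.map tail M)) (Vec.map head M)

  growPath : ∀ {L m} → Vec (Vec ℕ m) L → Vec (Vec ℕ N) m
  growPath {L} {zero}  M = []
  growPath {L} {suc m} M =
    insertStrip 𝟎 (growRows (Vec.map tail M)) (Vec.map head M) ∷ growPath (Vec.map tail M)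

  module _ {L : ℕ} (L≤N : L ≤ N) where

    grow : ∀ w μ λs (M : Vec (Vec ℕ (length w)) L) → HorizontalStrip λs 𝟎 → Sst w μ λs M →
           LR 𝟎 μ λs (growRows M) × Path w (shape 𝟎 (growRows M)) (growPath M)
    grow []      μ .μ M h refl = LR-empty μ h , shape-𝟎 L
    grow (k ∷ w) μ λs M h (size , strip , rest)
      with grow w (μ ⊕ Vec.map head M) λs (Vec.map tail M) h rest
    ... | lr , path
      with insert-LR 0 𝟎 𝟎 μ (Vec.map head M) λs (growRows (Vec.map tail M)) L≤N (supported-𝟎 {N})
             (horizontal-𝟎 {N}) strip lr
    ... | lr′ , h′ , eq =
      subst (λ z → LR z μ λs (growRows M)) (𝟎⊕ 𝟎) lr′ ,
      trans (sum-insertStrip 0 𝟎 (growRows (Vec.map tail M)) (Vec.map head M) (supported-𝟎 {N}) L≤N)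
            (trans (cong (_+ _) (sum-𝟎 N)) size) ,
      _ , trans (sym eq) (cong (λ z → shape z (growRows M)) (𝟎⊕ 𝟎)) , h′ , path

    shrink-grow : ∀ {m} (M : Vec (Vec ℕ m) L) → shrink (growRows M) (growPath M) ≡ M
    shrink-grow {zero}  M = empties M
    shrink-grow {suc m} M
      with delete-insert 0 𝟎 (growRows (Vec.map tail M)) (Vec.map head M) (supported-𝟎 {N}) L≤N
    ... | _ , eq₂ , eq₃ = begin
      zipWith _∷_ (deleteColumn (growRows M) Y) (shrink (deleteRows (growRows M) Y) p)
        ≡⟨ cong₂ (λ k Xs → zipWith _∷_ k (shrink Xs p)) eq₃ eq₂ ⟩
      zipWith _∷_ (Vec.map head M) (shrink (growRows (Vec.map tail M)) p)
        ≡⟨ cong (zipWith _∷_ (Vec.map head M)) (shrink-grow (Vec.map tail M)) ⟩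
      zipWith _∷_ (Vec.map head M) (Vec.map tail M)
        ≡⟨ head∷tail M ⟩
      M ∎
      where
      open ≡-Reasoning
      Y = insertStrip 𝟎 (growRows (Vec.map tail M)) (Vec.map head M)
      p = growPath (Vec.map tail M)

    shrink-sound : ∀ w μ λs (Xs : Vec (Vec ℕ N) L) p → LR 𝟎 μ λs Xs → Path w (shape 𝟎 Xs) p →
                   Sst w μ λs (shrink Xs p) × growRows (shrink Xs p) ≡ Xs × growPath (shrink Xs p) ≡ p
    shrink-sound []      μ λs Xs []      lr eq with shape≡𝟎 𝟎 Xs eq
    ... | _ , refl = LR-𝟎 μ λs 𝟎 lr , refl , refl
    shrink-sound (k ∷ w) μ λs Xs (Y ∷ p) lr (size , ν , eq , h , path)
      with delete-LR 𝟎 μ λs Xs Y ν lr h (sym eq)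
    ... | a , eqa , _ , strip , lr′ , eqν with ⊕≡𝟎 a (deleteStrip Xs Y) eqa
    ... | refl , eqy with shrink-sound w (μ ⊕ deleteColumn Xs Y) λs (deleteRows Xs Y) p lr′
                            (subst (λ z → Path w z p) (sym eqν) path)
    ... | sst , eq₁ , eq₂
      rewrite map-head (deleteColumn Xs Y) (shrink (deleteRows Xs Y) p)
            | map-tail (deleteColumn Xs Y) (shrink (deleteRows Xs Y) p) | eq₁ | eq₂ =
      ( trans (sym total) size , strip , sst) , eqX , cong (_∷ p) eqY
      where
      eqX : insertRows 𝟎 (deleteRows Xs Y) (deleteColumn Xs Y) ≡ Xs
      eqX = subst (λ z → insertRows z (deleteRows Xs Y) (deleteColumn Xs Y) ≡ Xs) eqy (insertRows-delete Xs Y)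
      eqY : insertStrip 𝟎 (deleteRows Xs Y) (deleteColumn Xs Y) ≡ Y
      eqY = subst (λ z → insertStrip z (deleteRows Xs Y) (deleteColumn Xs Y) ≡ Y) eqy (insertStrip-delete Xs Y)
      total : Vec.sum Y ≡ Vec.sum (deleteColumn Xs Y)
      total = trans (cong Vec.sum (sym eqY))
        (trans (sum-insertStrip 0 𝟎 (deleteRows Xs Y) (deleteColumn Xs Y) (supported-𝟎 {N}) L≤N)
               (cong (_+ Vec.sum (deleteColumn Xs Y)) (sum-𝟎 N)))

    -- A tableau is the same as a filling together with a path, and the paths depend on the shape of
    -- the filling alone. Once they are counted by straight tableaux, this is the expansion of a
    -- skew Schur function, coefficient by coefficient.
    LR-rule : ∀ w μ λs {Ms Ys} (paths : Vec (Vec ℕ N) L → List (Vec (Vec ℕ N) (length w))) →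
      HorizontalStrip λs 𝟎 →
      Enumerates (Sst w μ λs) Ms → Enumerates (LR 𝟎 μ λs) Ys →
      (∀ {Xs} → LR 𝟎 μ λs Xs → Enumerates (Path w (shape 𝟎 Xs)) (paths Xs)) →
      length Ms ≡ sum (List.map (length ∘ paths) Ys)
    LR-rule w μ λs {Ms} {Ys} paths h EM EY EP = trans
      (bijection-length (λ M → growRows M , growPath M) (λ (Xs , p) → shrink Xs p)
        (λ s → grow w μ λs _ h s)
        (λ (lr , p) → proj₁ (shrink-sound w μ λs _ _ lr p))
        (λ _ → shrink-grow _)
        (λ (lr , p) → let _ , eq₁ , eq₂ = shrink-sound w μ λs _ _ lr p in cong₂ _,_ eq₁ eq₂)
        EM (pairs-enumerate EY EP))
      (length-pairs EY EP Ys)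

-- Straight shapes

pad : ∀ {L N} → L ≤ N → Vec ℕ L → Vec ℕ N
pad z≤n       []      = 𝟎
pad (s≤s le) (c ∷ κ) = c ∷ pad le κ

straightRows : ∀ {L N} → L ≤ N → Vec ℕ L → Vec (Vec ℕ N) L
straightRows z≤n      []      = []
straightRows (s≤s le) (c ∷ κ) = (c ∷ 𝟎) ∷ Vec.map (0 ∷_) (straightRows le κ)

shape-straight : ∀ {L N} (le : L ≤ N) κ → shape 𝟎 (straightRows le κ) ≡ pad le κ
shape-straight z≤n      []      = refl
shape-straight {N = suc N} (s≤s le) (c ∷ κ) = trans
  (cong (λ z → shape (c ∷ z) (Vec.map (0 ∷_) (straightRows le κ))) (𝟎⊕ 𝟎))
  (trans (front 𝟎 (straightRows le κ)) (cong (c ∷_) (shape-straight le κ)))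
  where
  front : ∀ {L} ν (Xs : Vec (Vec ℕ N) L) → shape (c ∷ ν) (Vec.map (0 ∷_) Xs) ≡ c ∷ shape ν Xs
  front ν []       = refl
  front ν (x ∷ Xs) rewrite ℕ.+-identityʳ c = front (ν ⊕ x) Xs

strip-0 : ∀ {n} (x : Vec ℕ n) → Strip 0 𝟎 x → x ≡ 𝟎
strip-0 []      _        = refl
strip-0 (x ∷ v) (h , hs) rewrite ℕ.n≤0⇒n≡0 h = cong (0 ∷_) (strip-0 v hs)

-- The first row is read after the empty content and so has only the first letter. As all rows start
-- in the same column, every letter of a lower row is bracketed with a smaller one above it, which
-- the first letter cannot be. Dropping the first row and the first letter leaves a shorter straight
-- shape.
straight-unique : ∀ {L N} (le : L ≤ N) κ Xs → LR 𝟎 𝟎 κ Xs → Xs ≡ straightRows le κ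
straight-unique z≤n      []      []              _  = refl
straight-unique {N = suc N} (s≤s le) (c ∷ κ) ((a ∷ as) ∷ Xs) (h , size , below , rest)
  with strip-0 as h
... | refl with trans (sym (trans (cong (a +_) (sum-𝟎 N)) (ℕ.+-identityʳ a))) size
... | refl with front a (𝟎 ⊕ 𝟎) κ (a ∷ 𝟎) Xs below rest
  where
  front : ∀ {L} c ν κ x (Xs : Vec (Vec ℕ (suc N)) L) → Below 0 𝟎 x Xs → LR (c ∷ ν) 𝟎 κ Xs →
          ∃[ Xs′ ] Xs ≡ Vec.map (0 ∷_) Xs′ × LR ν 𝟎 κ Xs′ 
  front c ν []      x []                _ _ = [] , refl , tt
  front {suc L} c ν (l ∷ κ) (b ∷ bs) ((a ∷ as) ∷ Xs) below (h , size , below′ , rest)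
    with ℕ.m+n≡0⇒n≡0 (unmatched bs as ∸ b) (ℕ.n≤0⇒n≡0 (subst (_≤ 0) (ℕ.+-identityʳ _) below))
  ... | refl with front (c + 0) (ν ⊕ as) κ (0 ∷ as) Xs below′ rest
  ... | Xs′ , refl , lr =
    as ∷ Xs′ , refl , strip⇒horizontal ν as h , size , below″ Xs′ below′ , lr
    where
    below″ : ∀ {L} (Xs′ : Vec (Vec ℕ N) L) → Below 0 𝟎 (0 ∷ as) (Vec.map (0 ∷_) Xs′) → Below 0 𝟎 as Xs′
    below″ []        _ = tt
    below″ (x′ ∷ Xs′) d = subst (λ z → z + 0 ≤ 0) (ℕ.+-identityʳ (unmatched as x′)) d
... | Xs′ , refl , lr =
  cong ((a ∷ 𝟎) ∷_) (cong (Vec.map (0 ∷_)) (straight-unique le κ Xs′ (subst (λ z → LR z 𝟎 κ Xs′) (𝟎⊕ 𝟎) lr)))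

head-shape : ∀ {L N} (ν : Vec ℕ (suc N)) (Xs : Vec (Vec ℕ (suc N)) L) → head ν ≤ head (shape ν Xs)
head-shape ν       []             = ℕ.≤-refl
head-shape (c ∷ ν) ((a ∷ x) ∷ Xs) = ℕ.≤-trans (ℕ.m≤m+n c a) (head-shape (c + a ∷ ν ⊕ x) Xs)

straight-LR : ∀ {L N} (le : L ≤ N) κ → HorizontalStrip κ 𝟎 → LR 𝟎 𝟎 κ (straightRows le κ)
straight-LR z≤n [] _ = tt
straight-LR {suc L} {suc N} (s≤s le) (c ∷ κ) h =
  strip-𝟎 0 , trans (cong (c +_) (sum-𝟎 N)) (ℕ.+-identityʳ c) , below le κ h ,
  subst (λ z → LR (c ∷ z) 𝟎 κ (Vec.map (0 ∷_) (straightRows le κ))) (sym (𝟎⊕ 𝟎))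
    (lift 𝟎 κ (straightRows le κ) (bounded le κ h) (straight-LR le κ (strip⇒horizontal κ 𝟎 h)))
  where
  below : ∀ {L} (le : L ≤ N) κ → Strip c κ 𝟎 → Below 0 𝟎 (c ∷ 𝟎) (Vec.map (0 ∷_) (straightRows le κ))
  below z≤n                []       _ = tt
  below (s≤s {n = n} le) (c′ ∷ κ) (g , _) = ℕ.≤-reflexive (begin
    (unmatched 𝟎 (c′ ∷ 𝟎 {n}) ∸ c) + 0 + 0   ≡⟨ cong (λ z → (z ∸ c) + 0 + 0) (trans (unmatched-𝟎 (c′ ∷ 𝟎 {n})) (cong (c′ +_) (sum-𝟎 n))) ⟩
    (c′ + 0 ∸ c) + 0 + 0                     ≡⟨ cong (λ z → z + 0 + 0) (ℕ.m≤n⇒m∸n≡0 g) ⟩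
    0                                        ∎)
    where open ≡-Reasoning

  -- The condition under which an extra leading part `c` turns a `HorizontalStrip` into a `Strip c`.
  -- Contents only grow from row to row, so it suffices to bound the final one.
  Bounded : ∀ {N} → Vec ℕ N → Set
  Bounded {zero}  _ = ⊤
  Bounded {suc N} ν = head ν ≤ c

  bounded : ∀ {L N} (le : L ≤ N) κ → Strip c κ 𝟎 → Bounded (shape 𝟎 (straightRows le κ))
  bounded le κ g = subst Bounded (sym (shape-straight le κ)) (padded le κ g)
    where
    padded : ∀ {L N} (le : L ≤ N) κ → Strip c κ 𝟎 → Bounded (pad le κ)
    padded {N = zero}  z≤n      []       _       = tt
    padded {N = suc N} z≤n      []       _       = z≤n
    padded             (s≤s le) (c′ ∷ κ) (g , _) = subst (_≤ c) (ℕ.+-identityʳ c′) g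

  bounded-start : ∀ {L N} ν (Xs : Vec (Vec ℕ N) L) → Bounded (shape ν Xs) → Bounded ν
  bounded-start {N = zero}  ν Xs _ = tt
  bounded-start {N = suc N} ν Xs b = ℕ.≤-trans (head-shape ν Xs) b

  bounded-strip : ∀ {N} (ν x : Vec ℕ N) → Bounded (ν ⊕ x) → HorizontalStrip ν x → Strip c ν x
  bounded-strip []      []      _ _ = tt
  bounded-strip (_ ∷ _) (_ ∷ _) b h = b , h

  lift : ∀ {L N} ν κ (Xs : Vec (Vec ℕ N) L) → Bounded (shape ν Xs) → LR ν 𝟎 κ Xs →
         LR (c ∷ ν) 𝟎 κ (Vec.map (0 ∷_) Xs)
  lift ν []      []       _ _ = tt
  lift ν (l ∷ κ) (x ∷ Xs) b (h , size , d , rest) =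
    bounded-strip ν x (bounded-start (ν ⊕ x) Xs b) h , size , below′ Xs d ,
    subst (λ z → LR (z ∷ (ν ⊕ x)) 𝟎 κ (Vec.map (0 ∷_) Xs)) (sym (ℕ.+-identityʳ c)) (lift (ν ⊕ x) κ Xs b rest)
    where
    below′ : ∀ {L} (Xs : Vec (Vec ℕ _) L) → Below 0 𝟎 x Xs → Below 0 𝟎 (0 ∷ x) (Vec.map (0 ∷_) Xs)
    below′ []       _ = tt
    below′ (x′ ∷ _) d = subst (λ z → z + 0 ≤ 0) (sym (ℕ.+-identityʳ (unmatched x x′))) d

module _ {N L : ℕ} (L≤N : L ≤ N) where

  open Growth N

  -- Since the filling of a straight shape is unique, the growth bijection itself identifies
  -- straight tableaux with paths.
  straight-paths : ∀ w κ {Ms} → HorizontalStrip κ 𝟎 → Enumerates (Sst {L} w 𝟎 κ) Ms →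
                   Enumerates (Path w (pad L≤N κ)) (List.map growPath Ms)
  straight-paths w κ h E = image-enumerates growPath
    (λ {M} s → let lr , p = grow L≤N w 𝟎 κ M h s in
      subst (λ z → Path w z (growPath M))
        (trans (cong (shape 𝟎) (straight-unique L≤N κ (growRows M) lr)) (shape-straight L≤N κ)) p)
    (λ s t eq → trans (sym (undo s)) (trans (cong (shrink rows) eq) (undo t)))
    (λ {p} q → let s , _ , eq = back p q in shrink rows p , s , eq) E
    where
    rows = straightRows L≤N κ
    back : ∀ p → Path w (pad L≤N κ) p →
           Sst w 𝟎 κ (shrink rows p) × growRows (shrink rows p) ≡ rows × growPath (shrink rows p) ≡ p
    back p q = shrink-sound L≤N w 𝟎 κ rows p (straight-LR L≤N κ h)
      (subst (λ z → Path w z p) (sym (shape-straight L≤N κ)) q)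
    undo : ∀ {M} → Sst w 𝟎 κ M → shrink rows (growPath M) ≡ M
    undo {M} s = trans
      (cong (λ z → shrink z (growPath M))
        (sym (straight-unique L≤N κ (growRows M) (proj₁ (grow L≤N w 𝟎 κ M h s)))))
      (shrink-grow L≤N M)

-- Rows of letters and their multiplicities

tally : ∀ {m k} → Vec (Fin m) k → Vec ℕ m
tally []      = 𝟎
tally (x ∷ u) = updateAt (tally u) x suc

count-tally : ∀ {m k} (i : Fin m) (u : Vec (Fin m) k) →
              length (filter (i Fin.≟_) (Vec.toList u)) ≡ lookup (tally u) i
count-tally i []      = sym (Vec.lookup-replicate i 0)
count-tally i (x ∷ u) with i Fin.≟ x
... | yes refl = trans (cong suc (count-tally i u)) (sym (Vec.lookup∘updateAt i (tally u)))
... | no  i≢x  = trans (count-tally i u) (sym (Vec.lookup∘updateAt′ i x i≢x (tally u)))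

sum-updateAt : ∀ {m} (v : Vec ℕ m) x → Vec.sum (updateAt v x suc) ≡ suc (Vec.sum v)
sum-updateAt (_ ∷ v) zero    = refl
sum-updateAt (c ∷ v) (suc x) = trans (cong (c +_) (sum-updateAt v x)) (ℕ.+-suc c _)

sum-tally : ∀ {m k} (u : Vec (Fin m) k) → Vec.sum (tally u) ≡ k
sum-tally {m} [] = sum-𝟎 m
sum-tally (x ∷ u) = trans (sum-updateAt (tally u) x) (cong suc (sum-tally u))

prefix : ∀ {m} → ℕ → Vec ℕ m → ℕ
prefix zero    _       = 0
prefix (suc j) []      = 0
prefix (suc j) (x ∷ v) = x + prefix j v

below : ∀ {m k} → ℕ → Vec (Fin m) k → ℕ
below j u = prefix j (tally u)

prefix-𝟎 : ∀ m j → prefix j (𝟎 {m}) ≡ 0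
prefix-𝟎 m       zero    = refl
prefix-𝟎 zero    (suc j) = refl
prefix-𝟎 (suc m) (suc j) = prefix-𝟎 m j

prefix-< : ∀ {m} j (v : Vec ℕ m) x → toℕ x < j → prefix j (updateAt v x suc) ≡ suc (prefix j v)
prefix-< (suc j) (c ∷ v) zero    _        = refl
prefix-< (suc j) (c ∷ v) (suc x) (s≤s lt) = trans (cong (c +_) (prefix-< j v x lt)) (ℕ.+-suc c _)

prefix-≥ : ∀ {m} j (v : Vec ℕ m) x → j ≤ toℕ x → prefix j (updateAt v x suc) ≡ prefix j v
prefix-≥ zero    _       _       _        = refl
prefix-≥ (suc j) (c ∷ v) (suc x) (s≤s le) = cong (c +_) (prefix-≥ j v x le)

prefix-≤-sum : ∀ {m} j (v : Vec ℕ m) → prefix j v ≤ Vec.sum v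
prefix-≤-sum zero    v       = z≤n
prefix-≤-sum (suc j) []      = z≤n
prefix-≤-sum (suc j) (c ∷ v) = ℕ.+-monoʳ-≤ c (prefix-≤-sum j v)

below-≤ : ∀ {m k} j (u : Vec (Fin m) k) → below j u ≤ k
below-≤ j u = subst (below j u ≤_) (sum-tally u) (prefix-≤-sum j (tally u))

increasing-tail : ∀ {m k} {x : Fin m} {u : Vec (Fin m) k} → WeaklyIncreasing (x ∷ u) → WeaklyIncreasing u
increasing-tail w i j i≤j = w (suc i) (suc j) (s≤s i≤j)

none-below : ∀ {m k} j (u : Vec (Fin m) k) → (∀ p → j ≤ toℕ (lookup u p)) → below j u ≡ 0
none-below {m} j []      _ = prefix-𝟎 m j
none-below     j (x ∷ u) h = trans (prefix-≥ j (tally u) x (h zero)) (none-below j u (h ∘ suc))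

below⇒< : ∀ {m k} j (u : Vec (Fin m) k) → WeaklyIncreasing u → ∀ p → toℕ p < below j u → toℕ (lookup u p) < j
below⇒< j (x ∷ u) w p lt with ℕ.<-≤-connex (toℕ x) j
below⇒< j (x ∷ u) w zero    lt | inj₁ x<j = x<j

below⇒< j (x ∷ u) w (suc p) lt | inj₁ x<j =
  below⇒< j u (increasing-tail w) p (s≤s⁻¹ (subst (suc (toℕ p) <_) (prefix-< j (tally u) x x<j) lt))
below⇒< j (x ∷ u) w p       lt | inj₂ j≤x = contradiction
  (subst (toℕ p <_) (none-below j (x ∷ u) (λ q → ℕ.≤-trans j≤x (w zero q z≤n))) lt) λ ()

<⇒below : ∀ {m k} j (u : Vec (Fin m) k) → WeaklyIncreasing u → ∀ p → toℕ (lookup u p) < j → toℕ p < below j u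
<⇒below j (x ∷ u) w p lt
  rewrite prefix-< j (tally u) x (ℕ.≤-<-trans (w zero p z≤n) lt) = bound p lt
  where
  bound : ∀ p → toℕ (lookup (x ∷ u) p) < j → toℕ p < suc (below j u)
  bound zero    _  = s≤s z≤n
  bound (suc p) lt = s≤s (<⇒below j u (increasing-tail w) p lt)

tally-injective : ∀ {m k} (u v : Vec (Fin m) k) → WeaklyIncreasing u → WeaklyIncreasing v →
                  tally u ≡ tally v → u ≡ v
tally-injective u v wu wv eq = begin
  u                            ≡⟨ Vec.tabulate∘lookup u ⟨
  Vec.tabulate (lookup u)      ≡⟨ Vec.tabulate-cong (λ p → Fin.toℕ-injective (ℕ.≤-antisym (le u v wu wv eq p) (le v u wv wu (sym eq) p))) ⟩
  Vec.tabulate (lookup v)      ≡⟨ Vec.tabulate∘lookup v ⟩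
  v                            ∎
  where
  open ≡-Reasoning
  le : ∀ {m k} (u v : Vec (Fin m) k) → WeaklyIncreasing u → WeaklyIncreasing v → tally u ≡ tally v →
       ∀ p → toℕ (lookup u p) ≤ toℕ (lookup v p)
  le u v wu wv eq p = s≤s⁻¹ (below⇒< (suc (toℕ (lookup v p))) u wu p
    (subst (λ z → toℕ p < prefix (suc (toℕ (lookup v p))) z) (sym eq)
      (<⇒below (suc (toℕ (lookup v p))) v wv p ℕ.≤-refl)))

tally-map-suc : ∀ {m k} (u : Vec (Fin m) k) → tally (Vec.map suc u) ≡ 0 ∷ tally u
tally-map-suc []      = refl
tally-map-suc (x ∷ u) rewrite tally-map-suc u = refl

word : ∀ {m} (v : Vec ℕ m) k → Vec.sum v ≡ k → ∃[ u ] WeaklyIncreasing {m} {k} u × tally u ≡ v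
word []      .0 refl = [] , (λ ()) , refl
word (c ∷ v) = go c
  where
  go : ∀ c k → c + Vec.sum v ≡ k → ∃[ u ] WeaklyIncreasing {_} {k} u × tally u ≡ c ∷ v
  go zero k eq with word v k eq
  ... | u , w , refl = Vec.map suc u ,
    (λ i j i≤j → subst₂ Fin._≤_ (sym (Vec.lookup-map i suc u)) (sym (Vec.lookup-map j suc u)) (s≤s (w i j i≤j))) ,
    tally-map-suc u
  go (suc c) (suc k) eq with go c k (ℕ.suc-injective eq)
  ... | u , w , eq′ = zero ∷ u , increasing , cong (λ z → updateAt z zero suc) eq′
    where
    increasing : WeaklyIncreasing (zero ∷ u)
    increasing zero    j       _         = z≤n
    increasing (suc i) (suc j) (s≤s i≤j) = w i j i≤j

-- Column strictness in terms of multiplicities: the letters up to j of the lower row end no further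
-- right than the letters below j of the upper row. The columns `p` and `q` are where the current
-- letter begins in the two rows.
Ladder : ∀ {m} → ℕ → ℕ → Vec ℕ m → Vec ℕ m → Set
Ladder p q []      []      = ⊤
Ladder p q (a ∷ A) (b ∷ B) = q + b ≤ p × Ladder (p + a) (q + b) A B

ladder⇒prefix : ∀ {m} p q (A B : Vec ℕ m) → Ladder p q A B → ∀ (j : Fin m) →
                q + prefix (suc (toℕ j)) B ≤ p + prefix (toℕ j) A
ladder⇒prefix p q (a ∷ A) (b ∷ B) (h , _) zero
  rewrite ℕ.+-identityʳ b | ℕ.+-identityʳ p = h
ladder⇒prefix p q (a ∷ A) (b ∷ B) (_ , l) (suc j)
  rewrite sym (ℕ.+-assoc q b (prefix (suc (toℕ j)) B)) | sym (ℕ.+-assoc p a (prefix (toℕ j) A)) =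
  ladder⇒prefix (p + a) (q + b) A B l j

prefix⇒ladder : ∀ {m} p q (A B : Vec ℕ m) →
                (∀ (j : Fin m) → q + prefix (suc (toℕ j)) B ≤ p + prefix (toℕ j) A) → Ladder p q A B
prefix⇒ladder p q []      []      _ = tt
prefix⇒ladder p q (a ∷ A) (b ∷ B) h =
  subst₂ _≤_ (cong (q +_) (ℕ.+-identityʳ b)) (ℕ.+-identityʳ p) (h zero) ,
  prefix⇒ladder (p + a) (q + b) A B λ j →
    subst₂ _≤_ (sym (ℕ.+-assoc q b (prefix (suc (toℕ j)) B))) (sym (ℕ.+-assoc p a (prefix (toℕ j) A))) (h (suc j))

record Nested (r r′ : Row) : Set where
  field
    inner≤ : inner r′ ≤ inner r
    outer≤ : outer r′ ≤ outer r

module _ {m} (r r′ : Row) (nested : Nested r r′) (u : Vec (Fin m) (size r)) (v : Vec (Fin m) (size r′))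
         (wu : WeaklyIncreasing u) (wv : WeaklyIncreasing v) where

  open Nested nested

  columnStrict⇒ladder : ColumnStrict r r′ u v → Ladder (inner r) (inner r′) (tally u) (tally v)
  columnStrict⇒ladder strict = prefix⇒ladder (inner r) (inner r′) (tally u) (tally v) bound
    where
    bound : ∀ j → inner r′ + below (suc (toℕ j)) v ≤ inner r + below (toℕ j) u
    bound j with ℕ.<-≤-connex (inner r + below (toℕ j) u) (inner r′ + below (suc (toℕ j)) v)
    ... | inj₂ le = le

    -- In the column just after the letters below `j` of `u`, the lower row has a letter at most
    -- `j`. The upper row has a box there because of `outer≤`, and its letter is at least `j`.
    ... | inj₁ lt = contradiction (strict p q eq) λ u<v → ℕ.<-irrefl refl (ℕ.<-≤-trans u<v (ℕ.≤-trans v≤j j≤u))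
      where
      k = inner r + below (toℕ j) u ∸ inner r′
      inner+k : inner r′ + k ≡ inner r + below (toℕ j) u
      inner+k = ℕ.m+[n∸m]≡n (ℕ.≤-trans inner≤ (ℕ.m≤m+n _ _))
      k<below : k < below (suc (toℕ j)) v
      k<below = ℕ.+-cancelˡ-< (inner r′) _ _ (subst (_< inner r′ + below (suc (toℕ j)) v) (sym inner+k) lt)
      k<size : k < size r′
      k<size = ℕ.<-≤-trans k<below (below-≤ (suc (toℕ j)) v)
      b<size : below (toℕ j) u < size r
      b<size = ℕ.m+n≤o⇒m≤o∸n (suc (below (toℕ j) u)) (begin
        suc (below (toℕ j) u) + inner r   ≡⟨ cong suc (ℕ.+-comm _ (inner r)) ⟩
        suc (inner r + below (toℕ j) u)   ≡⟨ cong suc inner+k ⟨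
        suc (inner r′ + k)                ≡⟨ ℕ.+-suc (inner r′) k ⟨
        inner r′ + suc k                  ≤⟨ ℕ.+-monoʳ-≤ (inner r′) k<size ⟩
        inner r′ + (outer r′ ∸ inner r′)  ≡⟨ ℕ.m+[n∸m]≡n {inner r′} (ℕ.<⇒≤ (ℕ.m∸n≢0⇒n<m {outer r′} λ e → contradiction (subst (k <_) e k<size) λ ())) ⟩
        outer r′                          ≤⟨ outer≤ ⟩
        outer r                           ∎)
        where
        open ℕ.≤-Reasoning
      p : Fin (size r)
      p = fromℕ< b<size
      q : Fin (size r′)
      q = fromℕ< k<size
      eq : inner r + toℕ p ≡ inner r′ + toℕ q
      eq rewrite Fin.toℕ-fromℕ< b<size | Fin.toℕ-fromℕ< k<size = sym inner+k
      v≤j : toℕ (lookup v q) ≤ toℕ j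
      v≤j = s≤s⁻¹ (below⇒< (suc (toℕ j)) v wv q (subst (_< _) (sym (Fin.toℕ-fromℕ< k<size)) k<below))
      j≤u : toℕ j ≤ toℕ (lookup u p)
      j≤u = ℕ.≮⇒≥ λ u<j → ℕ.<-irrefl refl
        (subst (_< below (toℕ j) u) (Fin.toℕ-fromℕ< b<size) (<⇒below (toℕ j) u wu p u<j))

  ladder⇒columnStrict : Ladder (inner r) (inner r′) (tally u) (tally v) → ColumnStrict r r′ u v
  ladder⇒columnStrict l i j eq with ℕ.<-≤-connex (toℕ (lookup u i)) (toℕ (lookup v j))
  ... | inj₁ lt = lt

  ... | inj₂ v≤u = contradiction contra (ℕ.<-irrefl refl)
    where
    open ℕ.≤-Reasoning
    t = lookup v j
    contra : inner r′ + toℕ j < inner r′ + toℕ j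
    contra = begin-strict
      inner r′ + toℕ j                    <⟨ ℕ.+-monoʳ-< (inner r′) (<⇒below (suc (toℕ t)) v wv j ℕ.≤-refl) ⟩
      inner r′ + below (suc (toℕ t)) v    ≤⟨ ladder⇒prefix (inner r) (inner r′) (tally u) (tally v) l t ⟩
      inner r + below (toℕ t) u           ≤⟨ ℕ.+-monoʳ-≤ (inner r) (ℕ.≮⇒≥ λ i<b → ℕ.<⇒≱ (below⇒< (toℕ t) u wu i i<b) v≤u) ⟩
      inner r + toℕ i                     ≡⟨ eq ⟩
      inner r′ + toℕ j                    ∎

-- Semistandard fillings and their row contents

inners outers : ∀ D → Vec ℕ (length D)
inners []      = []
inners (r ∷ D) = inner r ∷ inners D
outers []      = []
outers (r ∷ D) = outer r ∷ outers D

data Skew : SkewDiagram → Set where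
  []  : Skew []
  [_] : ∀ {r} → inner r ≤ outer r → Skew (r ∷ [])
  _∷_ : ∀ {r r′ D} → inner r ≤ outer r × Nested r r′ → Skew (r′ ∷ D) → Skew (r ∷ r′ ∷ D)

contents : ∀ {m} D → Filling m D → Vec (Vec ℕ m) (length D)
contents []      []      = []
contents (r ∷ D) (u ∷ T) = tally u ∷ contents D T

Ladders : ∀ {L m} → Vec ℕ L → Vec (Vec ℕ m) L → Set
Ladders []           []          = ⊤
Ladders (p ∷ [])     (A ∷ [])    = ⊤
Ladders (p ∷ q ∷ μ)  (A ∷ B ∷ M) = Ladder p q A B × Ladders (q ∷ μ) (B ∷ M)

RowSums : ∀ {L m} → Vec ℕ L → Vec ℕ L → Vec (Vec ℕ m) L → Set
RowSums []      []       []      = ⊤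
RowSums (p ∷ μ) (l ∷ ls) (A ∷ M) = p + Vec.sum A ≡ l × RowSums μ ls M

ColumnSums : ∀ {L} (w : List ℕ) → Vec (Vec ℕ (length w)) L → Set
ColumnSums []      M = ⊤
ColumnSums (k ∷ w) M = Vec.sum (Vec.map head M) ≡ k × ColumnSums w (Vec.map tail M)

ladders-uncons : ∀ {L m} (μ : Vec ℕ L) (M : Vec (Vec ℕ (suc m)) L) → Ladders μ M →
                 HorizontalStrip μ (Vec.map head M) × Ladders (μ ⊕ Vec.map head M) (Vec.map tail M)
ladders-uncons []          []                          _             = tt , tt
ladders-uncons (p ∷ [])    ((_ ∷ _) ∷ [])              _             = tt , tt
ladders-uncons (p ∷ q ∷ μ) ((a ∷ A) ∷ (b ∷ B) ∷ M)     ((h , l) , ls)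
  with ladders-uncons (q ∷ μ) ((b ∷ B) ∷ M) ls
... | s , ls′ = (h , s) , (l , ls′)

ladders-cons : ∀ {L m} (μ : Vec ℕ L) (M : Vec (Vec ℕ (suc m)) L) →
               HorizontalStrip μ (Vec.map head M) → Ladders (μ ⊕ Vec.map head M) (Vec.map tail M) → Ladders μ M
ladders-cons []          []                      _       _       = tt
ladders-cons (p ∷ [])    ((_ ∷ _) ∷ [])          _       _       = tt
ladders-cons (p ∷ q ∷ μ) ((a ∷ A) ∷ (b ∷ B) ∷ M) (h , s) (l , ls) =
  (h , l) , ladders-cons (q ∷ μ) ((b ∷ B) ∷ M) s ls

rowSums-uncons : ∀ {L m} (μ λs : Vec ℕ L) (M : Vec (Vec ℕ (suc m)) L) → RowSums μ λs M →
                 RowSums (μ ⊕ Vec.map head M) λs (Vec.map tail M)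
rowSums-uncons []      []       []            _       = tt
rowSums-uncons (p ∷ μ) (l ∷ ls) ((a ∷ A) ∷ M) (e , s) = trans (ℕ.+-assoc p a _) e , rowSums-uncons μ ls M s

rowSums-cons : ∀ {L m} (μ λs : Vec ℕ L) (M : Vec (Vec ℕ (suc m)) L) →
               RowSums (μ ⊕ Vec.map head M) λs (Vec.map tail M) → RowSums μ λs M
rowSums-cons []      []       []            _       = tt
rowSums-cons (p ∷ μ) (l ∷ ls) ((a ∷ A) ∷ M) (e , s) = trans (sym (ℕ.+-assoc p a _)) e , rowSums-cons μ ls M s

ladders-0 : ∀ {L} (μ : Vec ℕ L) (M : Vec (Vec ℕ 0) L) → Ladders μ M
ladders-0 []          []             = tt
ladders-0 (p ∷ [])    ([] ∷ [])      = tt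
ladders-0 (p ∷ q ∷ μ) ([] ∷ [] ∷ M)  = tt , ladders-0 (q ∷ μ) ([] ∷ M)

rowSums-0 : ∀ {L} (μ λs : Vec ℕ L) (M : Vec (Vec ℕ 0) L) → RowSums μ λs M → μ ≡ λs
rowSums-0 []      []       []       _       = refl
rowSums-0 (p ∷ μ) (l ∷ ls) ([] ∷ M) (e , s) = cong₂ _∷_ (trans (sym (ℕ.+-identityʳ p)) e) (rowSums-0 μ ls M s)

rowSums-0′ : ∀ {L} (μ : Vec ℕ L) (M : Vec (Vec ℕ 0) L) → RowSums μ μ M
rowSums-0′ []      []       = tt
rowSums-0′ (p ∷ μ) ([] ∷ M) = ℕ.+-identityʳ p , rowSums-0′ μ M

-- Exchanges the description by pairs of rows for the one by letters: the first rungs of all ladders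
-- form a horizontal strip, and the remaining rungs are ladders over the enlarged inner shape.
sst-intro : ∀ {L} w (μ λs : Vec ℕ L) M → Ladders μ M → RowSums μ λs M → ColumnSums w M → Sst w μ λs M
sst-intro []      μ λs M _ r _       = rowSums-0 μ λs M r
sst-intro (k ∷ w) μ λs M l r (c , cs) with ladders-uncons μ M l
... | s , l′ = c , s , sst-intro w _ λs (Vec.map tail M) l′ (rowSums-uncons μ λs M r) cs

sst-elim : ∀ {L} w (μ λs : Vec ℕ L) M → Sst w μ λs M → Ladders μ M × RowSums μ λs M × ColumnSums w M
sst-elim []      μ .μ M refl = ladders-0 μ M , rowSums-0′ μ M , tt
sst-elim (k ∷ w) μ λs M (c , s , t) with sst-elim w _ λs (Vec.map tail M) t
... | l , r , cs = ladders-cons μ M s l , rowSums-cons μ λs M r , c , cs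

columnSum : ∀ {L m} → Vec (Vec ℕ m) L → Fin m → ℕ
columnSum []      i = 0
columnSum (A ∷ M) i = lookup A i + columnSum M i

columnSum-zero : ∀ {L m} (M : Vec (Vec ℕ (suc m)) L) → Vec.sum (Vec.map head M) ≡ columnSum M zero
columnSum-zero []            = refl
columnSum-zero ((a ∷ _) ∷ M) = cong (a +_) (columnSum-zero M)

columnSum-suc : ∀ {L m} (M : Vec (Vec ℕ (suc m)) L) i → columnSum (Vec.map tail M) i ≡ columnSum M (suc i)
columnSum-suc []            i = refl
columnSum-suc ((_ ∷ A) ∷ M) i = cong (lookup A i +_) (columnSum-suc M i)

columnSums-intro : ∀ {L} w (M : Vec (Vec ℕ (length w)) L) → (∀ i → columnSum M i ≡ List.lookup w i) → ColumnSums w M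
columnSums-intro []      M h = tt
columnSums-intro (k ∷ w) M h = trans (columnSum-zero M) (h zero) ,
  columnSums-intro w (Vec.map tail M) λ i → trans (columnSum-suc M i) (h (suc i))

columnSums-elim : ∀ {L} w (M : Vec (Vec ℕ (length w)) L) → ColumnSums w M → ∀ i → columnSum M i ≡ List.lookup w i
columnSums-elim (k ∷ w) M (c , cs) zero    = trans (sym (columnSum-zero M)) c
columnSums-elim (k ∷ w) M (c , cs) (suc i) = trans (sym (columnSum-suc M i)) (columnSums-elim w (Vec.map tail M) cs i)

count-entries : ∀ {m} D (T : Filling m D) i →
                length (filter (i Fin.≟_) (entries D T)) ≡ columnSum (contents D T) i
count-entries []      []      i = refl
count-entries (r ∷ D) (u ∷ T) i = begin
  length (filter (i Fin.≟_) (Vec.toList u ++ entries D T))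
    ≡⟨ cong length (List.filter-++ (i Fin.≟_) (Vec.toList u) (entries D T)) ⟩
  length (filter (i Fin.≟_) (Vec.toList u) ++ filter (i Fin.≟_) (entries D T))
    ≡⟨ List.length-++ (filter (i Fin.≟_) (Vec.toList u)) ⟩
  length (filter (i Fin.≟_) (Vec.toList u)) + length (filter (i Fin.≟_) (entries D T))
    ≡⟨ cong₂ _+_ (count-tally i u) (count-entries D T i) ⟩
  lookup (tally u) i + columnSum (contents D T) i ∎
  where open ≡-Reasoning

AllIncreasing : ∀ {m} D → Filling m D → Set
AllIncreasing []      []      = ⊤
AllIncreasing (r ∷ D) (u ∷ T) = WeaklyIncreasing u × AllIncreasing D T

semistandard⇒increasing : ∀ {m} D (T : Filling m D) → Semistandard D T → AllIncreasing D T
semistandard⇒increasing []           []          _           = tt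
semistandard⇒increasing (r ∷ [])     (u ∷ [])    w           = w , tt
semistandard⇒increasing (r ∷ r′ ∷ D) (u ∷ v ∷ T) (w , _ , s) = w , semistandard⇒increasing (r′ ∷ D) (v ∷ T) s

semistandard⇒ladders : ∀ {m} D (T : Filling m D) → Skew D → Semistandard D T → Ladders (inners D) (contents D T)
semistandard⇒ladders []           []          _              _           = tt
semistandard⇒ladders (r ∷ [])     (u ∷ [])    _              _           = tt
semistandard⇒ladders (r ∷ r′ ∷ D) (u ∷ v ∷ T) ((_ , n) ∷ sk) (w , c , s) =
  columnStrict⇒ladder r r′ n u v w (proj₁ (semistandard⇒increasing (r′ ∷ D) (v ∷ T) s)) c ,
  semistandard⇒ladders (r′ ∷ D) (v ∷ T) sk s

ladders⇒semistandard : ∀ {m} D (T : Filling m D) → Skew D → AllIncreasing D T →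
                       Ladders (inners D) (contents D T) → Semistandard D T
ladders⇒semistandard []           []          _              _              _        = tt
ladders⇒semistandard (r ∷ [])     (u ∷ [])    _              (w , _)        _        = w
ladders⇒semistandard (r ∷ r′ ∷ D) (u ∷ v ∷ T) ((_ , n) ∷ sk) (w , w′ , inc) (l , ls) =
  w , ladder⇒columnStrict r r′ n u v w w′ l , ladders⇒semistandard (r′ ∷ D) (v ∷ T) sk (w′ , inc) ls

contents-injective : ∀ {m} D (T T′ : Filling m D) → AllIncreasing D T → AllIncreasing D T′ →
                     contents D T ≡ contents D T′ → T ≡ T′
contents-injective []      []      []        _       _         _  = refl
contents-injective (r ∷ D) (u ∷ T) (u′ ∷ T′) (w , i) (w′ , i′) eq with Vec.∷-injective eq
... | e , es = cong₂ _∷_ (tally-injective u u′ w w′ e) (contents-injective D T T′ i i′ es)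

skew-tail : ∀ {r D} → Skew (r ∷ D) → inner r ≤ outer r × Skew D
skew-tail [ le ]         = le , []
skew-tail ((le , _) ∷ s) = le , s

contents-rowSums : ∀ {m} D (T : Filling m D) → Skew D → RowSums (inners D) (outers D) (contents D T)
contents-rowSums []      []      _ = tt
contents-rowSums (r ∷ D) (u ∷ T) s with skew-tail s
... | le , s′ = trans (cong (inner r +_) (sum-tally u)) (ℕ.m+[n∸m]≡n le) , contents-rowSums D T s′

contents-surjective : ∀ {m} D (M : Vec (Vec ℕ m) (length D)) → RowSums (inners D) (outers D) M →
                      ∃[ T ] AllIncreasing D T × contents D T ≡ M
contents-surjective []      []      _       = [] , tt , refl
contents-surjective (r ∷ D) (A ∷ M) (e , es) with contents-surjective D M es
... | T , inc , eq with word A (size r) (trans (sym (ℕ.m+n∸m≡n (inner r) _)) (cong (_∸ inner r) e))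
... | u , w , eq′ = u ∷ T , (w , inc) , cong₂ _∷_ eq′ eq

words-enumerate : ∀ m k → Enumerates (λ _ → ⊤) (words m k)
words-enumerate m zero = record
  { unique = [] ∷ [] ; sound = λ _ → tt ; complete = λ { {[]} _ → here refl } }
words-enumerate m (suc k) = record
  { unique   = Unique.cartesianProductWith⁺ _∷_ Vec.∷-injective (Unique.allFin⁺ m) (unique E)
  ; sound    = λ _ → tt
  ; complete = λ { {x ∷ u} _ → ∈-cartesianProductWith⁺ _∷_ (∈-allFin x) (complete E tt) }
  }
  where
  open Enumerates
  E = words-enumerate m k

fillings-enumerate : ∀ m D → Enumerates (λ _ → ⊤) (fillings m D)
fillings-enumerate m [] = record
  { unique = [] ∷ [] ; sound = λ _ → tt ; complete = λ { {[]} _ → here refl } }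
fillings-enumerate m (r ∷ D) = record
  { unique   = Unique.cartesianProductWith⁺ All._∷_ (λ { refl → refl , refl })
                 (unique (words-enumerate m (size r))) (unique (fillings-enumerate m D))
  ; sound    = λ _ → tt
  ; complete = λ { {u ∷ T} _ → ∈-cartesianProductWith⁺ All._∷_
                 (complete (words-enumerate m (size r)) tt) (complete (fillings-enumerate m D) tt) }
  }
  where open Enumerates

tableaux : ∀ w D → List (Filling (length w) D)
tableaux w D = filter (λ T → semistandard? D T ×-dec hasContent? w D T) (fillings (length w) D)

contents-enumerate : ∀ w D → Skew D → Enumerates (Sst w (inners D) (outers D)) (map (contents D) (tableaux w D))
contents-enumerate w D sk = image-enumerates (contents D)
  (λ {T} (_ , s , c) → sst-intro w _ _ (contents D T) (semistandard⇒ladders D T sk s) (contents-rowSums D T sk)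
    (columnSums-intro w (contents D T) λ i → trans (sym (count-entries D T i)) (c i)))
  (λ {T} {T′} (_ , s , _) (_ , s′ , _) →
    contents-injective D T T′ (semistandard⇒increasing D T s) (semistandard⇒increasing D T′ s′))
  (λ {M} q → surjective M q)
  (filter-enumerates _ (fillings-enumerate (length w) D))
  where
  surjective : ∀ M → Sst w (inners D) (outers D) M →
               ∃[ T ] (⊤ × Semistandard D T × HasContent w D T) × contents D T ≡ M
  surjective M q with sst-elim w _ _ M q
  ... | l , r , cs with contents-surjective D M r
  ... | T , inc , refl = T ,
    (tt , ladders⇒semistandard D T sk inc l ,
      λ i → trans (count-entries D T i) (columnSums-elim w (contents D T) cs i)) , refl

-- The crystal operator on two rows and the descents it respects

private variable
  n : ℕ
  A A′ B B′ C C′ W X Y : Vec ℕ n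

-- The crystal operator: A′ loses and B′ gains the smallest unmatched letter of A.
data Move : Vec ℕ n → Vec ℕ n → Vec ℕ n → Vec ℕ n → Set where
  here  : ∀ {a b} → unmatched A B ≤ a → Move (suc a ∷ A) (b ∷ B) (a ∷ A) (suc b ∷ B)
  there : ∀ {a b} → a ≤ unmatched A B → Move A B A′ B′ → Move (a ∷ A) (b ∷ B) (a ∷ A′) (b ∷ B′)

Descent : Vec ℕ n → Vec ℕ n → Set
Descent []      []      = ⊥
Descent (a ∷ A) (b ∷ B) = (0 < a × 0 < Vec.sum B) ⊎ Descent A B

-- There are letters a < b < c in the respective rows.
DoubleDescent : Vec ℕ n → Vec ℕ n → Vec ℕ n → Set
DoubleDescent []      []      []      = ⊥
DoubleDescent (a ∷ A) (b ∷ B) (c ∷ C) = (0 < a × Descent B C) ⊎ DoubleDescent A B C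

doubleDescent? : (A B C : Vec ℕ n) → Dec (DoubleDescent A B C)
doubleDescent? []      []      []      = no λ ()
doubleDescent? (a ∷ A) (b ∷ B) (c ∷ C) = (0 ℕ.<? a ×-dec descent? B C) ⊎-dec doubleDescent? A B C
  where
  descent? : ∀ {n} (A B : Vec ℕ n) → Dec (Descent A B)
  descent? []      []      = no λ ()
  descent? (a ∷ A) (b ∷ B) = (0 ℕ.<? a ×-dec 0 ℕ.<? Vec.sum B) ⊎-dec descent? A B

-- max A ≤ max A′, phrased as: A′ meets every final segment of the alphabet that A meets.
Dominated : Vec ℕ n → Vec ℕ n → Set
Dominated []      []        = ⊤
Dominated (a ∷ A) (a′ ∷ A′) = (0 < a + Vec.sum A → 0 < a′ + Vec.sum A′) × Dominated A A′

-- Some letter of B is at most every letter of A.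
Undercut : Vec ℕ n → Vec ℕ n → Set
Undercut []      []      = ⊥
Undercut (a ∷ A) (b ∷ B) = 0 < b ⊎ (a ≡ 0 × Undercut A B)

_⊑_ : Vec ℕ n → Vec ℕ n → Set
[]      ⊑ []        = ⊤
(a ∷ A) ⊑ (a′ ∷ A′) = a ≤ a′ × A ⊑ A′

⊑-refl : (A : Vec ℕ n) → A ⊑ A
⊑-refl []      = tt
⊑-refl (_ ∷ A) = ℕ.≤-refl , ⊑-refl A

⊑-trans : A ⊑ B → B ⊑ C → A ⊑ C
⊑-trans {A = []}    {[]}    {[]}    _       _       = tt
⊑-trans {A = _ ∷ _} {_ ∷ _} {_ ∷ _} (p , q) (r , s) = ℕ.≤-trans p r , ⊑-trans q s

⊑-sum : A ⊑ B → Vec.sum A ≤ Vec.sum B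
⊑-sum {A = []}    {[]}    _       = z≤n
⊑-sum {A = _ ∷ _} {_ ∷ _} (p , q) = ℕ.+-mono-≤ p (⊑-sum q)

move-upper : Move A B A′ B′ → A′ ⊑ A
move-upper (here _)    = ℕ.n≤1+n _ , ⊑-refl _
move-upper (there _ m) = ℕ.≤-refl , move-upper m

move-lower : Move A B A′ B′ → B ⊑ B′
move-lower (here _)    = ℕ.n≤1+n _ , ⊑-refl _
move-lower (there _ m) = ℕ.≤-refl , move-lower m

sum-upper : Move A B A′ B′ → Vec.sum A ≡ suc (Vec.sum A′)
sum-upper (here _)            = refl
sum-upper (there {a = a} _ m) = trans (cong (a +_) (sum-upper m)) (ℕ.+-suc a _)

sum-lower : Move A B A′ B′ → Vec.sum B′ ≡ suc (Vec.sum B)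
sum-lower (here _)            = refl
sum-lower (there {b = b} _ m) = trans (cong (b +_) (sum-lower m)) (ℕ.+-suc b _)

move-⊕ : ∀ (ν : Vec ℕ n) → Move A B A′ B′ → (ν ⊕ A) ⊕ B ≡ (ν ⊕ A′) ⊕ B′
move-⊕ (v ∷ ν) (here {A = A} {B = B} {a = a} {b} _) =
  cong (_∷ (ν ⊕ A) ⊕ B) (trans (cong (_+ b) (ℕ.+-suc v a)) (sym (ℕ.+-suc (v + a) b)))
move-⊕ (v ∷ ν) (there _ m) = cong (_ ∷_) (move-⊕ ν m)

move-unmatched : Move A B A′ B′ → unmatched A′ B′ ≡ suc (unmatched A B)
move-unmatched (here {a = a} {b} le)
  rewrite ℕ.m≤n⇒m∸n≡0 le | ℕ.m≤n⇒m∸n≡0 (ℕ.m≤n⇒m≤1+n le) = refl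
move-unmatched (there {a = a} {b} le m)
  rewrite move-unmatched m | ℕ.+-∸-assoc 1 le = refl

-- The result shows where the letter was moved: `here` leaves at most `a` unmatched letters in the
-- tails, while after `there` their number exceeds `a` by `move-unmatched`.
move-injective : Move A B X Y → Move A′ B′ X Y → A ≡ A′ × B ≡ B′
move-injective (here _)    (here _)     = refl , refl
move-injective (there _ m) (there _ m′) with move-injective m m′
... | refl , refl = refl , refl
move-injective (here le) (there le′ m′)
  rewrite move-unmatched m′ = contradiction (ℕ.≤-trans le le′) (ℕ.<-irrefl refl)
move-injective (there le m) (here le′)
  rewrite move-unmatched m = contradiction (ℕ.≤-trans le′ le) (ℕ.<-irrefl refl)

-- The number of unbracketed letters of A is `Vec.sum A + unmatched A B` less `Vec.sum B`. If all
-- `a` copies of the smallest letter are bracketed, discarding that letter does not change this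
-- number, so the lower bound `k` persists.
unmatched-excess : ∀ s s′ u a b k → a ≤ u →
  k + (b + s′) ≤ (a + s) + ((u ∸ a) + b) → k + s′ ≤ s + u
unmatched-excess s s′ u a b k a≤u le = ℕ.+-cancelʳ-≤ b _ _ (begin
  k + s′ + b                ≡⟨ r₁ k s′ b ⟩
  k + (b + s′)              ≤⟨ le ⟩
  (a + s) + ((u ∸ a) + b)   ≡⟨ r₂ a s (u ∸ a) b ⟩
  s + (u ∸ a + a) + b       ≡⟨ cong (λ z → s + z + b) (ℕ.m∸n+n≡m a≤u) ⟩
  s + u + b                 ∎)
  where
  open ℕ.≤-Reasoning
  r₁ : ∀ k s b → k + s + b ≡ k + (b + s)
  r₁ = solve-∀
  r₂ : ∀ a s d b → (a + s) + (d + b) ≡ s + (d + a) + b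
  r₂ = solve-∀

move-exists : (A B : Vec ℕ n) → Vec.sum B < Vec.sum A + unmatched A B → ∃₂ λ A′ B′ → Move A B A′ B′
move-exists []      []      ()
move-exists (a ∷ A) (b ∷ B) lt with ℕ.<-≤-connex (unmatched A B) a
move-exists (suc a ∷ A) (b ∷ B) lt | inj₁ u<a = _ , _ , here (s≤s⁻¹ u<a)
move-exists (a ∷ A) (b ∷ B) lt | inj₂ a≤u
  with move-exists A B (unmatched-excess (Vec.sum A) (Vec.sum B) (unmatched A B) a b 1 a≤u lt)
... | _ , _ , m = _ , _ , there a≤u m

-- Copies of the smallest letter in the lower row are never bracketed, so `unmatched` bounds them.
-- This is what keeps the Yamanouchi condition after a move: the part that lost a letter still
-- leaves room for the next letter of the lower row.
strip-weaken : ∀ {p q} (ν x : Vec ℕ n) {y : Vec ℕ n} → Strip p ν x → Strip q (ν ⊕ x) y →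
               ∀ {r} → p + unmatched x y ≤ r → Strip r (ν ⊕ x) y
strip-weaken []      []      {[]}    _       _       _  = tt
strip-weaken (v ∷ ν) (x ∷ xs) {y ∷ ys} (h , _) (_ , g) le =
  ℕ.≤-trans (ℕ.+-mono-≤ h (ℕ.m≤n+m y _)) le , g

move-strip : ∀ {p q} (ν : Vec ℕ n) → Move A B A′ B′ → Strip p ν A → Strip q (ν ⊕ A) B →
             Strip p ν A′ × Strip q (ν ⊕ A′) B′
move-strip {q = q} (v ∷ ν) (here {A = A} {a = a} {b} le) (h , hs) (g , gs) =
  (ℕ.≤-trans (ℕ.+-monoʳ-≤ v (ℕ.n≤1+n a)) h , hs) ,
  (subst (_≤ q) (trans (cong (_+ b) (ℕ.+-suc v a)) (sym (ℕ.+-suc (v + a) b))) g ,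
   strip-weaken ν A hs gs (ℕ.+-monoʳ-≤ v le))
move-strip (v ∷ ν) (there _ m) (h , hs) (g , gs) with move-strip ν m hs gs
... | p , q = (h , p) , (g , q)

move-horizontal : (ν : Vec ℕ n) → Move A B A′ B′ → HorizontalStrip ν A → HorizontalStrip (ν ⊕ A) B →
                  HorizontalStrip ν A′ × HorizontalStrip (ν ⊕ A′) B′
move-horizontal (v ∷ ν) (here {A = A} le) h g = h , strip-weaken ν A h g (ℕ.+-monoʳ-≤ v le)
move-horizontal (v ∷ ν) (there _ m) h g = move-strip ν m h g

unmatched-≤ : (A B : Vec ℕ n) → unmatched A B ≤ Vec.sum B
unmatched-≤ []      []      = z≤n
unmatched-≤ (a ∷ A) (b ∷ B) = begin
  (unmatched A B ∸ a) + b   ≤⟨ ℕ.+-monoˡ-≤ b (ℕ.≤-trans (ℕ.m∸n≤m _ a) (unmatched-≤ A B)) ⟩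
  Vec.sum B + b             ≡⟨ ℕ.+-comm _ b ⟩
  b + Vec.sum B             ∎
  where open ℕ.≤-Reasoning

-- A descent exists exactly if a bracket does, and `Vec.sum B` less `unmatched A B` is the number of
-- brackets. As moves keep this number, they carry descents in both directions.
descent⇒matched : Descent A B → unmatched A B < Vec.sum B
descent⇒matched {A = []} {[]} ()
descent⇒matched {A = a ∷ A} {b ∷ B} d =
  subst (unmatched (a ∷ A) (b ∷ B) <_) (ℕ.+-comm (Vec.sum B) b) (ℕ.+-monoˡ-< b (lt d))
  where
  lt : Descent (a ∷ A) (b ∷ B) → unmatched A B ∸ a < Vec.sum B
  lt (inj₂ d) = ℕ.≤-<-trans (ℕ.m∸n≤m _ a) (descent⇒matched d)
  lt (inj₁ (s≤s {n = a′} _ , 0<B)) with unmatched A B | unmatched-≤ A B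
  ... | zero  | _  = 0<B
  ... | suc u | le = ℕ.≤-trans (s≤s (ℕ.m∸n≤m u a′)) le

matched⇒descent : unmatched A B < Vec.sum B → Descent A B
matched⇒descent {A = []}        {[]}    ()
matched⇒descent {A = a ∷ A}     {b ∷ B} lt = go a lt′
  where
  lt′ : unmatched A B ∸ a < Vec.sum B
  lt′ = ℕ.+-cancelʳ-< b _ _ (subst (unmatched (a ∷ A) (b ∷ B) <_) (ℕ.+-comm b (Vec.sum B)) lt)
  go : ∀ a → unmatched A B ∸ a < Vec.sum B → Descent (a ∷ A) (b ∷ B)
  go zero    lt = inj₂ (matched⇒descent lt)
  go (suc a) lt = inj₁ (s≤s z≤n , ℕ.≤-<-trans z≤n lt)

move-descent : Move A B A′ B′ → Descent A B → Descent A′ B′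
move-descent m d = matched⇒descent
  (subst₂ _<_ (sym (move-unmatched m)) (sym (sum-lower m)) (s≤s (descent⇒matched d)))

move-descent⁻ : Move A B A′ B′ → Descent A′ B′ → Descent A B
move-descent⁻ m d = matched⇒descent
  (s≤s⁻¹ (subst₂ _<_ (move-unmatched m) (sum-lower m) (descent⇒matched d)))

descent-⊑ : A ⊑ A′ → B ⊑ B′ → Descent A B → Descent A′ B′
descent-⊑ {A = []} {[]} {[]} {[]} _ _ ()
descent-⊑ {A = _ ∷ _} {_ ∷ _} {_ ∷ _} {_ ∷ _} (p , ps) (q , qs) (inj₁ (a , b)) =
  inj₁ (ℕ.≤-trans a p , ℕ.≤-trans b (⊑-sum qs))
descent-⊑ {A = _ ∷ _} {_ ∷ _} {_ ∷ _} {_ ∷ _} (p , ps) (q , qs) (inj₂ d) = inj₂ (descent-⊑ ps qs d)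

descent⇒nonempty : Descent A B → 0 < Vec.sum B
descent⇒nonempty d = ℕ.≤-<-trans z≤n (descent⇒matched d)

double-⊑ : A ⊑ A′ → B ⊑ B′ → C ⊑ C′ → DoubleDescent A B C → DoubleDescent A′ B′ C′
double-⊑ {A = []} {[]} {[]} {[]} {[]} {[]} _ _ _ ()
double-⊑ {A = _ ∷ _} {_ ∷ _} {_ ∷ _} {_ ∷ _} {_ ∷ _} {_ ∷ _} (p , _) (_ , qs) (_ , rs) (inj₁ (a , d)) =
  inj₁ (ℕ.≤-trans a p , descent-⊑ qs rs d)
double-⊑ {A = _ ∷ _} {_ ∷ _} {_ ∷ _} {_ ∷ _} {_ ∷ _} {_ ∷ _} (_ , ps) (_ , qs) (_ , rs) (inj₂ d) =
  inj₂ (double-⊑ ps qs rs d)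

double⇒descent : DoubleDescent A B C → Descent A B
double⇒descent {A = []} {[]} {[]} ()
double⇒descent {A = _ ∷ _} {b ∷ B} {_ ∷ C} (inj₁ (a , d)) = inj₁ (a , letter B C d)
  where
  letter : ∀ {n} (B C : Vec ℕ n) → Descent B C → 0 < Vec.sum B
  letter []      []      ()
  letter (b ∷ B) (_ ∷ _) (inj₁ (p , _)) = ℕ.≤-trans p (ℕ.m≤m+n b _)
  letter (b ∷ B) (_ ∷ C) (inj₂ d)       = ℕ.≤-trans (letter B C d) (ℕ.m≤n+m _ b)
double⇒descent {A = _ ∷ _} {_ ∷ _} {_ ∷ _} (inj₂ d)       = inj₂ (double⇒descent d)

double⇒descent′ : DoubleDescent A B C → Descent B C
double⇒descent′ {A = []} {[]} {[]} ()
double⇒descent′ {A = _ ∷ _} {_ ∷ _} {_ ∷ _} (inj₁ (_ , d)) = inj₂ d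
double⇒descent′ {A = _ ∷ _} {_ ∷ _} {_ ∷ _} (inj₂ d)       = inj₂ (double⇒descent′ d)

-- A letter of X is followed by letters of the larger part of the alphabet only, and restricted to
-- such a part a move is again a move or changes nothing.
double-move-lower : Move A B A′ B′ → DoubleDescent X A B → DoubleDescent X A′ B′
double-move-lower {X = _ ∷ _} (here _)    d              = d
double-move-lower {X = _ ∷ _} (there _ m) (inj₁ (x , d)) = inj₁ (x , move-descent m d)
double-move-lower {X = _ ∷ _} (there _ m) (inj₂ d)       = inj₂ (double-move-lower m d)

double-move-lower⁻ : Move A B A′ B′ → DoubleDescent X A′ B′ → DoubleDescent X A B
double-move-lower⁻ {X = _ ∷ _} (here _)    d              = d
double-move-lower⁻ {X = _ ∷ _} (there _ m) (inj₁ (x , d)) = inj₁ (x , move-descent⁻ m d)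
double-move-lower⁻ {X = _ ∷ _} (there _ m) (inj₂ d)       = inj₂ (double-move-lower⁻ m d)

-- The letter of B that starts the descent is bracketed, hence has a smaller letter of A.
all-matched⇒double : unmatched A B ≤ 0 → Descent B C → DoubleDescent A B C
all-matched⇒double {A = []} {[]} {[]} _ ()
all-matched⇒double {A = a ∷ A} {b ∷ B} {c ∷ C} le d
  with ℕ.m+n≡0⇒n≡0 (unmatched A B ∸ a) (ℕ.n≤0⇒n≡0 le)
all-matched⇒double {A = suc a ∷ A} {_ ∷ B} {c ∷ C} le (inj₂ d) | refl = inj₁ (s≤s z≤n , d)
all-matched⇒double {A = zero ∷ A} {_ ∷ B} {c ∷ C} le (inj₂ d) | refl =
  inj₂ (all-matched⇒double (subst (_≤ 0) (ℕ.+-identityʳ _) le) d)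

-- All letters of B larger than the moved one are bracketed, since that one would otherwise have
-- been bracketed itself. An unbracketed letter of B is therefore at most the moved letter and can
-- replace it in a descent.
move-descent-next : 0 < unmatched A B → Move A B A′ B′ → Descent B′ C → Descent B C
move-descent-next {A = suc a ∷ A} {b ∷ B} {C = c ∷ C} lt (here le) d
  rewrite ℕ.m≤n⇒m∸n≡0 (ℕ.m≤n⇒m≤1+n le) with d
... | inj₁ (_ , p) = inj₁ (lt , p)
... | inj₂ d′      = inj₂ d′
move-descent-next {A = a ∷ A} {b ∷ B} {C = c ∷ C} lt (there le m) (inj₁ p) = inj₁ p
move-descent-next {A = a ∷ A} {b ∷ B} {C = c ∷ C} lt (there le m) (inj₂ d) with unmatched A B in eq
... | suc u = inj₂ (move-descent-next (subst (0 <_) (sym eq) (s≤s z≤n)) m d)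
... | zero rewrite ℕ.0∸n≡0 a = inj₁ (lt , descent⇒nonempty d)

-- The critical case is the loss of the only copy of the letter starting the triple. All larger
-- letters of B are then bracketed with letters that remain in A, and one of these can start the
-- triple.
double-move-upper : Move A B A′ B′ → DoubleDescent A B C → DoubleDescent A′ B′ C
double-move-upper {C = _ ∷ _} (here {a = suc a} le) (inj₁ (_ , d)) = inj₁ (s≤s z≤n , d)
double-move-upper {C = _ ∷ _} (here {a = zero} le)  (inj₁ (_ , d)) = inj₂ (all-matched⇒double le d)
double-move-upper {C = _ ∷ _} (here _)    (inj₂ d)       = inj₂ d
double-move-upper {C = _ ∷ _} (there _ m) (inj₁ (a , d)) = inj₁ (a , descent-⊑ (move-lower m) (⊑-refl _) d)
double-move-upper {C = _ ∷ _} (there _ m) (inj₂ d)       = inj₂ (double-move-upper m d)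

double-move-upper⁻ : Move A B A′ B′ → DoubleDescent A′ B′ C → DoubleDescent A B C
double-move-upper⁻ {C = _ ∷ _} (here _)     (inj₁ (_ , d)) = inj₁ (s≤s z≤n , d)
double-move-upper⁻ {C = _ ∷ _} (here _)     (inj₂ d)       = inj₂ d
double-move-upper⁻ {C = _ ∷ _} (there le m) (inj₁ (a , d)) =
  inj₁ (a , move-descent-next (ℕ.≤-trans a le) m d)
double-move-upper⁻ {C = _ ∷ _} (there _ m)  (inj₂ d)       = inj₂ (double-move-upper⁻ m d)

dominated-refl : (A : Vec ℕ n) → Dominated A A
dominated-refl []      = tt
dominated-refl (_ ∷ A) = (λ p → p) , dominated-refl A

dominated-sum : Dominated A A′ → 0 < Vec.sum A → 0 < Vec.sum A′
dominated-sum {A = []}    {[]}    _       ()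
dominated-sum {A = _ ∷ _} {_ ∷ _} (p , _) = p

descent-dominated : Dominated B B′ → Descent A B → Descent A B′
descent-dominated {B = []} {[]} {[]} _ ()
descent-dominated {B = _ ∷ _} {_ ∷ _} {_ ∷ _} (_ , ps) (inj₁ (a , b)) = inj₁ (a , dominated-sum ps b)
descent-dominated {B = _ ∷ _} {_ ∷ _} {_ ∷ _} (_ , ps) (inj₂ d)       = inj₂ (descent-dominated ps d)

double-dominated : Dominated C C′ → DoubleDescent A B C → DoubleDescent A B C′
double-dominated {C = []} {[]} {[]} {[]} _ ()
double-dominated {C = _ ∷ _} {_ ∷ _} {_ ∷ _} {_ ∷ _} (_ , ps) (inj₁ (a , d)) = inj₁ (a , descent-dominated ps d)
double-dominated {C = _ ∷ _} {_ ∷ _} {_ ∷ _} {_ ∷ _} (_ , ps) (inj₂ d)       = inj₂ (double-dominated ps d)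

-- The hypothesis says that at least two letters of A are unbracketed. The smallest of them moves,
-- and another one, no smaller, stays.
move-dominated : Move A B A′ B′ → 2 + Vec.sum B ≤ Vec.sum A + unmatched A B → Dominated A A′
move-dominated (here {a = suc a} _) _ = (λ _ → s≤s z≤n) , dominated-refl _
move-dominated (here {A = A} {B = B} {a = zero} {b} le) lt = (λ _ → letter) , dominated-refl _
  where
  letter : 0 < Vec.sum A
  letter rewrite ℕ.n≤0⇒n≡0 le | ℕ.+-comm (Vec.sum A) b = ℕ.≤-trans (s≤s z≤n)
    (ℕ.+-cancelˡ-≤ b (suc (Vec.sum B)) (Vec.sum A) (subst (_≤ b + Vec.sum A) (sym (ℕ.+-suc b _)) (s≤s⁻¹ lt)))
move-dominated {A = a ∷ A} {b ∷ B} (there le m) lt = front a ih , ih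
  where
  ih = move-dominated m (unmatched-excess (Vec.sum A) (Vec.sum B) (unmatched A B) a b 2 le lt)
  front : ∀ {n} {A A′ : Vec ℕ n} a → Dominated A A′ → 0 < a + Vec.sum A → 0 < a + Vec.sum A′
  front zero    d p = dominated-sum d p
  front (suc a) d _ = s≤s z≤n

-- Otherwise the smallest letter of A would be smaller than every letter of B, and any descent from
-- B to C would extend to a triple.
undercut : ¬ DoubleDescent A B C → Descent B C → Undercut A B
undercut {A = []} {[]} {[]} _ ()
undercut {A = _ ∷ _} {_ ∷ _} {_ ∷ _} _ (inj₁ (b , _)) = inj₁ b
undercut {A = zero ∷ _} {_ ∷ _} {_ ∷ _} ¬d (inj₂ d) = inj₂ (refl , undercut (λ p → ¬d (inj₂ p)) d)
undercut {A = suc _ ∷ _} {_ ∷ _} {_ ∷ _} ¬d (inj₂ d) = contradiction (inj₁ (s≤s z≤n , d)) ¬d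

undercut⇒unmatched : Undercut A B → 0 < unmatched A B
undercut⇒unmatched {A = []} {[]} ()
undercut⇒unmatched {A = _ ∷ _} {b ∷ _} (inj₁ p)          = ℕ.≤-trans p (ℕ.m≤n+m b _)
undercut⇒unmatched {A = _ ∷ _} {b ∷ _} (inj₂ (refl , p)) = ℕ.≤-trans (undercut⇒unmatched p) (ℕ.m≤m+n _ b)

-- The letter gained by B comes from A, so the undercutting letter of B is no larger and can take
-- its place at the start of the triple.
undercut-move : Undercut A B → Move A B A′ B′ → DoubleDescent B′ C W → DoubleDescent B C W
undercut-move {C = _ ∷ _} {_ ∷ _} (inj₁ p)  (here _)    (inj₁ (_ , d)) = inj₁ (p , d)
undercut-move {C = _ ∷ _} {_ ∷ _} (inj₁ p)  (here _)    (inj₂ d)       = inj₂ d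
undercut-move {C = _ ∷ _} {_ ∷ _} (inj₂ ()) (here _)    _
undercut-move {C = _ ∷ _} {_ ∷ _} (inj₁ p)  (there _ m) (inj₁ q)       = inj₁ q
undercut-move {C = _ ∷ _} {_ ∷ _} (inj₁ p)  (there _ m) (inj₂ d)       = inj₁ (p , double⇒descent′ d)
undercut-move {C = _ ∷ _} {_ ∷ _} (inj₂ (_ , u)) (there _ m) (inj₁ q)  = inj₁ q
undercut-move {C = _ ∷ _} {_ ∷ _} (inj₂ (_ , u)) (there _ m) (inj₂ d)  = inj₂ (undercut-move u m d)

-- Moving a letter through several rows

Rows : ℕ → Set
Rows n = List (Vec ℕ n)

-- Move a letter from the first row to the second, from the second to the third and
-- so on, up to the first double descent.
data Block : Rows n → Rows n → Set where
  last : Move A B A′ B′ → Block (A ∷ B ∷ []) (A′ ∷ B′ ∷ [])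
  stop : ∀ {R : Rows n} → DoubleDescent A B C → Move A B A′ B′ →
         Block (A ∷ B ∷ C ∷ R) (A′ ∷ B′ ∷ C ∷ R)
  step : ∀ {R S : Rows n} {B″} → ¬ DoubleDescent A B C → Move A B A′ B′ →
         Block (B′ ∷ C ∷ R) (B″ ∷ C′ ∷ S) → Block (A ∷ B ∷ C ∷ R) (A′ ∷ B″ ∷ C′ ∷ S)

block-first : ∀ {R S : Rows n} → Block (A ∷ R) (A′ ∷ S) → A′ ⊑ A
block-first (last m)     = move-upper m
block-first (stop _ m)   = move-upper m
block-first (step _ m _) = move-upper m

-- The move at the top reflects double descents; whatever follows only takes a letter away from its
-- second row.
block-double⁻ : ∀ {R S : Rows n} → Block (A ∷ B ∷ R) (A′ ∷ B′ ∷ S) →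
                DoubleDescent X A′ B′ → DoubleDescent X A B
block-double⁻ (last m)     d = double-move-lower⁻ m d
block-double⁻ (stop _ m)   d = double-move-lower⁻ m d
block-double⁻ (step _ m b) d =
  double-move-lower⁻ m (double-⊑ (⊑-refl _) (⊑-refl _) (block-first b) d)

-- Stopping and continuing are told apart by the first three rows of the result: they contain a
-- double descent after `stop`, whereas one found after `step` would reflect back to the original
-- rows.
block-injective : ∀ {R S Z : Rows n} → Block R Z → Block S Z → R ≡ S
block-injective (last m) (last m′) with move-injective m m′
... | refl , refl = refl
block-injective (stop _ m) (stop _ m′) with move-injective m m′
... | refl , refl = refl
block-injective (step _ m b) (step _ m′ b′) with block-injective b b′
... | refl with move-injective m m′
... | refl , refl = refl
block-injective (stop d m) (step ¬d m′ b) =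
  contradiction (double-move-upper⁻ m′ (block-double⁻ b (double-move-upper m d))) ¬d
block-injective (step ¬d m b) (stop d m′) =
  contradiction (double-move-upper⁻ m (block-double⁻ b (double-move-upper m′ d))) ¬d

-- From the bottom up: a block is moved as soon as a double descent starts in the
-- row above it. Its presence afterwards makes the process reversible.
data Prepare : Rows n → Rows n → Set where
  base  : Prepare (A ∷ B ∷ []) (A ∷ B ∷ [])
  apply : ∀ {R S T : Rows n} → Prepare R S → Block S (B ∷ C ∷ T) → DoubleDescent A B C →
          Prepare (A ∷ R) (A ∷ B ∷ C ∷ T)
  keep  : ∀ {R S : Rows n} → Prepare R (B ∷ C ∷ S) → ¬ DoubleDescent A B C →
          Prepare (A ∷ R) (A ∷ B ∷ C ∷ S)

prepare-injective : ∀ {R S Z : Rows n} → Prepare R Z → Prepare S Z → R ≡ S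
prepare-injective base base = refl
prepare-injective (apply p b _)  (apply p′ b′ _) with block-injective b b′
... | refl = cong (_ ∷_) (prepare-injective p p′)
prepare-injective (keep p _)     (keep p′ _)     = cong (_ ∷_) (prepare-injective p p′)
prepare-injective (apply _ _ d)  (keep _ ¬d)     = contradiction d ¬d
prepare-injective (keep _ ¬d)    (apply _ _ d)   = contradiction d ¬d

-- The row sizes before a block is moved: the row ending the block lacks one letter.
data Ready {n} (a : ℕ) : Rows n → Set where
  last : a ≤ Vec.sum A → suc (Vec.sum B) ≡ a → Descent A B → Ready a (A ∷ B ∷ [])
  stop : ∀ {R : Rows n} → a ≤ Vec.sum A → suc (Vec.sum B) ≡ a → Descent A B → DoubleDescent A B C →
         Linked Descent (B ∷ C ∷ R) → All (λ X → Vec.sum X ≡ a) (C ∷ R) → Ready a (A ∷ B ∷ C ∷ R)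
  step : ∀ {R : Rows n} → a ≤ Vec.sum A → Vec.sum B ≡ a → Descent A B → ¬ DoubleDescent A B C →
         Ready a (B ∷ C ∷ R) → Ready a (A ∷ B ∷ C ∷ R)

ready-descent : ∀ {a} {R : Rows n} → Ready a (A ∷ B ∷ R) → Descent A B
ready-descent (last _ _ d)         = d
ready-descent (stop _ _ d _ _ _)   = d
ready-descent (step _ _ d _ _)     = d

-- A longer first row threatens only the absence of a double descent in `step`; there the
-- undercutting letter shows that the received letter starts no new triple.
ready-gain : ∀ {a} {R : Rows n} → Undercut A B → Move A B A′ B′ → Ready a (B ∷ R) → Ready a (B′ ∷ R)
ready-gain u m (last le eq d) =
  last (ℕ.≤-trans le (⊑-sum (move-lower m))) eq (descent-⊑ (move-lower m) (⊑-refl _) d)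
ready-gain u m (stop le eq d dd l s) =
  stop (ℕ.≤-trans le (⊑-sum (move-lower m))) eq (descent-⊑ (move-lower m) (⊑-refl _) d)
    (double-⊑ (move-lower m) (⊑-refl _) (⊑-refl _) dd) l s
ready-gain u m (step le eq d ¬dd r) =
  step (ℕ.≤-trans le (⊑-sum (move-lower m))) eq (descent-⊑ (move-lower m) (⊑-refl _) d)
    (λ dd → ¬dd (undercut-move u m dd)) r

-- Two ways to keep the overlap with the row above: `dominated` if the first row has more than `a`
-- letters, and `double` if that overlap is part of a double descent.
record Moved {n} (a : ℕ) (A B : Vec ℕ n) (R : Rows n) : Set where
  field
    {first}   : Vec ℕ n
    {second}  : Vec ℕ n
    {others}  : Rows n
    block     : Block (A ∷ B ∷ R) (first ∷ second ∷ others)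
    loses     : Vec.sum A ≡ suc (Vec.sum first)
    sizes     : All (λ X → Vec.sum X ≡ a) (second ∷ others)
    descents  : Linked Descent (first ∷ second ∷ others)
    dominated : suc a ≤ Vec.sum A → Dominated A first
    double    : ∀ {X} → DoubleDescent X A B → DoubleDescent X first second

surplus : ∀ {a} {A B : Vec ℕ n} k → suc (Vec.sum B) ≡ a → k + a ≤ Vec.sum A →
          suc k + Vec.sum B ≤ Vec.sum A + unmatched A B
surplus {A = A} {B} k refl le =
  ℕ.≤-trans (subst (_≤ Vec.sum A) (ℕ.+-suc k (Vec.sum B)) le) (ℕ.m≤m+n (Vec.sum A) (unmatched A B))

block-exists : ∀ {a} (A B : Vec ℕ n) R → Ready a (A ∷ B ∷ R) → Moved a A B R
block-exists {a = a} A B .[] (last le eq d)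
  with move-exists A B (surplus {A = A} 0 eq le)
... | A′ , B′ , m = record
  { block     = last m
  ; loses     = sum-upper m
  ; sizes     = trans (sum-lower m) eq ∷ []
  ; descents  = move-descent m d ∷ [-]
  ; dominated = λ lt → move-dominated m (surplus {A = A} 1 eq lt)
  ; double    = double-move-lower m
  }
block-exists {a = a} A B (C ∷ R) (stop le eq d dd (d′ ∷ l) s)
  with move-exists A B (surplus {A = A} 0 eq le)
... | A′ , B′ , m = record
  { block     = stop dd m
  ; loses     = sum-upper m
  ; sizes     = trans (sum-lower m) eq ∷ s
  ; descents  = move-descent m d ∷ descent-⊑ (move-lower m) (⊑-refl C) d′ ∷ l
  ; dominated = λ lt → move-dominated m (surplus {A = A} 1 eq lt)
  ; double    = double-move-lower m
  }
block-exists {a = a} A B (C ∷ R) (step le eq d ¬dd r) = combine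
  (move-exists A B (excess 1 (s≤s le)))
  where
  -- Here B has all its `a` letters, so lengths alone do not provide an unbracketed letter of A. The
  -- undercutting letter of B is unmatched and makes up for the one missing.
  u : Undercut A B
  u = undercut ¬dd (ready-descent r)
  excess : ∀ k → k + a ≤ suc (Vec.sum A) → k + Vec.sum B ≤ Vec.sum A + unmatched A B
  excess k h = subst (λ z → k + z ≤ _) (sym eq) (ℕ.≤-trans h
    (subst (_≤ Vec.sum A + unmatched A B) (ℕ.+-comm (Vec.sum A) 1)
      (ℕ.+-monoʳ-≤ (Vec.sum A) (undercut⇒unmatched u))))
  combine : (∃₂ λ A′ B′ → Move A B A′ B′) → Moved a A B (C ∷ R)
  combine (A′ , B′ , m) = record
    { block     = step ¬dd m (Moved.block ih)
    ; loses     = sum-upper m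
    ; sizes     = ℕ.suc-injective (trans (sym (Moved.loses ih)) (trans (sum-lower m) (cong suc eq))) ∷ Moved.sizes ih
    ; descents  = descent-dominated dom (move-descent m d) ∷ Moved.descents ih
    ; dominated = λ lt → move-dominated m (excess 2 (s≤s lt))
    ; double    = λ dd → double-dominated dom (double-move-lower m dd)
    }
    where
    ih : Moved a B′ C R
    ih = block-exists B′ C R (ready-gain u m r)
    -- Having received a letter, the row has `a + 1` of them, so it keeps its largest letter when it
    -- passes one on.
    dom : Dominated B′ (Moved.first ih)
    dom = Moved.dominated ih (ℕ.≤-reflexive (sym (trans (sum-lower m) (cong suc eq))))

data Initial {n} (a : ℕ) : Rows n → Set where
  last : a ≤ Vec.sum A → suc (Vec.sum B) ≡ a → Descent A B → Initial a (A ∷ B ∷ [])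
  step : ∀ {R : Rows n} → a ≤ Vec.sum A → Vec.sum B ≡ a → Descent A B →
         Initial a (B ∷ C ∷ R) → Initial a (A ∷ B ∷ C ∷ R)

prepare-exists : ∀ {a} {R : Rows n} → Initial a (A ∷ R) →
                 ∃₂ λ B S → Prepare (A ∷ R) (A ∷ B ∷ S) × Ready a (A ∷ B ∷ S)
prepare-exists (last le eq d) = _ , _ , base , last le eq d
prepare-exists {A = A} (step {B = B} le eq d r) with prepare-exists r
... | C , S , p , ready with doubleDescent? A B C
... | no ¬dd = _ , _ , keep p ¬dd , step le eq d ¬dd ready
-- Running the lower block now shortens its first row to `a ∸ 1`, the length that `stop` expects,
-- and `double` shows that the test would succeed again afterwards.
... | yes dd with block-exists B C S ready
... | record { block = b ; loses = loses ; sizes = s ∷ ss ; descents = l ; double = double } =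
  _ , _ , apply p b (double dd) ,
  stop le (trans (sym loses) eq) (double⇒descent (double dd)) (double dd) l (s ∷ ss)

Transfer : Rows n → Rows n → Set
Transfer R Z = ∃[ S ] Prepare R S × Block S Z

transfer-injective : ∀ {R S Z : Rows n} → Transfer R Z → Transfer S Z → R ≡ S
transfer-injective (_ , p , b) (_ , q , c) with block-injective b c
... | refl = prepare-injective p q

-- Invariants of sequences of moves

private variable
  R S T U : Rows n

infix 4 _⇝_
infixr 5 _⨾_

-- This forgets the order and the conditions of the moves. Content, the Yamanouchi property and the
-- growth of the last row need to be checked on a single move only.
data _⇝_ {n} : Rows n → Rows n → Set where
  done  : R ⇝ R
  front : Move A B A′ B′ → A ∷ B ∷ R ⇝ A′ ∷ B′ ∷ R
  skip  : R ⇝ S → A ∷ R ⇝ A ∷ S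
  _⨾_   : R ⇝ S → S ⇝ T → R ⇝ T

block-⇝ : Block R S → R ⇝ S
block-⇝ (last m)     = front m
block-⇝ (stop _ m)   = front m
block-⇝ (step _ m b) = front m ⨾ skip (block-⇝ b)

prepare-⇝ : Prepare R S → R ⇝ S
prepare-⇝ base          = done
prepare-⇝ (apply p b _) = skip (prepare-⇝ p ⨾ block-⇝ b)
prepare-⇝ (keep p _)    = skip (prepare-⇝ p)

⇝-++ : ∀ U → R ⇝ S → R ++ U ⇝ S ++ U
⇝-++ U done      = done
⇝-++ U (front m) = front m
⇝-++ U (skip r)  = skip (⇝-++ U r)
⇝-++ U (r ⨾ s)   = ⇝-++ U r ⨾ ⇝-++ U s

++-⇝ : ∀ P → R ⇝ S → P ++ R ⇝ P ++ S
++-⇝ []      r = r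
++-⇝ (_ ∷ P) r = skip (++-⇝ P r)

⇝-length : R ⇝ S → length R ≡ length S
⇝-length done      = refl
⇝-length (front _) = refl
⇝-length (skip r)  = cong suc (⇝-length r)
⇝-length (r ⨾ s)   = trans (⇝-length r) (⇝-length s)

content : Vec ℕ n → Rows n → Vec ℕ n
content ν []      = ν
content ν (x ∷ R) = content (ν ⊕ x) R

⇝-content : ∀ ν → R ⇝ S → content ν R ≡ content ν S
⇝-content ν done               = refl
⇝-content ν (front {R = R} m)  = cong (λ z → content z R) (move-⊕ ν m)
⇝-content ν (skip {A = A} r)   = ⇝-content (ν ⊕ A) r
⇝-content ν (r ⨾ s)            = trans (⇝-content ν r) (⇝-content ν s)

Yamanouchi : Vec ℕ n → Rows n → Set
Yamanouchi ν []      = ⊤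
Yamanouchi ν (x ∷ R) = HorizontalStrip ν x × Yamanouchi (ν ⊕ x) R

⇝-yamanouchi : ∀ ν → R ⇝ S → Yamanouchi ν R → Yamanouchi ν S
⇝-yamanouchi ν done              y           = y
⇝-yamanouchi ν (front {R = R} m) (h , g , y) with move-horizontal ν m h g
... | h′ , g′ = h′ , g′ , subst (λ z → Yamanouchi z R) (move-⊕ ν m) y
⇝-yamanouchi ν (skip {A = A} r)  (h , y)     = h , ⇝-yamanouchi (ν ⊕ A) r y
⇝-yamanouchi ν (r ⨾ s)           y           = ⇝-yamanouchi ν s (⇝-yamanouchi ν r y)

bottom : Rows n → Vec ℕ n
bottom []          = 𝟎
bottom (x ∷ [])    = x
bottom (_ ∷ y ∷ R) = bottom (y ∷ R)

⇝-bottom : R ⇝ S → bottom R ⊑ bottom S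
⇝-bottom done                   = ⊑-refl _
⇝-bottom (front {R = []} m)     = move-lower m
⇝-bottom (front {R = _ ∷ _} m)  = ⊑-refl _
⇝-bottom (skip {R = []} {[]} r)       = ⊑-refl _
⇝-bottom (skip {R = _ ∷ _} {_ ∷ _} r) = ⇝-bottom r
⇝-bottom (skip {R = []} {_ ∷ _} r)    with () ← ⇝-length r
⇝-bottom (skip {R = _ ∷ _} {[]} r)    with () ← ⇝-length r
⇝-bottom (r ⨾ s)                = ⊑-trans (⇝-bottom r) (⇝-bottom s)

-- Overlap `b` demands at least `b` brackets between the two rows. The columns have disappeared, so
-- rows that are not moved keep their mutual overlaps.
Overlaps : List ℕ → Rows n → Set
Overlaps []      (x ∷ [])    = ⊤
Overlaps (b ∷ β) (x ∷ y ∷ R) = unmatched x y + b ≤ Vec.sum y × Overlaps β (y ∷ R)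
Overlaps _       _           = ⊥

descent⇒overlap : Descent A B → unmatched A B + 1 ≤ Vec.sum B
descent⇒overlap {A = A} {B} d = subst (_≤ Vec.sum B) (ℕ.+-comm 1 (unmatched A B)) (descent⇒matched d)

overlap⇒descent : unmatched A B + 1 ≤ Vec.sum B → Descent A B
overlap⇒descent {A = A} {B} le = matched⇒descent (subst (_≤ Vec.sum B) (ℕ.+-comm (unmatched A B) 1) le)

overlaps-split : ∀ k {β} (R : Rows n) {U} → length R ≡ suc k → Overlaps (replicate k 1 ++ β) (R ++ U) →
                 Linked Descent R × Overlaps β (bottom R ∷ U)
overlaps-split zero    (x ∷ [])    _  o       = [-] , o
overlaps-split (suc k) (x ∷ y ∷ R) eq (d , o) with overlaps-split k (y ∷ R) (ℕ.suc-injective eq) o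
... | l , o′ = overlap⇒descent d ∷ l , o′

overlaps-join : ∀ k {β} (R : Rows n) {U} → length R ≡ suc k → Linked Descent R → Overlaps β (bottom R ∷ U) →
                Overlaps (replicate k 1 ++ β) (R ++ U)
overlaps-join zero    (x ∷ [])    _  _       o = o
overlaps-join (suc k) (x ∷ y ∷ R) eq (d ∷ l) o = descent⇒overlap d , overlaps-join k (y ∷ R) (ℕ.suc-injective eq) l o

data StartsWithOne : List ℕ → Set where
  []  : StartsWithOne []
  [-] : ∀ {β} → StartsWithOne (1 ∷ β)

data EndsWithOne : List ℕ → Set where
  []  : EndsWithOne []
  [1] : EndsWithOne (1 ∷ [])
  _∷_ : ∀ b {b′ β} → EndsWithOne (b′ ∷ β) → EndsWithOne (b ∷ b′ ∷ β)

overlaps-⊑ : ∀ {β} {U : Rows n} → StartsWithOne β → A ⊑ A′ → Overlaps β (A ∷ U) → Overlaps β (A′ ∷ U)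
overlaps-⊑ {U = []}     []  le o       = o
overlaps-⊑ {U = []}     [-] le ()
overlaps-⊑ {U = x ∷ []} []  le ()
overlaps-⊑ {U = x ∷ U} [-] le (d , o) =
  descent⇒overlap (descent-⊑ le (⊑-refl x) (overlap⇒descent d)) , o

-- Among the overlaps above, only the last involves a changed row. It equals 1, so that preserving
-- descents into that row is enough.
overlaps-prefix : ∀ {β̄ β} (P : Rows n) {R} → EndsWithOne β̄ → length P ≡ length β̄ →
                  Overlaps (β̄ ++ β) (P ++ A ∷ R) →
                  Overlaps β (A ∷ R) ×
                  (∀ {A′ R′} → (∀ {X} → Descent X A → Descent X A′) → Overlaps β (A′ ∷ R′) →
                   Overlaps (β̄ ++ β) (P ++ A′ ∷ R′))
overlaps-prefix []          []      _  o       = o , λ _ o′ → o′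
overlaps-prefix (p ∷ [])    [1]     _  (d , o) =
  o , λ {A′} f o′ → descent⇒overlap {A = p} {A′} (f {p} (overlap⇒descent {A = p} d)) , o′
overlaps-prefix (p ∷ q ∷ P) (b ∷ e) eq (d , o) with overlaps-prefix (q ∷ P) e (ℕ.suc-injective eq) o
... | o₁ , f = o₁ , λ g o′ → d , f g o′

Tableau : List ℕ → List ℕ → Rows n → Set
Tableau α β R = Yamanouchi 𝟎 R × map Vec.sum R ≡ α × Overlaps β R

map-split : ∀ {X Y : Set} (f : X → Y) ys {zs} xs → map f xs ≡ ys ++ zs →
            ∃₂ λ as bs → xs ≡ as ++ bs × map f as ≡ ys × map f bs ≡ zs
map-split f []       xs       eq = [] , xs , refl , refl , eq
map-split f (y ∷ ys) (x ∷ xs) eq with List.∷-injective eq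
... | eq₁ , eq₂ with map-split f ys xs eq₂
... | as , bs , refl , p , q = x ∷ as , bs , refl , cong₂ _∷_ eq₁ p , q

++-cancel : ∀ {X : Set} {zs zs′ : List X} xs xs′ → length xs ≡ length xs′ → xs ++ zs ≡ xs′ ++ zs′ → xs ≡ xs′ × zs ≡ zs′
++-cancel []       []         _   eq = refl , eq
++-cancel (x ∷ xs) (x′ ∷ xs′) len eq with List.∷-injective eq
... | refl , eq′ with ++-cancel xs xs′ (ℕ.suc-injective len) eq′
... | p , q = cong (x ∷_) p , q

length-sums : ∀ {α} (R : Rows n) → map Vec.sum R ≡ α → length R ≡ length α
length-sums R refl = sym (List.length-map Vec.sum R)

-- The last clause of `exists` secures the overlap with the row above. The overlap with the row
-- below needs no clause, since letters move downwards and the last row can only gain.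
record Exchange (k : ℕ) (α α′ : List ℕ) : Set₁ where
  field
    Related   : ∀ {n} → Rows n → Rows n → Set
    injective : ∀ {n} {R S Z : Rows n} → Related R Z → Related S Z → R ≡ S
    lengths   : length α ≡ suc k
    lengths′  : length α′ ≡ suc k
    exists    : ∀ {n} (A : Vec ℕ n) R → map Vec.sum (A ∷ R) ≡ α → Linked Descent (A ∷ R) →
                ∃₂ λ A′ R′ → Related (A ∷ R) (A′ ∷ R′) × A ∷ R ⇝ A′ ∷ R′ ×
                             map Vec.sum (A′ ∷ R′) ≡ α′ × Linked Descent (A′ ∷ R′) ×
                             (∀ {X} → Descent X A → Descent X A′)

module Embed {k α α′} (E : Exchange k α α′) (σ σ̄ τ τ̄ : List ℕ)
             (len-σ : length σ ≡ length σ̄) (end : EndsWithOne σ̄) (start : StartsWithOne τ̄) where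

  open Exchange E

  -- The two lengths make the cuts of `Z` unique, which reduces injectivity to that of `Related`.
  record Lift {n} (X Z : Rows n) : Set where
    constructor lifted
    field
      P M M′ V : Rows n
      X≡       : X ≡ P ++ M ++ V
      Z≡       : Z ≡ P ++ M′ ++ V
      len-P    : length P ≡ length σ
      len-M′   : length M′ ≡ suc k
      related  : Related M M′

  lift-injective : ∀ {n} {X Y Z : Rows n} → Lift X Z → Lift Y Z → X ≡ Y
  lift-injective (lifted P M M′ U refl refl lp lm r) (lifted P₁ M₁ M₁′ U₁ refl eq lp₁ lm₁ r₁)
    with ++-cancel P P₁ (trans lp (sym lp₁)) eq
  ... | refl , eq′ with ++-cancel M′ M₁′ (trans lm (sym lm₁)) eq′
  ... | refl , refl = cong (λ z → P ++ z ++ U) (injective r r₁)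

  β = σ̄ ++ replicate k 1 ++ τ̄

  lift-exists : ∀ {n} {X : Rows n} → Tableau (σ ++ α ++ τ) β X →
                ∃[ Z ] Tableau (σ ++ α′ ++ τ) β Z × Lift X Z × content 𝟎 X ≡ content 𝟎 Z
  lift-exists {n} {X} (yam , sums , overlaps) with map-split Vec.sum σ X sums
  ... | P , Q , refl , eqσ , eq with map-split Vec.sum α Q eq
  ... | [] , U , refl , eqα , eqτ with () ← trans (cong length eqα) lengths
  ... | A ∷ R , U , refl , eqα , eqτ
    with overlaps-prefix P end (trans (length-sums P eqσ) len-σ) overlaps
  ... | o , replaceP with overlaps-split k (A ∷ R) (trans (length-sums (A ∷ R) eqα) lengths) o
  ... | l , oU with exists A R eqα l
  ... | A′ , R′ , rel , moves , eqα′ , l′ , top =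
    P ++ A′ ∷ R′ ++ U ,
    (⇝-yamanouchi 𝟎 whole yam , sums′ , replaceP top (overlaps-join k (A′ ∷ R′) len′ l′
       (overlaps-⊑ start (⇝-bottom moves) oU))) ,
    lifted P (A ∷ R) (A′ ∷ R′) U refl refl (length-sums P eqσ) len′ rel ,
    ⇝-content 𝟎 whole
    where
    whole : P ++ (A ∷ R) ++ U ⇝ P ++ (A′ ∷ R′) ++ U
    whole = ++-⇝ P (⇝-++ U moves)
    len′ : length (A′ ∷ R′) ≡ suc k
    len′ = trans (length-sums (A′ ∷ R′) eqα′) lengths′
    sums′ : map Vec.sum (P ++ (A′ ∷ R′) ++ U) ≡ σ ++ α′ ++ τ
    sums′ = trans (List.map-++ Vec.sum P _) (cong₂ _++_ eqσ
      (trans (List.map-++ Vec.sum (A′ ∷ R′) U) (cong₂ _++_ eqα′ eqτ)))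

-- The two exchanges

twoRows : ∀ a b → b ≤ a → 2 ≤ b → Exchange 1 (a + 1 ∷ b ∸ 1 ∷ []) (a ∷ b ∷ [])
twoRows a (suc b) b≤a _ = record
  { Related   = Block
  ; injective = block-injective
  ; lengths   = refl
  ; lengths′  = refl
  ; exists    = exists
  }
  where
  exists : ∀ {n} (A : Vec ℕ n) R → map Vec.sum (A ∷ R) ≡ a + 1 ∷ b ∷ [] → Linked Descent (A ∷ R) →
           ∃₂ λ A′ R′ → Block (A ∷ R) (A′ ∷ R′) × A ∷ R ⇝ A′ ∷ R′ ×
                        map Vec.sum (A′ ∷ R′) ≡ a ∷ suc b ∷ [] × Linked Descent (A′ ∷ R′) ×
                        (∀ {X} → Descent X A → Descent X A′)
  exists A (B ∷ []) eq (d ∷ [-]) =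
    let A′ , B′ , m = move-exists A B (ℕ.≤-trans (ℕ.n≤1+n _) bound) in
    A′ , B′ ∷ [] , last m , front m ,
    cong₂ _∷_ (ℕ.suc-injective (trans (sym (sum-upper m)) (trans sumA (ℕ.+-comm a 1))))
      (cong (_∷ []) (trans (sum-lower m) (cong suc sumB))) ,
    move-descent m d ∷ [-] , descent-dominated (move-dominated m bound)
    where
    sumA : Vec.sum A ≡ a + 1
    sumA = proj₁ (List.∷-injective eq)
    sumB : Vec.sum B ≡ b
    sumB = proj₁ (List.∷-injective (proj₂ (List.∷-injective eq)))
    -- After the match `b` is the length of the shorter lower row. Since `suc b ≤ a`, the `a + 1`
    -- letters of A exceed those of B by at least two, so two of them are unbracketed.
    bound : 2 + Vec.sum B ≤ Vec.sum A + unmatched A B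
    bound = surplus {A = A} 1 refl
      (subst₂ (λ x y → suc (suc x) ≤ y) (sym sumB) (trans (ℕ.+-comm 1 a) (sym sumA)) (s≤s b≤a))

initial : ∀ {n} a k (A : Vec ℕ n) R → suc a ≤ Vec.sum A → Linked Descent (A ∷ R) →
          map Vec.sum R ≡ replicate k (suc a) ++ a ∷ [] → Initial (suc a) (A ∷ R)
initial a zero    A (B ∷ [])    le (d ∷ _) eq = last le (cong suc (proj₁ (List.∷-injective eq))) d
initial a (suc k) A (B ∷ [])    le (d ∷ _) eq with k
... | zero  with () ← proj₂ (List.∷-injective eq)
... | suc _ with () ← proj₂ (List.∷-injective eq)
initial a (suc k) A (B ∷ C ∷ R) le (d ∷ l) eq with List.∷-injective eq
... | sumB , eq′ = step le sumB d (initial a k B (C ∷ R) (ℕ.≤-reflexive (sym sumB)) l eq′)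

sums-constant : ∀ {n a} (R : Rows n) → All (λ X → Vec.sum X ≡ a) R → map Vec.sum R ≡ replicate (length R) a
sums-constant []      []       = refl
sums-constant (x ∷ R) (e ∷ es) = cong₂ _∷_ e (sums-constant R es)

equalRows : ∀ a k → 1 ≤ a →
            Exchange (suc k) (a + 1 ∷ replicate k a ++ a ∸ 1 ∷ []) (replicate (2 + k) a)
equalRows (suc a) k _ = record
  { Related   = Transfer
  ; injective = transfer-injective
  ; lengths   = cong suc (trans (List.length-++ (replicate k (suc a)))
                  (trans (cong (_+ 1) (List.length-replicate k)) (ℕ.+-comm k 1)))
  ; lengths′  = List.length-replicate (2 + k)
  ; exists    = exists
  }
  where
  exists : ∀ {n} (A : Vec ℕ n) R → map Vec.sum (A ∷ R) ≡ suc a + 1 ∷ replicate k (suc a) ++ a ∷ [] →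
           Linked Descent (A ∷ R) →
           ∃₂ λ A′ R′ → Transfer (A ∷ R) (A′ ∷ R′) × A ∷ R ⇝ A′ ∷ R′ ×
                        map Vec.sum (A′ ∷ R′) ≡ replicate (2 + k) (suc a) × Linked Descent (A′ ∷ R′) ×
                        (∀ {X} → Descent X A → Descent X A′)
  exists A R eq l with List.∷-injective eq
  ... | sumA , eq′ with prepare-exists (initial a k A R
                          (subst (suc a ≤_) (sym sumA) (ℕ.m≤m+n (suc a) 1)) l eq′)
  ... | B , S , p , ready with block-exists A B S ready
  ... | record { first = A′ ; second = B′ ; others = R′ ; block = b ; loses = loses ; sizes = sizes
               ; descents = descents ; dominated = dominated } =
    A′ , B′ ∷ R′ , (_ , p , b) , moves ,
    cong₂ _∷_ (ℕ.suc-injective (trans (sym loses) (trans sumA (ℕ.+-comm (suc a) 1))))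
      (trans (sums-constant (B′ ∷ R′) sizes) (cong (λ z → replicate z (suc a)) len)) ,
    -- The top row starts with one letter more than the common length, so its largest letter
    -- survives.
    descents , descent-dominated (dominated (ℕ.≤-reflexive (trans (ℕ.+-comm 1 (suc a)) (sym sumA))))
    where
    moves = prepare-⇝ p ⨾ block-⇝ b
    len : suc (length R′) ≡ suc k
    len = ℕ.suc-injective (trans (sym (⇝-length moves)) (trans (length-sums (A ∷ R) eq)
      (cong suc (trans (List.length-++ (replicate k (suc a)))
        (trans (cong (_+ 1) (List.length-replicate k)) (ℕ.+-comm k 1))))))

-- Expansion into Schur functions

vectors : ∀ {A : Set} → List A → ∀ n → List (Vec A n)
vectors xs zero    = [] ∷ []
vectors xs (suc n) = cartesianProductWith Vec._∷_ xs (vectors xs n)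

vectors-enumerate : ∀ {A : Set} {P : A → Set} {xs} → Enumerates P xs → ∀ n →
                    Enumerates (VecAll.All P {n}) (vectors xs n)
vectors-enumerate E zero = record
  { unique = [] ∷ [] ; sound = λ { (here refl) → [] } ; complete = λ { [] → here refl } }
vectors-enumerate {P = P} {xs} E (suc n) = record
  { unique   = Unique.cartesianProductWith⁺ Vec._∷_ Vec.∷-injective (unique E) (unique E′)
  ; sound    = λ p → let _ , _ , q , r , eq = ∈-cartesianProductWith⁻ Vec._∷_ xs (vectors xs n) p in
                     subst (VecAll.All P) (sym eq) (sound E q ∷ sound E′ r)
  ; complete = λ { (p ∷ ps) → ∈-cartesianProductWith⁺ Vec._∷_ (complete E p) (complete E′ ps) }
  }
  where
  open Enumerates
  E′ = vectors-enumerate E n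

upTo-enumerates : ∀ n → Enumerates (_< n) (upTo n)
upTo-enumerates n = record { unique = Unique.upTo⁺ n ; sound = ∈-upTo⁻ ; complete = ∈-upTo⁺ }

strip? : ∀ {n} p (ν x : Vec ℕ n) → Dec (Strip p ν x)
strip? p []      []       = yes tt
strip? p (c ∷ ν) (x ∷ xs) = c + x ℕ.≤? p ×-dec strip? c ν xs

horizontal? : ∀ {n} (ν x : Vec ℕ n) → Dec (HorizontalStrip ν x)
horizontal? []      []       = yes tt
horizontal? (c ∷ ν) (_ ∷ xs) = strip? c ν xs

LR? : ∀ {L N} ν (μ λs : Vec ℕ L) (Xs : Vec (Vec ℕ N) L) → Dec (LR ν μ λs Xs)
LR? ν []      []       []       = yes tt
LR? ν (m ∷ μ) (l ∷ ls) (x ∷ xs) =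
  horizontal? ν x ×-dec m + Vec.sum x ℕ.≟ l ×-dec below? μ xs ×-dec LR? (ν ⊕ x) μ ls xs
  where
  below? : ∀ {L} μ (xs : Vec _ L) → Dec (Below m μ x xs)
  below? []       []       = yes tt
  below? (m′ ∷ _) (x′ ∷ _) = unmatched x x′ + m′ ℕ.≤? m

entries-< : ∀ {n} (x : Vec ℕ n) {b} → Vec.sum x < b → VecAll.All (_< b) x
entries-< []      _  = []
entries-< (a ∷ x) lt = ℕ.≤-<-trans (ℕ.m≤m+n a _) lt ∷ entries-< x (ℕ.≤-<-trans (ℕ.m≤n+m _ a) lt)

LR-bounded : ∀ {L N b} ν (μ λs : Vec ℕ L) (Xs : Vec (Vec ℕ N) L) → Vec.sum λs < b → LR ν μ λs Xs →
             VecAll.All (VecAll.All (_< b)) Xs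
LR-bounded ν []      []       []       _  _ = []
LR-bounded ν (m ∷ μ) (l ∷ ls) (x ∷ xs) lt (_ , eq , _ , lr) =
  entries-< x (ℕ.≤-<-trans (ℕ.≤-trans (ℕ.m≤n+m _ m) (ℕ.≤-reflexive eq)) (ℕ.≤-<-trans (ℕ.m≤m+n l _) lt)) ∷
  LR-bounded (ν ⊕ x) μ ls xs (ℕ.≤-<-trans (ℕ.m≤n+m _ l) lt) lr

fillingsLR : ∀ N {L} (μ λs : Vec ℕ L) → List (Vec (Vec ℕ N) L)
fillingsLR N {L} μ λs = filter (LR? 𝟎 μ λs) (vectors (vectors (upTo (suc (Vec.sum λs))) N) L)

fillingsLR-enumerate : ∀ N {L} (μ λs : Vec ℕ L) → Enumerates (LR 𝟎 μ λs) (fillingsLR N μ λs)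
fillingsLR-enumerate N {L} μ λs = enumerates-⇔ proj₂ (λ lr → LR-bounded 𝟎 μ λs _ ℕ.≤-refl lr , lr)
  (filter-enumerates (LR? 𝟎 μ λs) (vectors-enumerate (vectors-enumerate (upTo-enumerates _) N) L))

horizontal-step : ∀ {n} (ν x : Vec ℕ n) → HorizontalStrip ν x → HorizontalStrip (ν ⊕ x) 𝟎
horizontal-step []      []       _ = tt
horizontal-step (c ∷ ν) (a ∷ x) h = go c a ν x h
  where
  go : ∀ {n} c a (ν x : Vec ℕ n) → Strip c ν x → Strip (c + a) (ν ⊕ x) 𝟎
  go c a []      []      _        = tt
  go c a (v ∷ ν) (y ∷ x) (h , hs) =
    ℕ.≤-trans (ℕ.≤-reflexive (ℕ.+-identityʳ _)) (ℕ.≤-trans h (ℕ.m≤m+n c a)) , go v y ν x hs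

shape-partition : ∀ {L N} ν (μ λs : Vec ℕ L) (Xs : Vec (Vec ℕ N) L) → HorizontalStrip ν 𝟎 → LR ν μ λs Xs →
                  HorizontalStrip (shape ν Xs) 𝟎
shape-partition ν []      []       []       h _               = h
shape-partition ν (m ∷ μ) (l ∷ ls) (x ∷ xs) _ (g , _ , _ , r) =
  shape-partition (ν ⊕ x) μ ls xs (horizontal-step ν x g) r

nonzero : ∀ {n} → Vec ℕ n → List ℕ
nonzero []          = []
nonzero (zero ∷ _)  = []
nonzero (suc c ∷ ν) = suc c ∷ nonzero ν

nonzero-positive : ∀ {n} (ν : Vec ℕ n) → All (1 ≤_) (nonzero ν)
nonzero-positive []          = []
nonzero-positive (zero ∷ _)  = []
nonzero-positive (suc c ∷ ν) = s≤s z≤n ∷ nonzero-positive ν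

nonzero-decreasing : ∀ {n} (ν : Vec ℕ n) → HorizontalStrip ν 𝟎 → Linked _≥_ (nonzero ν)
nonzero-decreasing []                   _       = []
nonzero-decreasing (zero ∷ _)           _       = []
nonzero-decreasing (suc c ∷ [])         _       = [-]
nonzero-decreasing (suc c ∷ zero ∷ ν)   _       = [-]
nonzero-decreasing (suc c ∷ suc d ∷ ν)  (h , g) =
  subst (_≤ suc c) (ℕ.+-identityʳ (suc d)) h ∷ nonzero-decreasing (suc d ∷ ν) g

-- Junk value: the empty partition, if ν does not decrease.
partition : ∀ {n} → Vec ℕ n → Partition
partition ν with horizontal? ν 𝟎
... | yes h = record { parts = nonzero ν ; positive = nonzero-positive ν ; decreasing = nonzero-decreasing ν h }
... | no  _ = record { parts = [] ; positive = [] ; decreasing = [] }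

straight : ∀ {n} → Vec ℕ n → SkewDiagram
straight ν = map (row 0) (nonzero ν)

schur-partition : ∀ {n} (ν : Vec ℕ n) w → HorizontalStrip ν 𝟎 →
                  schur (partition ν) w ≡ pos (length (tableaux w (straight ν)))
schur-partition ν w h with horizontal? ν 𝟎
... | yes _ = refl
... | no ¬h = contradiction h ¬h

straight-length : ∀ {n} (ν : Vec ℕ n) → length (straight ν) ≤ n
straight-length []          = z≤n
straight-length (zero ∷ ν)  = z≤n
straight-length (suc c ∷ ν) = s≤s (straight-length ν)

straight-inners : ∀ {n} (ν : Vec ℕ n) → inners (straight ν) ≡ 𝟎
straight-inners []          = refl
straight-inners (zero ∷ ν)  = refl
straight-inners (suc c ∷ ν) = cong (0 ∷_) (straight-inners ν)

straight-pad : ∀ {n} (ν : Vec ℕ n) → HorizontalStrip ν 𝟎 → pad (straight-length ν) (outers (straight ν)) ≡ ν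
straight-pad []          _ = refl
straight-pad (zero ∷ ν)  h = cong (0 ∷_) (sym (zeros ν h))
  where
  zeros : ∀ {n} (ν : Vec ℕ n) → Strip 0 ν 𝟎 → ν ≡ 𝟎
  zeros []      _       = refl
  zeros (c ∷ ν) (h , g) with ℕ.m+n≡0⇒m≡0 c (ℕ.n≤0⇒n≡0 h)
  ... | refl = cong (0 ∷_) (zeros ν g)
straight-pad (suc c ∷ ν) h = cong (suc c ∷_) (straight-pad ν (strip⇒horizontal ν 𝟎 h))

straight-skew : ∀ {n} (ν : Vec ℕ n) → HorizontalStrip ν 𝟎 → Skew (straight ν)
straight-skew []                  _       = []
straight-skew (zero ∷ ν)          _       = []
straight-skew (suc c ∷ [])        _       = [ z≤n ]
straight-skew (suc c ∷ zero ∷ ν)  _       = [ z≤n ]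
straight-skew (suc c ∷ suc d ∷ ν) (h , g) =
  (z≤n , record { inner≤ = z≤n ; outer≤ = subst (_≤ suc c) (ℕ.+-identityʳ (suc d)) h }) ∷
  straight-skew (suc d ∷ ν) g

skew-outers : ∀ D → Skew D → HorizontalStrip (outers D) 𝟎
skew-outers []           []            = tt
skew-outers (r ∷ [])     _             = tt
skew-outers (r ∷ r′ ∷ D) ((_ , n) ∷ s) =
  ℕ.≤-trans (ℕ.≤-reflexive (ℕ.+-identityʳ _)) (Nested.outer≤ n) , skew-outers (r′ ∷ D) s

-- The paths belonging to a filling are listed by growing the tableaux of the straight shape given
-- by its content, so each filling contributes one Schur function.
skew-expansion : ∀ {N} D → length D ≤ N → Skew D → ∀ w →
  length (tableaux w D) ≡
  sum (map (length ∘ tableaux w ∘ straight) (map (shape 𝟎) (fillingsLR N (inners D) (outers D))))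
skew-expansion {N} D le sk w = begin
  length (tableaux w D)                        ≡⟨ List.length-map (contents D) (tableaux w D) ⟨
  length (map (contents D) (tableaux w D))     ≡⟨ LR-rule le w (inners D) (outers D) paths (skew-outers D sk)
                                                    (contents-enumerate w D sk)
                                                    (fillingsLR-enumerate N (inners D) (outers D)) paths-enumerate ⟩
  sum (map (length ∘ paths) Ys)                ≡⟨ cong sum (List.map-cong length-paths Ys) ⟩
  sum (map (length ∘ tableaux w ∘ straight ∘ shape 𝟎) Ys) ≡⟨ cong sum (List.map-∘ Ys) ⟩
  sum (map (length ∘ tableaux w ∘ straight) (map (shape 𝟎) Ys)) ∎
  where
  open ≡-Reasoning
  open Growth N
  Ys = fillingsLR N (inners D) (outers D)
  paths : Vec (Vec ℕ N) (length D) → List (Vec (Vec ℕ N) (length w))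
  paths Xs = map growPath (map (contents (straight (shape 𝟎 Xs))) (tableaux w (straight (shape 𝟎 Xs))))
  length-paths : ∀ Xs → length (paths Xs) ≡ length (tableaux w (straight (shape 𝟎 Xs)))
  length-paths Xs = trans (List.length-map growPath (map (contents D′) (tableaux w D′)))
                          (List.length-map (contents D′) (tableaux w D′))
    where D′ = straight (shape 𝟎 Xs)
  paths-enumerate : ∀ {Xs} → LR 𝟎 (inners D) (outers D) Xs → Enumerates (Path w (shape 𝟎 Xs)) (paths Xs)
  paths-enumerate {Xs} lr = subst (λ z → Enumerates (Path w z) (paths Xs)) (straight-pad ν h)
    (straight-paths (straight-length ν) w (outers (straight ν)) (skew-outers _ sk′)
      (subst (λ z → Enumerates (Sst w z (outers (straight ν))) (map (contents (straight ν)) (tableaux w (straight ν))))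
        (straight-inners ν) (contents-enumerate w (straight ν) sk′)))
    where
    ν = shape 𝟎 Xs
    h : HorizontalStrip ν 𝟎
    h = shape-partition 𝟎 (inners D) (outers D) Xs (horizontal-𝟎 {N}) lr
    sk′ = straight-skew ν h

-- Overlap notation

data Valid : List ℕ → List ℕ → Set where
  [_] : ∀ a → Valid (a ∷ []) []
  _∷_ : ∀ {a a′ α b β} → b ≤ a × b ≤ a′ → Valid (a′ ∷ α) β → Valid (a ∷ a′ ∷ α) (b ∷ β)

overlap-length : ∀ {α β} → Valid α β → length (overlapDiagram α β) ≡ suc (length β)
overlap-length [ a ]   = refl
overlap-length (_ ∷ v) = cong suc (overlap-length v)

overlap-skew : ∀ {α β} → Valid α β → Skew (overlapDiagram α β)
overlap-skew [ a ] = [ z≤n ]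
overlap-skew {a ∷ a′ ∷ α} {b ∷ β} ((b≤a , b≤a′) ∷ v) = add v (overlap-skew v)
  where
  nested : ∀ m → Nested (row (m + a′ ∸ b) ((m + a′ ∸ b) + a)) (row m (m + a′))
  nested m = record
    { inner≤ = ℕ.m+n≤o⇒m≤o∸n m (ℕ.+-monoʳ-≤ m b≤a′)
    ; outer≤ = ℕ.≤-trans (ℕ.≤-reflexive (sym (ℕ.m∸n+n≡m (ℕ.≤-trans b≤a′ (ℕ.m≤n+m a′ m))))) (ℕ.+-monoʳ-≤ (m + a′ ∸ b) b≤a)
    }
  add : ∀ {α β} → Valid (a′ ∷ α) β → Skew (overlapDiagram (a′ ∷ α) β) → Skew (overlapDiagram (a ∷ a′ ∷ α) (b ∷ β))
  -- Distinguishing the two forms of `Valid` lets `topOuter` compute; the row below starts in column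
  -- 0 or at its own inner end.
  add [ _ ]   s = (ℕ.m≤m+n _ a , nested 0) ∷ s
  add (_ ∷ _) s = (ℕ.m≤m+n _ a , nested _) ∷ s

overlap⇒below : ∀ u m {a b} → b ≤ a → u + b ≤ a → u + m ≤ m + a ∸ b
overlap⇒below u m {a} {b} b≤a le = ℕ.m+n≤o⇒m≤o∸n (u + m) (begin
  u + m + b     ≡⟨ ℕ.+-assoc u m b ⟩
  u + (m + b)   ≡⟨ cong (u +_) (ℕ.+-comm m b) ⟩
  u + (b + m)   ≡⟨ ℕ.+-assoc u b m ⟨
  u + b + m     ≤⟨ ℕ.+-monoˡ-≤ m le ⟩
  a + m         ≡⟨ ℕ.+-comm a m ⟩
  m + a         ∎)
  where open ℕ.≤-Reasoning

below⇒overlap : ∀ u m {a b} → b ≤ a → u + m ≤ m + a ∸ b → u + b ≤ a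
below⇒overlap u m {a} {b} b≤a le = ℕ.+-cancelʳ-≤ m _ _ (begin
  u + b + m         ≡⟨ ℕ.+-assoc u b m ⟩
  u + (b + m)       ≡⟨ cong (u +_) (ℕ.+-comm b m) ⟩
  u + (m + b)       ≡⟨ ℕ.+-assoc u m b ⟨
  u + m + b         ≤⟨ ℕ.+-monoˡ-≤ b le ⟩
  m + a ∸ b + b     ≡⟨ ℕ.m∸n+n≡m (ℕ.≤-trans b≤a (ℕ.m≤n+m a m)) ⟩
  m + a             ≡⟨ ℕ.+-comm m a ⟩
  a + m             ∎)
  where open ℕ.≤-Reasoning

module _ {N : ℕ} where

  LR⇒tableau : ∀ {α β} → Valid α β → ∀ ν (Xs : Vec (Vec ℕ N) _) →
    LR ν (inners (overlapDiagram α β)) (outers (overlapDiagram α β)) Xs →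
    Yamanouchi ν (toList Xs) × map Vec.sum (toList Xs) ≡ α × Overlaps β (toList Xs)
  LR⇒tableau [ a ] ν (x ∷ []) (h , size , _) = (h , tt) , cong (_∷ []) size , tt
  LR⇒tableau ((b≤a , b≤a′) ∷ v) ν (x ∷ Xs) (h , size , d , rest) with LR⇒tableau v (ν ⊕ x) Xs rest
  LR⇒tableau ((b≤a , b≤a′) ∷ [ _ ])   ν (x ∷ x′ ∷ Xs) (h , size , d , rest) | y , eq , o =
    (h , y) , cong₂ _∷_ (ℕ.+-cancelˡ-≡ _ _ _ size) eq ,
    subst (_ ≤_) (sym (proj₁ (List.∷-injective eq))) (below⇒overlap (unmatched x x′) 0 b≤a′ d) , o
  LR⇒tableau ((b≤a , b≤a′) ∷ (_ ∷ _)) ν (x ∷ x′ ∷ Xs) (h , size , d , rest) | y , eq , o =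
    (h , y) , cong₂ _∷_ (ℕ.+-cancelˡ-≡ _ _ _ size) eq ,
    subst (_ ≤_) (sym (proj₁ (List.∷-injective eq))) (below⇒overlap (unmatched x x′) _ b≤a′ d) , o

  tableau⇒LR : ∀ {α β} → Valid α β → ∀ ν (R : Rows N) → Yamanouchi ν R → map Vec.sum R ≡ α → Overlaps β R →
    ∃[ Xs ] LR ν (inners (overlapDiagram α β)) (outers (overlapDiagram α β)) Xs × toList Xs ≡ R
  tableau⇒LR [ a ] ν (x ∷ []) (h , _) eq _ =
    x ∷ [] , (h , proj₁ (List.∷-injective eq) , tt , tt) , refl
  tableau⇒LR ((b≤a , b≤a′) ∷ v) ν (x ∷ y ∷ R) (h , yam) eq (d , o)
    with tableau⇒LR v (ν ⊕ x) (y ∷ R) yam (proj₂ (List.∷-injective eq)) o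
  tableau⇒LR ((b≤a , b≤a′) ∷ [ _ ])   ν (x ∷ y ∷ R) (h , yam) eq (d , o) | y ∷ Xs , lr , refl =
    x ∷ y ∷ Xs ,
    (h , cong (_ +_) (List.∷-injectiveˡ eq) ,
     overlap⇒below (unmatched x y) 0 b≤a′ (subst (_ ≤_) (List.∷-injectiveˡ (List.∷-injectiveʳ eq)) d) , lr) , refl
  tableau⇒LR ((b≤a , b≤a′) ∷ (_ ∷ _)) ν (x ∷ y ∷ R) (h , yam) eq (d , o) | y ∷ Xs , lr , refl =
    x ∷ y ∷ Xs ,
    (h , cong (_ +_) (List.∷-injectiveˡ eq) ,
     overlap⇒below (unmatched x y) _ b≤a′ (subst (_ ≤_) (List.∷-injectiveˡ (List.∷-injectiveʳ eq)) d) , lr) , refl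

content-toList : ∀ {L N} ν (Xs : Vec (Vec ℕ N) L) → content ν (toList Xs) ≡ shape ν Xs
content-toList ν []       = refl
content-toList ν (x ∷ Xs) = content-toList (ν ⊕ x) Xs

-- The alphabet has as many letters as there are rows, a number read off from `β`. Both diagrams of
-- a difference share it, so their contents are vectors of the same length.
tableauxLR : ∀ (α β : List ℕ) → List (Rows (suc (length β)))
tableauxLR α β = map toList (fillingsLR _ (inners (overlapDiagram α β)) (outers (overlapDiagram α β)))

tableauxLR-enumerate : ∀ {α β} → Valid α β → Enumerates (Tableau α β) (tableauxLR α β)
tableauxLR-enumerate {α} {β} v = image-enumerates toList
  (λ {Xs} lr → LR⇒tableau v 𝟎 Xs lr)
  (λ {Xs} {Ys} _ _ eq → trans (sym (Vec.cast-is-id refl Xs)) (Vec.toList-injective refl Xs Ys eq))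
  (λ {R} (y , s , o) → tableau⇒LR v 𝟎 R y s o)
  (fillingsLR-enumerate _ (inners D) (outers D))
  where D = overlapDiagram α β

overlap-expansion : ∀ {α β} → Valid α β → ∀ w →
  length (tableaux w (overlapDiagram α β)) ≡
  sum (map (length ∘ tableaux w ∘ straight) (map (content 𝟎) (tableauxLR α β)))
overlap-expansion {α} {β} v w = trans
  (skew-expansion (overlapDiagram α β) (ℕ.≤-reflexive (overlap-length v)) (overlap-skew v) w)
  (cong (sum ∘ map (length ∘ tableaux w ∘ straight))
    (trans (List.map-cong (λ Xs → sym (content-toList 𝟎 Xs)) Ys) (List.map-∘ Ys)))
  where Ys = fillingsLR _ (inners (overlapDiagram α β)) (outers (overlapDiagram α β))

content-partition : ∀ {N} ν (R : Rows N) → HorizontalStrip ν 𝟎 → Yamanouchi ν R → HorizontalStrip (content ν R) 𝟎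
content-partition ν []      h _       = h
content-partition ν (x ∷ R) _ (h , y) = content-partition (ν ⊕ x) R (horizontal-step ν x h) y

schurs : ∀ {N} → List (Vec ℕ N) → List (ℕ × Partition)
schurs = map λ ν → 1 , partition ν

schurs-combination : ∀ {N} (νs : List (Vec ℕ N)) w → All (λ ν → HorizontalStrip ν 𝟎) νs →
  linearCombination (schurs νs) w ≡ pos (sum (map (length ∘ tableaux w ∘ straight) νs))
schurs-combination []       w []       = refl
schurs-combination (ν ∷ νs) w (h ∷ hs) = cong₂ ℤ._+_
  (trans (ℤ.*-identityˡ _) (schur-partition ν w h)) (schurs-combination νs w hs)

-- The contents left over by the embedding are the Schur functions of the difference, each listed
-- with coefficient 1 and repeated according to multiplicity.
exchange-positive : ∀ {k α α′} → Exchange k α α′ → ∀ σ σ̄ τ τ̄ → length σ ≡ length σ̄ →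
  EndsWithOne σ̄ → StartsWithOne τ̄ →
  Valid (σ ++ α ++ τ) (σ̄ ++ replicate k 1 ++ τ̄) → Valid (σ ++ α′ ++ τ) (σ̄ ++ replicate k 1 ++ τ̄) →
  SchurPositive (⟦ σ ++ α′ ++ τ ∣ σ̄ ++ replicate k 1 ++ τ̄ ⟧ ⊖ ⟦ σ ++ α ++ τ ∣ σ̄ ++ replicate k 1 ++ τ̄ ⟧)
exchange-positive {k} {α} {α′} E σ σ̄ τ τ̄ len end start v v′
  with embedding (Embed.Lift E σ σ̄ τ τ̄ len end start) (content 𝟎) (content 𝟎)
         (Embed.lift-injective E σ σ̄ τ τ̄ len end start)
         (Enumerates.unique (tableauxLR-enumerate v))
         (λ p → let Z , t , l , eq = Embed.lift-exists E σ σ̄ τ τ̄ len end start (Enumerates.sound (tableauxLR-enumerate v) p)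
                in Z , Enumerates.complete (tableauxLR-enumerate v′) t , l , eq)
... | νs , p = schurs νs , coefficients
  where
  β = σ̄ ++ replicate k 1 ++ τ̄
  Xs = tableauxLR (σ ++ α ++ τ) β
  Zs = tableauxLR (σ ++ α′ ++ τ) β

  partitions : All (λ ν → HorizontalStrip ν 𝟎) νs
  partitions = All.++⁻ʳ (map (content 𝟎) Xs) (Perm.All-resp-↭ p (All.map⁺ (All.tabulate λ {Z} q →
    content-partition 𝟎 Z (horizontal-𝟎 {suc (length β)}) (proj₁ (Enumerates.sound (tableauxLR-enumerate v′) q)))))

  coefficients : ∀ w → (⟦ σ ++ α′ ++ τ ∣ β ⟧ ⊖ ⟦ σ ++ α ++ τ ∣ β ⟧) w ≡ linearCombination (schurs νs) w
  coefficients w = begin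
    pos (length (tableaux w (overlapDiagram (σ ++ α′ ++ τ) β))) ℤ.- pos (length (tableaux w (overlapDiagram (σ ++ α ++ τ) β)))
      ≡⟨ cong₂ (λ x y → pos x ℤ.- pos y) (overlap-expansion v′ w) (overlap-expansion v w) ⟩
    pos (sum (map g (map (content 𝟎) Zs))) ℤ.- pos x
      ≡⟨ cong (λ z → pos z ℤ.- pos x) (ListAction.sum-↭ (Perm.map⁺ g p)) ⟩
    pos (sum (map g (map (content 𝟎) Xs ++ νs))) ℤ.- pos x
      ≡⟨ cong (λ z → pos (sum z) ℤ.- pos x) (List.map-++ g (map (content 𝟎) Xs) νs) ⟩
    pos (sum (map g (map (content 𝟎) Xs) ++ map g νs)) ℤ.- pos x
      ≡⟨ cong (λ z → pos z ℤ.- pos x) (ListAction.sum-++ (map g (map (content 𝟎) Xs)) (map g νs)) ⟩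
    pos (x + sum (map g νs)) ℤ.- pos x
      ≡⟨ cong (λ z → pos z ℤ.- pos x) (ℕ.+-comm x _) ⟩
    pos (sum (map g νs) + x) ℤ.- pos x
      ≡⟨ ℤ.+-assoc (pos (sum (map g νs))) (pos x) (ℤ.- pos x) ⟩
    pos (sum (map g νs)) ℤ.+ (pos x ℤ.- pos x)
      ≡⟨ cong (λ z → pos (sum (map g νs)) ℤ.+ z) (ℤ.+-inverseʳ (pos x)) ⟩
    pos (sum (map g νs)) ℤ.+ ℤ.0ℤ
      ≡⟨ ℤ.+-identityʳ _ ⟩
    pos (sum (map g νs))
      ≡⟨ schurs-combination νs w partitions ⟨
    linearCombination (schurs νs) w ∎
    where
    open ≡-Reasoning
    g = length ∘ tableaux w ∘ straight
    x = sum (map g (map (content 𝟎) Xs))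

-- From the Standing Hypothesis to admissible overlaps

-- Each entry of `τ̄` is an overlap with the preceding row; putting the last middle row `x` in front
-- of `τ` and using `inject₁` expresses this uniformly.
valid-right : ∀ {t} x (τ τ̄ : Vec ℕ t) → (∀ i → lookup τ̄ i ≤ lookup (x ∷ τ) (inject₁ i)) →
              (∀ i → lookup τ̄ i ≤ lookup τ i) → Valid (x ∷ toList τ) (toList τ̄)
valid-right x []      []      _ _ = [ x ]
valid-right x (y ∷ τ) (b ∷ τ̄) h g = (h zero , g zero) ∷ valid-right y τ τ̄ (h ∘ suc) (g ∘ suc)

valid-ones : ∀ k {α τ τ̄} → length α ≡ suc k → All (1 ≤_) α → (∀ {x} → 1 ≤ x → Valid (x ∷ τ) τ̄) →
             Valid (α ++ τ) (replicate k 1 ++ τ̄)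
valid-ones zero    {_ ∷ []}    _  (p ∷ [])     v = v p
valid-ones (suc k) {_ ∷ _ ∷ _} eq (p ∷ q ∷ ps) v = (p , q) ∷ valid-ones k (ℕ.suc-injective eq) (q ∷ ps) v

valid-left : ∀ {s} (σ σ̄ : Vec ℕ s) {y α β} → 1 ≤ y →
  (∀ i → 1 ≤ lookup σ i) → (∀ i → suc (toℕ i) ≡ s → lookup σ̄ i ≡ 1) →
  (∀ i j → toℕ j ≡ suc (toℕ i) → lookup σ̄ i ≤ lookup σ i ⊓ lookup σ j) →
  Valid (y ∷ α) β → Valid (toList σ ++ y ∷ α) (toList σ̄ ++ β)
valid-left []           []           _ _   _    _     v = v
valid-left (s ∷ [])     (b ∷ [])     p 1≤σ end _     v with end zero refl
... | refl = (1≤σ zero , p) ∷ v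
valid-left (s ∷ s′ ∷ σ) (b ∷ b′ ∷ σ̄) p 1≤σ end bound v =
  (ℕ.≤-trans b≤ (ℕ.m⊓n≤m s s′) , ℕ.≤-trans b≤ (ℕ.m⊓n≤n s s′)) ∷
  valid-left (s′ ∷ σ) (b′ ∷ σ̄) p (1≤σ ∘ suc) (λ i e → end (suc i) (cong suc e))
    (λ i j e → bound (suc i) (suc j) (cong suc e)) v
  where b≤ = bound zero (suc zero) refl

ends-with-one : ∀ {s} (σ̄ : Vec ℕ s) → (∀ i → suc (toℕ i) ≡ s → lookup σ̄ i ≡ 1) → EndsWithOne (toList σ̄)
ends-with-one []           _    = []
ends-with-one (b ∷ [])     end with end zero refl
... | refl = [1]
ends-with-one (b ∷ b′ ∷ σ̄) end = b ∷ ends-with-one (b′ ∷ σ̄) λ i e → end (suc i) (cong suc e)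

starts-with-one : ∀ {t} (τ̄ : Vec ℕ t) → (∀ i → toℕ i ≡ 0 → lookup τ̄ i ≡ 1) → StartsWithOne (toList τ̄)
starts-with-one []      _     = []
starts-with-one (b ∷ τ̄) first with first zero refl
... | refl = [-]

module _ {s t : ℕ} (σ σ̄ : Vec ℕ s) (τ τ̄ : Vec ℕ t) (hyp : StandingHypothesis σ σ̄ τ τ̄) where

  open StandingHypothesis hyp

  standing-right : ∀ {x} → 1 ≤ x → Valid (x ∷ toList τ) (toList τ̄)
  standing-right {x} p = valid-right x τ τ̄ (above τ τ̄ τ-positive τ̄-first τ̄-bound) (beside τ τ̄ τ-positive τ̄-first τ̄-bound)
    where
    above : ∀ {t} (τ τ̄ : Vec ℕ t) → (∀ i → 1 ≤ lookup τ i) → (∀ i → toℕ i ≡ 0 → lookup τ̄ i ≡ 1) →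
            (∀ i j → toℕ i ≡ suc (toℕ j) → lookup τ̄ i ≤ lookup τ i ⊓ lookup τ j) →
            ∀ i → lookup τ̄ i ≤ lookup (x ∷ τ) (inject₁ i)
    above τ τ̄ 1≤τ first bound zero    = subst (_≤ x) (sym (first zero refl)) p
    above τ τ̄ 1≤τ first bound (suc i) =
      ℕ.≤-trans (bound (suc i) (inject₁ i) (cong suc (sym (Fin.toℕ-inject₁ i)))) (ℕ.m⊓n≤n _ _)

    beside : ∀ {t} (τ τ̄ : Vec ℕ t) → (∀ i → 1 ≤ lookup τ i) → (∀ i → toℕ i ≡ 0 → lookup τ̄ i ≡ 1) →
             (∀ i j → toℕ i ≡ suc (toℕ j) → lookup τ̄ i ≤ lookup τ i ⊓ lookup τ j) →
             ∀ i → lookup τ̄ i ≤ lookup τ i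
    beside τ τ̄ 1≤τ first bound zero    = subst (_≤ lookup τ zero) (sym (first zero refl)) (1≤τ zero)
    beside τ τ̄ 1≤τ first bound (suc i) =
      ℕ.≤-trans (bound (suc i) (inject₁ i) (cong suc (sym (Fin.toℕ-inject₁ i)))) (ℕ.m⊓n≤m _ _)

  standing-positive : ∀ {k α α′} → Exchange k α α′ → All (1 ≤_) α → All (1 ≤_) α′ →
    SchurPositive (⟦ toList σ ++ α′ ++ toList τ ∣ toList σ̄ ++ replicate k 1 ++ toList τ̄ ⟧ ⊖
                   ⟦ toList σ ++ α ++ toList τ ∣ toList σ̄ ++ replicate k 1 ++ toList τ̄ ⟧)
  standing-positive {k} E p p′ =
    exchange-positive E (toList σ) (toList σ̄) (toList τ) (toList τ̄)
      (trans (Vec.length-toList σ) (sym (Vec.length-toList σ̄)))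
      (ends-with-one σ̄ σ̄-last) (starts-with-one τ̄ τ̄-first)
      (valid p (Exchange.lengths E)) (valid p′ (Exchange.lengths′ E))
    where
    valid : ∀ {α} → All (1 ≤_) α → length α ≡ suc k →
            Valid (toList σ ++ α ++ toList τ) (toList σ̄ ++ replicate k 1 ++ toList τ̄)
    valid (p ∷ ps) eq = valid-left σ σ̄ p σ-positive σ̄-last σ̄-bound (valid-ones k eq (p ∷ ps) standing-right)

theorem3p1 : ∀ {s t : ℕ} (σ σ̄ : Vec ℕ s) (τ τ̄ : Vec ℕ t) → StandingHypothesis σ σ̄ τ τ̄ →
    (∀ (a b : ℕ) → b ≤ a → 2 ≤ b →
    SchurPositive
    (⟦ toList σ ++ a ∷ b ∷ toList τ ∣ toList σ̄ ++ 1 ∷ toList τ̄ ⟧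
    ⊖ ⟦ toList σ ++ (a + 1) ∷ (b ∸ 1) ∷ toList τ ∣ toList σ̄ ++ 1 ∷ toList τ̄ ⟧))
    × (∀ (a n : ℕ) → 2 ≤ a → 2 ≤ n →
    SchurPositive
    (⟦ toList σ ++ replicate n a ++ toList τ ∣ toList σ̄ ++ replicate (n ∸ 1) 1 ++ toList τ̄ ⟧
    ⊖ ⟦ toList σ ++ (a + 1) ∷ replicate (n ∸ 2) a ++ (a ∸ 1) ∷ toList τ ∣ toList σ̄ ++ replicate (n ∸ 1) 1 ++ toList τ̄ ⟧))
theorem3p1 σ σ̄ τ τ̄ hyp = part-i , part-ii
  where
  part-i : ∀ a b → b ≤ a → 2 ≤ b → _
  part-i a b b≤a 2≤b@(s≤s 1≤b) = standing-positive σ σ̄ τ τ̄ hyp (twoRows a b b≤a 2≤b)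
    (ℕ.m≤n+m 1 a ∷ 1≤b ∷ []) (ℕ.≤-trans (ℕ.≤-trans (ℕ.n≤1+n 1) 2≤b) b≤a ∷ s≤s z≤n ∷ [])

  part-ii : ∀ a n → 2 ≤ a → 2 ≤ n → _
  part-ii a (suc zero)    _           (s≤s ())
  part-ii a (suc (suc k)) (s≤s 1≤a) _ =
    -- The exchange treats the row of length `a ∸ 1` as the end of the middle block, whereas the
    -- statement attaches it to `τ`.
    subst (λ z → SchurPositive
             (⟦ toList σ ++ replicate (2 + k) a ++ toList τ ∣ toList σ̄ ++ replicate (suc k) 1 ++ toList τ̄ ⟧
               ⊖ ⟦ toList σ ++ a + 1 ∷ z ∣ toList σ̄ ++ replicate (suc k) 1 ++ toList τ̄ ⟧))
      (List.++-assoc (replicate k a) (a ∸ 1 ∷ []) (toList τ))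
      (standing-positive σ σ̄ τ τ̄ hyp (equalRows a k (s≤s z≤n))
        (ℕ.m≤n+m 1 a ∷ All.++⁺ (All.replicate⁺ k (s≤s z≤n)) (1≤a ∷ []))
        (All.replicate⁺ (2 + k) (s≤s z≤n)))
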